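{- Let $\mu$ be a distribution on $\Sigma\times\Gamma\times\Phi$ (finite sets), $\Sigma'\subseteq\Sigma$, and $T:\mathsf{supp}(\mu)\to\mathbb{D}$ nonembeddable over $\mathbb{D}$, such that $(\mu,\Sigma',T)$ satisfies the relaxed base case. Then there are constants $c=c(T,\mu)>0$ and $C=C(T,\mu)>0$ such that for all $n$, $d$, all $G:\Gamma^n\to\mathbb{C}$, $H:\Phi^n\to\mathbb{C}$, and every $F:\Sigma^n\to\mathbb{C}$ that is effectively homogeneous of effective degree $d$, $$\left|\mathbb{E}_{(x,y,z)\sim\mu^{\otimes n}}\Big[F(x)G(y)H(z)\prod_{i=1}^nT(x_i,y_i,z_i)\Big]\right|\le 2^{ -c\cdot d(d/n)^C}\|F\|_2\|G\|_2\|H\|_2.$$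
   Context: $\mathbb{D}$ is the closed unit disk. $T$ is nonembeddable over $\mathbb{D}$ if there are no $A:\Sigma\to\mathbb{D}$, $B:\Gamma\to\mathbb{D}$, $C:\Phi\to\mathbb{D}$ with $A(x)B(y)C(z)T(x,y,z)=1$ on $\mathsf{supp}(\mu)$. Norms are $L_2$ norms with respect to the marginals $\mu_x^{\otimes n},\mu_y^{\otimes n},\mu_z^{\otimes n}$ (resp. $\mu_x,\mu_y,\mu_z$ for $n=1$). Let $M=\max\{|\Sigma|,|\Gamma|,|\Phi|\}$. For $F:\Sigma\to\mathbb{C}$ put $I_{\mathsf{eff}}[F]=\mathbb{E}_{x,x'\sim\mu_x\text{ indep.}}[1_{x,x'\in\Sigma'}|F(x)-F(x')|^2]$. $(\mu,\Sigma',T)$ satisfies the relaxed base case if: (i) the marginal $\mu_{y,z}$ is a product distribution; (ii) for $(x,y,z)\in\mathsf{supp}(\mu)$, $(y,z)$ determines $x$; (iii) there is a constant $c_0=c_0(T,\mu)>0$ such that for every $\tau>0$ and all $F:\Sigma\to\mathbb{C}$, $G:\Gamma\to\mathbb{C}$, $H:\Phi\to\mathbb{C}$ with $I_{\mathsf{eff}}[F]\ge\tau\|F\|_2^2$, one has $|\mathbb{E}_{(x,y,z)\sim\mu}[F(x)G(y)H(z)T(x,y,z)]|\le(1-c_0\tau^{100M})\|F\|_2\|G\|_2\|H\|_2$. Effective degree: take an orthonormal basis $B=B_1\cup B_2$ of $L_2(\Sigma,\mu_x)$ where $B_1$ is an orthonormal basis of the functions constant on $\Sigma'$ and contains the constant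 function, and $B_2$ is an orthonormal basis of the functions supported on $\Sigma'$ orthogonal to constants. For $\chi=\chi_1\otimes\cdots\otimes\chi_n\in B^{\otimes n}$, $\mathsf{effdeg}(\chi)=|\{i:\chi_i\in B_2\}|$. $F:\Sigma^n\to\mathbb{C}$ is effectively homogeneous of effective degree $d$ if $F=\sum_{\chi\in B^{\otimes n}:\,\mathsf{effdeg}(\chi)=d}\hat F(\chi)\chi$. -}

module Defs where

open import Level using (0ℓ)
open import Algebra.Bundles using (CommutativeRing)
open import Algebra.Bundles.Raw using (RawRing)
import Algebra.Definitions.RawSemiring as RawSemiringDefinitions
open import Axiom.ExcludedMiddle using (ExcludedMiddle)
open import Data.Bool.Base using (if_then_else_; _∧_)
open import Data.Empty using (⊥-elim)
open import Data.Fin.Base using (Fin; splitAt)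
open import Data.Fin.Subset using (Subset; _∈_; _∉_)
open import Data.Fin.Subset.Properties using (_∈?_)
open import Data.List.Base as List using (List; []; _∷_; allFin; cartesianProduct; cartesianProductWith)
open import Data.Nat.Base as ℕ using (ℕ; zero; suc)
import Data.Nat.Properties as ℕ
open import Data.Product.Base using (Σ-syntax; ∃; _×_; _,_; proj₁; proj₂)
open import Data.Sum.Base using (_⊎_; inj₁; inj₂; [_,_]′)
open import Data.Vec.Base as Vec using (Vec; lookup)
open import Data.Vec.Functional using (_++_)
open import Function.Base using (const)
open import Relation.Binary.Core using (Rel)
open import Relation.Binary.PropositionalEquality.Core using (_≡_; _≢_)
open import Relation.Binary.Structures using (IsDecTotalOrder)
open import Relation.Nullary using (¬_; Dec; yes; no; does)
open import Relation.Unary using (Pred)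

-- The real numbers, axiomatised (up to isomorphism) as a complete ordered field.
-- `_⁻¹` and `sup` are total functions which are only constrained where the
-- inverse, respectively the supremum, makes sense.  A decidable order together
-- with suprema that are approximated by elements of the set gives excluded
-- middle for `Set` (see `excludedMiddle` below), so this is the classical real
-- line and not one of its constructive variants.
record CompleteOrderedField : Set₁ where
  field
    commutativeRing : CommutativeRing 0ℓ 0ℓ

  open CommutativeRing commutativeRing public renaming (Carrier to ℝ)

  infix  4 _≤_ _<_
  infix  9 _⁻¹

  field
    _≤_             : Rel ℝ 0ℓ
    isDecTotalOrder : IsDecTotalOrder _≈_ _≤_

  _<_ : Rel ℝ 0ℓ
  x < y = ¬ (y ≤ x)

  BoundedAbove : Pred ℝ 0ℓ → Set
  BoundedAbove P = Σ[ u ∈ ℝ ] (∀ x → P x → x ≤ u)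

  field
    0<1        : 0# < 1#
    +-monoˡ-≤  : ∀ {x y} z → x ≤ y → x + z ≤ y + z
    *-nonNeg   : ∀ {x y} → 0# ≤ x → 0# ≤ y → 0# ≤ x * y
    _⁻¹        : ℝ → ℝ
    ⁻¹-inverse : ∀ {x} → ¬ (x ≈ 0#) → x * x ⁻¹ ≈ 1#
    sup        : Pred ℝ 0ℓ → ℝ
    sup-upper  : ∀ P → BoundedAbove P → ∀ x → P x → x ≤ sup P
    sup-approx : ∀ P → ∃ P → BoundedAbove P → ∀ y → y < sup P → Σ[ x ∈ ℝ ] (P x × y < x)

  open IsDecTotalOrder isDecTotalOrder public
    using (_≟_; _≤?_)
    renaming (reflexive to ≤-reflexive; refl to ≤-refl; trans to ≤-trans; total to ≤-total)

  excludedMiddle : ExcludedMiddle 0ℓ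
  excludedMiddle {P} = decide (sup S ≤? 0#)
    where
    S : Pred ℝ 0ℓ
    S x = x ≈ 0# ⊎ (x ≈ 1# × P)

    0≤1 : 0# ≤ 1#
    0≤1 = [ (λ 0≤1 → 0≤1) , (λ 1≤0 → ⊥-elim (0<1 1≤0)) ]′ (≤-total 0# 1#)

    bounded : BoundedAbove S
    bounded = 1# , λ where
      x (inj₁ x≈0)       → ≤-trans (≤-reflexive x≈0) 0≤1
      x (inj₂ (x≈1 , _)) → ≤-reflexive x≈1

    decide : Dec (sup S ≤ 0#) → Dec P
    decide (yes supS≤0) = no λ p →
      0<1 (≤-trans (sup-upper S bounded 1# (inj₂ (refl , p))) supS≤0)
    decide (no supS≰0) with sup-approx S (0# , inj₁ refl) bounded 0# supS≰0
    ... | x , inj₁ x≈0 , 0<x     = ⊥-elim (0<x (≤-reflexive x≈0))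
    ... | x , inj₂ (_ , p) , 0<x = yes p

module Theory (ℛ : CompleteOrderedField) where

  open CompleteOrderedField ℛ public

  private
    module Real = RawSemiringDefinitions (RawRing.rawSemiring rawRing)

  open Real public using (_^_)

  fromℕ : ℕ → ℝ
  fromℕ n = n Real.× 1#

  √_ : ℝ → ℝ
  √ x = sup (λ y → 0# ≤ y × y * y ≤ x)

  -- For a ≥ 1, aˣ is the supremum of the rational powers a^((m - k) / q) with
  -- (m - k) / q ≤ x.  The inequality y ≤ a^((m - k) / q) is written without
  -- roots and negative exponents as y^q a^k ≤ a^m.
  pow≥1 : ℝ → ℝ → ℝ
  pow≥1 a x = sup λ y → Σ[ m ∈ ℕ ] Σ[ k ∈ ℕ ] Σ[ q ∈ ℕ ]
    (1 ℕ.≤ q × fromℕ m ≤ fromℕ q * x + fromℕ k × 0# ≤ y × y ^ q * a ^ k ≤ a ^ m)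

  -- Real powers of a nonnegative base, with 0ˣ = 0 for x ≠ 0 and 0⁰ = 1.
  infixr 8 _^ʳ_
  _^ʳ_ : ℝ → ℝ → ℝ
  a ^ʳ x =
    if does (1# ≤? a) then pow≥1 a x
    else if does (a ≤? 0#) then (if does (x ≟ 0#) then 1# else 0#)
    else (pow≥1 (a ⁻¹) x) ⁻¹

  infix 5 _+i_
  record ℂ : Set where
    constructor _+i_
    field
      re im : ℝ
  open ℂ public

  infix  4 _≈ᶜ_
  infixl 6 _+ᶜ_ _-ᶜ_
  infixl 7 _*ᶜ_ _·ᶜ_

  _≈ᶜ_ : Rel ℂ 0ℓ
  w ≈ᶜ z = re w ≈ re z × im w ≈ im z

  0ᶜ 1ᶜ : ℂ
  0ᶜ = 0# +i 0#
  1ᶜ = 1# +i 0#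

  _+ᶜ_ _*ᶜ_ _-ᶜ_ : ℂ → ℂ → ℂ
  w +ᶜ z = (re w + re z) +i (im w + im z)
  w *ᶜ z = (re w * re z - im w * im z) +i (re w * im z + im w * re z)
  w -ᶜ z = (re w - re z) +i (im w - im z)

  -ᶜ_ conj : ℂ → ℂ
  -ᶜ z   = (- re z) +i (- im z)
  conj z = re z +i (- im z)

  _·ᶜ_ : ℝ → ℂ → ℂ
  r ·ᶜ z = (r * re z) +i (r * im z)

  ∣_∣² ∣_∣ : ℂ → ℝ
  ∣ z ∣² = re z * re z + im z * im z
  ∣ z ∣  = √ ∣ z ∣²

  ℂ-rawRing : RawRing 0ℓ 0ℓ
  ℂ-rawRing = record
    { Carrier = ℂ ; _≈_ = _≈ᶜ_ ; _+_ = _+ᶜ_ ; _*_ = _*ᶜ_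
    ; -_ = -ᶜ_ ; 0# = 0ᶜ ; 1# = 1ᶜ }

  private
    module Complex = RawSemiringDefinitions (RawRing.rawSemiring ℂ-rawRing)

  ∏ : ∀ {n} → (Fin n → ℝ) → ℝ
  ∏ = Real.product

  ∏ᶜ : ∀ {n} → (Fin n → ℂ) → ℂ
  ∏ᶜ = Complex.product

  ∑ : {A : Set} → List A → (A → ℝ) → ℝ
  ∑ xs f = List.foldr (λ a → f a +_) 0# xs

  ∑ᶜ : {A : Set} → List A → (A → ℂ) → ℂ
  ∑ᶜ xs f = List.foldr (λ a → f a +ᶜ_) 0ᶜ xs

  -- A finite set, enumerated without repetition by `points` in every use below,
  -- with a real weight on each point.
  record Weighted (Ω : Set) : Set where
    field
      points : List Ω
      weight : Ω → ℝ
  open Weighted public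

  record IsDistribution {Ω : Set} (μ : Weighted Ω) : Set where
    field
      nonNegative : ∀ ω → 0# ≤ weight μ ω
      total       : ∑ (points μ) (weight μ) ≈ 1#

  words : {A : Set} → List A → ∀ n → List (Vec A n)
  words as zero    = Vec.[] ∷ []
  words as (suc n) = cartesianProductWith Vec._∷_ as (words as n)

  infix 10 _^⊗_
  _^⊗_ : {Ω : Set} → Weighted Ω → ∀ n → Weighted (Vec Ω n)
  μ ^⊗ n = record
    { points = words (points μ) n
    ; weight = λ ω → ∏ (λ i → weight μ (lookup ω i)) }

  𝔼 : {Ω : Set} → Weighted Ω → (Ω → ℝ) → ℝ
  𝔼 μ f = ∑ (points μ) (λ ω → weight μ ω * f ω)

  𝔼ᶜ : {Ω : Set} → Weighted Ω → (Ω → ℂ) → ℂ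
  𝔼ᶜ μ f = ∑ᶜ (points μ) (λ ω → weight μ ω ·ᶜ f ω)

  supp : {Ω : Set} → Weighted Ω → Pred Ω 0ℓ
  supp μ ω = 0# < weight μ ω

  ⟨_,_⟩[_] : {Ω : Set} → (Ω → ℂ) → (Ω → ℂ) → Weighted Ω → ℂ
  ⟨ f , g ⟩[ μ ] = 𝔼ᶜ μ (λ ω → f ω *ᶜ conj (g ω))

  ‖_‖[_] : {Ω : Set} → (Ω → ℂ) → Weighted Ω → ℝ
  ‖ f ‖[ μ ] = √ (𝔼 μ (λ ω → ∣ f ω ∣²))

  -- Equality in L₂(Ω, μ), i.e. almost everywhere.
  _≐_[_] : {Ω : Set} → (Ω → ℂ) → (Ω → ℂ) → Weighted Ω → Set
  f ≐ g [ μ ] = ∀ ω → supp μ ω → f ω ≈ᶜ g ω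

  -- An orthonormal basis of the subspace V of L₂(Ω, μ); its vectors are given
  -- by representatives in V.
  record IsOrthonormalBasis {Ω : Set} (μ : Weighted Ω) (V : Pred (Ω → ℂ) 0ℓ)
                            {k : ℕ} (b : Fin k → Ω → ℂ) : Set where
    field
      inside     : ∀ i → V (b i)
      normalised : ∀ i → ⟨ b i , b i ⟩[ μ ] ≈ᶜ 1ᶜ
      orthogonal : ∀ i j → i ≢ j → ⟨ b i , b j ⟩[ μ ] ≈ᶜ 0ᶜ
      spanning   : ∀ f → V f → Σ[ a ∈ (Fin k → ℂ) ]
                   f ≐ (λ ω → ∑ᶜ (allFin k) (λ i → a i *ᶜ b i ω)) [ μ ]

  module _ {s g p : ℕ} where

    dist : (Fin s × Fin g × Fin p → ℝ) → Weighted (Fin s × Fin g × Fin p)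
    dist μ = record
      { points = cartesianProduct (allFin s) (cartesianProduct (allFin g) (allFin p))
      ; weight = μ }

    module _ (μ : Fin s × Fin g × Fin p → ℝ) where

      marginalˣ : Weighted (Fin s)
      marginalˣ = record
        { points = allFin s
        ; weight = λ x → ∑ (allFin g) λ y → ∑ (allFin p) λ z → μ (x , y , z) }

      marginalʸ : Weighted (Fin g)
      marginalʸ = record
        { points = allFin g
        ; weight = λ y → ∑ (allFin s) λ x → ∑ (allFin p) λ z → μ (x , y , z) }

      marginalᶻ : Weighted (Fin p)
      marginalᶻ = record
        { points = allFin p
        ; weight = λ z → ∑ (allFin s) λ x → ∑ (allFin g) λ y → μ (x , y , z) }

      marginalʸᶻ : Weighted (Fin g × Fin p)
      marginalʸᶻ = record
        { points = cartesianProduct (allFin g) (allFin p)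
        ; weight = λ (y , z) → ∑ (allFin s) λ x → μ (x , y , z) }

      -- T : supp μ → 𝔻 is represented by a function on the whole product whose
      -- values outside the support are irrelevant: everywhere below, T is
      -- evaluated on the support or its value is multiplied by a weight 0.
      DiskValuedOnSupport : (Fin s × Fin g × Fin p → ℂ) → Set
      DiskValuedOnSupport T = ∀ ω → supp (dist μ) ω → ∣ T ω ∣ ≤ 1#

      EmbeddableOverDisk : (Fin s × Fin g × Fin p → ℂ) → Set
      EmbeddableOverDisk T =
        Σ[ A ∈ (Fin s → ℂ) ] Σ[ B ∈ (Fin g → ℂ) ] Σ[ C ∈ (Fin p → ℂ) ]
          ((∀ x → ∣ A x ∣ ≤ 1#) × (∀ y → ∣ B y ∣ ≤ 1#) × (∀ z → ∣ C z ∣ ≤ 1#) ×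
           (∀ x y z → supp (dist μ) (x , y , z) →
             A x *ᶜ B y *ᶜ C z *ᶜ T (x , y , z) ≈ᶜ 1ᶜ))

      effectiveInfluence : Subset s → (Fin s → ℂ) → ℝ
      effectiveInfluence Σ′ F =
        𝔼 marginalˣ λ x → 𝔼 marginalˣ λ x′ →
          if does (x ∈? Σ′) ∧ does (x′ ∈? Σ′) then ∣ F x -ᶜ F x′ ∣² else 0#

      correlation : (Fin s × Fin g × Fin p → ℂ) →
                    ∀ n → (Vec (Fin s) n → ℂ) → (Vec (Fin g) n → ℂ) → (Vec (Fin p) n → ℂ) → ℂ
      correlation T n F G H = 𝔼ᶜ (dist μ ^⊗ n) λ ω →
        F (Vec.map proj₁ ω) *ᶜ G (Vec.map (λ t → proj₁ (proj₂ t)) ω)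
          *ᶜ H (Vec.map (λ t → proj₂ (proj₂ t)) ω) *ᶜ ∏ᶜ (λ i → T (lookup ω i))

      record RelaxedBaseCase (Σ′ : Subset s) (T : Fin s × Fin g × Fin p → ℂ) : Set where
        M : ℕ
        M = s ℕ.⊔ g ℕ.⊔ p
        field
          yz-product     : ∀ y z → weight marginalʸᶻ (y , z) ≈ weight marginalʸ y * weight marginalᶻ z
          yz-determine-x : ∀ x x′ y z → supp (dist μ) (x , y , z) → supp (dist μ) (x′ , y , z) → x ≡ x′
          influence-gap  : Σ[ c₀ ∈ ℝ ] (0# < c₀ ×
            (∀ τ → 0# < τ → (F : Fin s → ℂ) (G : Fin g → ℂ) (H : Fin p → ℂ) →
              τ * ‖ F ‖[ marginalˣ ] ^ 2 ≤ effectiveInfluence Σ′ F →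
              ∣ 𝔼ᶜ (dist μ) (λ (x , y , z) → F x *ᶜ G y *ᶜ H z *ᶜ T (x , y , z)) ∣
                ≤ (1# - c₀ * τ ^ (100 ℕ.* M))
                  * ‖ F ‖[ marginalˣ ] * ‖ G ‖[ marginalʸ ] * ‖ H ‖[ marginalᶻ ]))

      ConstantOn : Subset s → Pred (Fin s → ℂ) 0ℓ
      ConstantOn Σ′ f = ∀ x x′ → x ∈ Σ′ → x′ ∈ Σ′ → f x ≈ᶜ f x′

      SupportedOnMeanZero : Subset s → Pred (Fin s → ℂ) 0ℓ
      SupportedOnMeanZero Σ′ f =
        (∀ x → x ∉ Σ′ → f x ≈ᶜ 0ᶜ) × (∀ a → ⟨ f , const a ⟩[ marginalˣ ] ≈ᶜ 0ᶜ)

      -- The bases B₁ and B₂; the full basis B = B₁ ∪ B₂ is indexed by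
      -- Fin (k₁ + k₂), the first k₁ indices being those of B₁.
      record EffectiveBasis (Σ′ : Subset s) : Set where
        field
          k₁ k₂    : ℕ
          B₁       : Fin k₁ → Fin s → ℂ
          B₂       : Fin k₂ → Fin s → ℂ
          basis₁   : IsOrthonormalBasis marginalˣ (ConstantOn Σ′) B₁
          constant : ∃ λ i → ∀ x → B₁ i x ≈ᶜ 1ᶜ
          basis₂   : IsOrthonormalBasis marginalˣ (SupportedOnMeanZero Σ′) B₂

        B : Fin (k₁ ℕ.+ k₂) → Fin s → ℂ
        B = B₁ ++ B₂

        character : ∀ {n} → Vec (Fin (k₁ ℕ.+ k₂)) n → Vec (Fin s) n → ℂ
        character χ x = ∏ᶜ (λ i → B (lookup χ i) (lookup x i))

        effdeg : ∀ {n} → Vec (Fin (k₁ ℕ.+ k₂)) n → ℕ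
        effdeg χ = Vec.sum (Vec.map (λ i → [ const 0 , const 1 ]′ (splitAt k₁ i)) χ)

        fourier : ∀ {n} → (Vec (Fin s) n → ℂ) → Vec (Fin (k₁ ℕ.+ k₂)) n → ℂ
        fourier {n} F χ = ⟨ F , character χ ⟩[ marginalˣ ^⊗ n ]

        EffectivelyHomogeneous : ∀ {n} → ℕ → (Vec (Fin s) n → ℂ) → Set
        EffectivelyHomogeneous {n} d F =
          F ≐ (λ x → ∑ᶜ (words (allFin (k₁ ℕ.+ k₂)) n) λ χ →
                 if does (effdeg χ ℕ.≟ d) then fourier F χ *ᶜ character χ x else 0ᶜ)
            [ marginalˣ ^⊗ n ]

{-# OPTIONS --safe #-}
module Submission where

-- Expand F in characters.  By Cauchy-Schwarz it suffices to bound the weight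
-- S = Σ |Λ(χ)|² of the correlations Λ(χ) of the characters χ of effective
-- degree ≥ k with G and H by δ² ‖G‖² ‖H‖², where δ decays with the number of
-- coordinates peeled off.  Peeling off a coordinate i, put u(y,z) for the vector
-- of correlations of the slices G_y and H_z, so that ‖u(y,z)‖ ≤ δ ‖G_y‖ ‖H_z‖,
-- and let f(x) be the slices of the dual vector of (Λ(χ)).  If S were close to
-- δ² ‖G‖² ‖H‖², then T f(x) would be close to the conjugate of u(y,z), and
-- δ² ‖G_y‖² ‖H_z‖² - ‖u(y,z)‖² would be close to 0.  The latter is a nonnegative
-- form in (G_y, H_z), so by polarisation ⟨u(y,z), u(y₀,z₀)⟩ is close to
-- δ² ⟨G_y, G_y₀⟩ ⟨H_z, H_z₀⟩ for any two points.  Hence the scalar functions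
-- ⟨f(x), T₀ f(x₀)⟩, ⟨G_y, G_y₀⟩ and ⟨H_z, H_z₀⟩ nearly saturate the base case,
-- so ⟨f(x), T₀ f(x₀)⟩ has little effective influence for every x₀, and therefore
-- f nearly does not depend on x in Σ′.  This is impossible for a coordinate i
-- of average influence, since these influences add up to at least a constant
-- times k S.

-- None of the constants of a peeling step depends on the number of coordinates: vectors enter only
-- through norms and inner products, and the passage from averages to single atoms costs a factor
-- `A`, which is at least the reciprocal of every positive weight of `μ`. The bound concerns all
-- characters of effective degree at least `k`, not those of one degree, because removing a
-- coordinate lowers the degree by 0 or 1. Origin of the exponent, with ρ = d / n: the argument ends
-- in a contradiction once the squared distances of the vectors `f x` on Σ′ are below a constant
-- times ρ S. They are controlled through squared inner products, of size ρ² S², so the influence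
-- threshold τ of the base case is taken of order ρ². Its gain κ is then of order τ ^ (100 M), and
-- the relative loss η may be of order κ τ, that is ρ ^ (200 M + 2). Only about half of the `d`
-- degrees are spent, so that `k` stays at least d / 2 and the same η serves at every step.

open import Algebra.Bundles using (CommutativeRing)
open import Algebra.Bundles.Raw using (RawRing)
import Algebra.Definitions.RawSemiring as RawSemiringDefinitions
import Algebra.Properties.AbelianGroup as AbelianGroupProperties
import Algebra.Properties.CommutativeSemigroup as CommutativeSemigroupProperties
import Algebra.Properties.CommutativeSemiring.Exp as CommutativeExp
import Algebra.Properties.Ring as RingProperties
import Algebra.Properties.Semiring.Exp as SemiringExp
import Algebra.Properties.Semiring.Mult as SemiringMult
import Algebra.Properties.Semiring.Mult.TCOptimised as Mult
import Algebra.Solver.Ring as RingSolver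
open import Algebra.Solver.Ring.AlmostCommutativeRing using (_-Raw-AlmostCommutative⟶_; fromCommutativeRing)
open import Data.Bool.Base using (T; Bool; true; false; if_then_else_; _∧_)
open import Data.Empty using (⊥-elim)
open import Data.Fin.Base using (Fin; zero; suc; splitAt; join)
open import Data.Fin.Properties using (join-splitAt)
open import Data.Fin.Subset using (Subset; _∈_; _∉_)
open import Data.Fin.Subset.Properties using (_∈?_)
open import Data.Integer.Base as ℤ using (ℤ; +_; -[1+_])
import Data.Integer.Properties as ℤ
open import Data.List.Base as List using (List; []; _∷_; allFin; cartesianProductWith)
open import Data.List.Membership.Propositional using () renaming (_∈_ to _∈ˡ_)
open import Data.List.Membership.Propositional.Properties using (∈-allFin; ∈-cartesianProduct⁺)
open import Data.List.Properties using (map-tabulate)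
open import Data.List.Relation.Unary.Any using (here; there)
open import Data.Maybe.Base as Maybe using (Maybe; just; is-just)
open import Data.Nat.Base as ℕ using (ℕ; zero; suc; NonZero; ⌊_/2⌋; ⌈_/2⌉)
import Data.Nat.Properties as ℕ
open import Data.Product.Base using (_×_; proj₁; proj₂; Σ-syntax; _,_)
open import Data.Sum.Base using (_⊎_; inj₁; inj₂; [_,_]′)
open import Data.Vec.Base as Vec using (Vec; lookup; insertAt)
open import Data.Vec.N-ary using (N-ary; Eq; curryⁿ; curryⁿ-cong)
open import Data.Vec.Properties using (map-insertAt; insertAt-lookup; lookup-map)
open import Defs
open import Function.Base using (_∘_; const)
open import Level using (0ℓ)
open import Relation.Binary.Bundles using (Poset)
open import Relation.Binary.PropositionalEquality as ≡ using (_≡_; _≢_)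
import Relation.Binary.Reasoning.PartialOrder
import Relation.Binary.Reasoning.Setoid
open import Relation.Binary.Structures using (IsDecTotalOrder; IsEquivalence)
open import Relation.Nullary using (¬_; Dec; yes; no; does)
open import Relation.Nullary.Decidable using (dec⇒maybe; dec-true; dec-false)

-- The ring solver with integer coefficients

module IntegerCoefficients {c ℓ} (R : CommutativeRing c ℓ) where
  open CommutativeRing R
  open Mult semiring using (×-homo-+; ×1-homo-*; 1+×) renaming (_×_ to _×′_)
  open RingProperties ring using (-‿distribˡ-*; -‿distribʳ-*; -0#≈0#; -‿involutive)
  open AbelianGroupProperties +-abelianGroup using (⁻¹-∙-comm)
  open import Relation.Binary.Reasoning.Setoid setoid

  -- With the optimised multiple `_×′_` the coefficients 0 and 1 evaluate to `0#` and `1#` by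
  -- computation, so that `# 0` and `# 1` in a solver call match these constants in a goal.
  ⟦_⟧ᶻ : ℤ → Carrier
  ⟦ + n ⟧ᶻ      = n ×′ 1#
  ⟦ -[1+ n ] ⟧ᶻ = - (suc n ×′ 1#)

  ⊖-homo : ∀ m n → ⟦ m ℤ.⊖ n ⟧ᶻ ≈ m ×′ 1# - n ×′ 1#
  ⊖-homo zero zero = sym (-‿inverseʳ 0#)
  ⊖-homo zero (suc n) = sym (+-identityˡ _)
  ⊖-homo (suc m) zero = sym (trans (+-congˡ -0#≈0#) (+-identityʳ _))
  ⊖-homo (suc m) (suc n) = begin
    ⟦ suc m ℤ.⊖ suc n ⟧ᶻ                  ≡⟨ ≡.cong ⟦_⟧ᶻ (ℤ.[1+m]⊖[1+n]≡m⊖n m n) ⟩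
    ⟦ m ℤ.⊖ n ⟧ᶻ                          ≈⟨ ⊖-homo m n ⟩
    m ×′ 1# - n ×′ 1#                   ≈⟨ cancel (m ×′ 1#) (n ×′ 1#) ⟨
    (1# + m ×′ 1#) - (1# + n ×′ 1#)     ≈⟨ +-cong (1+× m 1#) (-‿cong (1+× n 1#)) ⟨
    suc m ×′ 1# - suc n ×′ 1#           ∎
    where
    cancel : ∀ x y → (1# + x) - (1# + y) ≈ x - y
    cancel x y = begin
      (1# + x) + - (1# + y)      ≈⟨ +-cong (+-comm _ _) (sym (⁻¹-∙-comm 1# y)) ⟩
      (x + 1#) + (- 1# + - y)    ≈⟨ +-assoc _ _ _ ⟩
      x + (1# + (- 1# + - y))    ≈⟨ +-congˡ (+-assoc _ _ _) ⟨
      x + ((1# + - 1#) + - y)    ≈⟨ +-congˡ (+-congʳ (-‿inverseʳ 1#)) ⟩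
      x + (0# + - y)             ≈⟨ +-congˡ (+-identityˡ _) ⟩
      x + - y                    ∎

  -‿homo : ∀ i → ⟦ ℤ.- i ⟧ᶻ ≈ - ⟦ i ⟧ᶻ
  -‿homo (+ zero)    = sym -0#≈0#
  -‿homo (+ (suc n)) = refl
  -‿homo -[1+ n ]    = sym (-‿involutive _)

  +-homo : ∀ i j → ⟦ i ℤ.+ j ⟧ᶻ ≈ ⟦ i ⟧ᶻ + ⟦ j ⟧ᶻ
  +-homo (+ m)    (+ n)    = ×-homo-+ 1# m n
  +-homo (+ m)    -[1+ n ] = ⊖-homo m (suc n)
  +-homo -[1+ m ] (+ n)    = trans (⊖-homo n (suc m)) (+-comm _ _)
  +-homo -[1+ m ] -[1+ n ] = begin
    - (suc (suc (m ℕ.+ n)) ×′ 1#)         ≡⟨ ≡.cong (λ k → - (suc k ×′ 1#)) (ℕ.+-suc m n) ⟨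
    - ((suc m ℕ.+ suc n) ×′ 1#)           ≈⟨ -‿cong (×-homo-+ 1# (suc m) (suc n)) ⟩
    - (suc m ×′ 1# + suc n ×′ 1#)         ≈⟨ ⁻¹-∙-comm _ _ ⟨
    - (suc m ×′ 1#) + - (suc n ×′ 1#)     ∎

  *-pos-homo : ∀ m n → ⟦ + m ℤ.* + n ⟧ᶻ ≈ (m ×′ 1#) * (n ×′ 1#)
  *-pos-homo m n = begin
    ⟦ + m ℤ.* + n ⟧ᶻ        ≡⟨ ≡.cong ⟦_⟧ᶻ (ℤ.pos-* m n) ⟨
    (m ℕ.* n) ×′ 1#         ≈⟨ ×1-homo-* m n ⟩
    (m ×′ 1#) * (n ×′ 1#)   ∎

  *-homo : ∀ i j → ⟦ i ℤ.* j ⟧ᶻ ≈ ⟦ i ⟧ᶻ * ⟦ j ⟧ᶻ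
  *-homo (+ m)    (+ n)    = *-pos-homo m n
  *-homo (+ m)    -[1+ n ] = begin
    ⟦ + m ℤ.* -[1+ n ] ⟧ᶻ                ≡⟨ ≡.cong ⟦_⟧ᶻ (ℤ.neg-distribʳ-* (+ m) (+ suc n)) ⟨
    ⟦ ℤ.- (+ m ℤ.* + suc n) ⟧ᶻ           ≈⟨ -‿homo (+ m ℤ.* + suc n) ⟩
    - ⟦ + m ℤ.* + suc n ⟧ᶻ               ≈⟨ -‿cong (*-pos-homo m (suc n)) ⟩
    - ((m ×′ 1#) * (suc n ×′ 1#))        ≈⟨ -‿distribʳ-* _ _ ⟩
    (m ×′ 1#) * - (suc n ×′ 1#)          ∎
  *-homo -[1+ m ] (+ n)    = begin
    ⟦ -[1+ m ] ℤ.* + n ⟧ᶻ                ≡⟨ ≡.cong ⟦_⟧ᶻ (ℤ.neg-distribˡ-* (+ suc m) (+ n)) ⟨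
    ⟦ ℤ.- (+ suc m ℤ.* + n) ⟧ᶻ           ≈⟨ -‿homo (+ suc m ℤ.* + n) ⟩
    - ⟦ + suc m ℤ.* + n ⟧ᶻ               ≈⟨ -‿cong (*-pos-homo (suc m) n) ⟩
    - ((suc m ×′ 1#) * (n ×′ 1#))        ≈⟨ -‿distribˡ-* _ _ ⟩
    - (suc m ×′ 1#) * (n ×′ 1#)          ∎
  *-homo -[1+ m ] -[1+ n ] = begin
    ⟦ + suc m ℤ.* + suc n ⟧ᶻ                     ≈⟨ *-pos-homo (suc m) (suc n) ⟩
    (suc m ×′ 1#) * (suc n ×′ 1#)                ≈⟨ -‿involutive _ ⟨
    - - ((suc m ×′ 1#) * (suc n ×′ 1#))          ≈⟨ -‿cong (-‿distribʳ-* _ _) ⟩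
    - ((suc m ×′ 1#) * - (suc n ×′ 1#))          ≈⟨ -‿distribˡ-* _ _ ⟩
    - (suc m ×′ 1#) * - (suc n ×′ 1#)            ∎

  morphism : ℤ.+-*-rawRing -Raw-AlmostCommutative⟶ fromCommutativeRing R
  morphism = record
    { ⟦_⟧ = ⟦_⟧ᶻ ; +-homo = +-homo ; *-homo = *-homo ; -‿homo = -‿homo
    ; 0-homo = refl ; 1-homo = refl }

  _coeff≟_ : ∀ i j → Maybe (⟦ i ⟧ᶻ ≈ ⟦ j ⟧ᶻ)
  i coeff≟ j = Maybe.map (λ i≡j → reflexive (≡.cong ⟦_⟧ᶻ i≡j)) (dec⇒maybe (i ℤ.≟ j))

  module Solver = RingSolver ℤ.+-*-rawRing (fromCommutativeRing R) morphism _coeff≟_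
  open Solver public using (Polynomial; _:+_; _:*_; :-_; _:-_; _:=_)
  open Solver using (con; normalise; _≟N_; ⟦_⟧N-cong; correct; ⟦_⟧; ⟦_⟧N; ⟦_⟧↓; var)
  open import Relation.Binary.Reflection setoid var ⟦_⟧ ⟦_⟧↓ correct using (close)

  infix 10 #_
  #_ : ∀ {n} → ℕ → Polynomial n
  # k = con (+ k)

  -- Unlike the standard `solve`, the two normal forms are compared as closed
  -- data and not after they have been evaluated at the atoms.
  solve : ∀ n (f : N-ary n (Polynomial n) (Polynomial n × Polynomial n)) →
          {T (is-just (normalise (proj₁ (close n f)) ≟N normalise (proj₂ (close n f))))} →
          Eq n _≈_ (curryⁿ ⟦ proj₁ (close n f) ⟧) (curryⁿ ⟦ proj₂ (close n f) ⟧)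
  solve n f {same} = curryⁿ-cong _≈_ ⟦ e₁ ⟧ ⟦ e₂ ⟧ λ ρ → agree ρ (normalise e₁ ≟N normalise e₂) same
    where
    e₁ e₂ : Polynomial n
    e₁ = proj₁ (close n f)
    e₂ = proj₂ (close n f)

    agree : ∀ ρ (e : Maybe _) → T (is-just e) → ⟦ e₁ ⟧ ρ ≈ ⟦ e₂ ⟧ ρ
    agree ρ (just eq) _ = begin
      ⟦ e₁ ⟧ ρ            ≈⟨ correct e₁ ρ ⟨
      ⟦ normalise e₁ ⟧N ρ ≈⟨ ⟦ eq ⟧N-cong ρ ⟩
      ⟦ normalise e₂ ⟧N ρ ≈⟨ correct e₂ ρ ⟩
      ⟦ e₂ ⟧ ρ            ∎

-- Complete ordered fields

module RealFieldProperties (ℛ : CompleteOrderedField) where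
  open Theory ℛ
  open IntegerCoefficients commutativeRing public using (⟦_⟧ᶻ; solve; #_; _:+_; _:*_; :-_; _:-_; _:=_; Polynomial)
  open SemiringMult semiring public using (×-homo-+; ×1-homo-*)
  open SemiringExp semiring public using (^-congˡ; ^-homo-*; ^-assocʳ)
  open CommutativeExp commutativeSemiring public using (^-distrib-*)

  private
    poset : Poset 0ℓ 0ℓ 0ℓ
    poset = record { isPartialOrder = IsDecTotalOrder.isPartialOrder isDecTotalOrder }
  open IsDecTotalOrder isDecTotalOrder public using (antisym; ≤-respˡ-≈; ≤-respʳ-≈)
  module ≈-Reasoning = Relation.Binary.Reasoning.Setoid setoid
  module ≤-Reasoning = Relation.Binary.Reasoning.PartialOrder poset

  -- The evaluation used by the solver, so `num k` and `# k` agree by computation. In contrast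
  -- `fromℕ 2` is `1# + (1# + 0#)`, and the solver calls about it spell this out.
  num : ℕ → ℝ
  num n = ⟦ ℤ.+ n ⟧ᶻ

  -- The workhorse for polynomial inequalities: `t` is a certificate, a sum of products of
  -- nonnegative terms assembled with `_⊹_` and `_⊠_`, and the solver checks that it equals the
  -- difference of the two sides.
  ≤-via : ∀ {x y t} → 0# ≤ t → y - x ≈ t → x ≤ y
  ≤-via {x} {y} {t} 0≤t eq = ≤-respˡ-≈ (+-identityˡ x) (≤-respʳ-≈ restore (+-monoˡ-≤ x 0≤t))
    where
    restore : t + x ≈ y
    restore = trans (+-congʳ (sym eq)) (solve 2 (λ x y → (y :- x) :+ x := y) x y)

  gap : ∀ {x y} → x ≤ y → 0# ≤ y - x
  gap {x} {y} x≤y = ≤-respˡ-≈ (-‿inverseʳ x) (+-monoˡ-≤ (- x) x≤y)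

  infixr 6 _⊹_
  infixr 7 _⊠_

  _⊹_ : ∀ {x y} → 0# ≤ x → 0# ≤ y → 0# ≤ x + y
  _⊹_ {x} {y} 0≤x 0≤y = ≤-trans 0≤y (≤-via 0≤x (solve 2 (λ x y → (x :+ y) :- y := x) x y))

  _⊠_ : ∀ {x y} → 0# ≤ x → 0# ≤ y → 0# ≤ x * y
  _⊠_ = *-nonNeg

  <⇒≤ : ∀ {x y} → x < y → x ≤ y
  <⇒≤ {x} {y} x<y = [ (λ x≤y → x≤y) , (λ y≤x → ⊥-elim (x<y y≤x)) ]′ (≤-total x y)

  ≰⇒≥ : ∀ {x y} → ¬ (x ≤ y) → y ≤ x
  ≰⇒≥ = <⇒≤

  0≤1 : 0# ≤ 1#
  0≤1 = <⇒≤ 0<1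

  0≤num : ∀ n → 0# ≤ num n
  0≤num 0             = ≤-refl
  0≤num 1             = 0≤1
  0≤num (suc (suc n)) = 0≤num (suc n) ⊹ 0≤1

  square-nonNeg : ∀ x → 0# ≤ x * x
  square-nonNeg x with ≤-total 0# x
  ... | inj₁ 0≤x = 0≤x ⊠ 0≤x
  ... | inj₂ x≤0 = ≤-respʳ-≈ (solve 1 (λ x → (# 0 :- x) :* (# 0 :- x) := x :* x) x) (gap x≤0 ⊠ gap x≤0)

  +-mono-≤ : ∀ {a b c d} → a ≤ b → c ≤ d → a + c ≤ b + d
  +-mono-≤ {a} {b} {c} {d} p q = ≤-via (gap p ⊹ gap q)
    (solve 4 (λ a b c d → (b :+ d) :- (a :+ c) := (b :- a) :+ (d :- c)) a b c d)

  *-monoˡ-≤ : ∀ {c a b} → 0# ≤ c → a ≤ b → c * a ≤ c * b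
  *-monoˡ-≤ {c} {a} {b} 0≤c a≤b = ≤-via (0≤c ⊠ gap a≤b) (solve 3 (λ a b c → c :* b :- c :* a := c :* (b :- a)) a b c)

  *-monoʳ-≤ : ∀ {c a b} → 0# ≤ c → a ≤ b → a * c ≤ b * c
  *-monoʳ-≤ {c} {a} {b} 0≤c a≤b = ≤-via (0≤c ⊠ gap a≤b) (solve 3 (λ a b c → b :* c :- a :* c := c :* (b :- a)) a b c)

  *-mono-≤ : ∀ {a b c d} → 0# ≤ a → 0# ≤ d → a ≤ b → c ≤ d → a * c ≤ b * d
  *-mono-≤ 0≤a 0≤d a≤b c≤d = ≤-trans (*-monoˡ-≤ 0≤a c≤d) (*-monoʳ-≤ 0≤d a≤b)

  0<⇒≉0 : ∀ {x} → 0# < x → ¬ (x ≈ 0#)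
  0<⇒≉0 0<x x≈0 = 0<x (≤-reflexive x≈0)

  <-≤-trans : ∀ {x y z} → x < y → y ≤ z → x < z
  <-≤-trans x<y y≤z z≤x = x<y (≤-trans y≤z z≤x)

  ≤-<-trans : ∀ {x y z} → x ≤ y → y < z → x < z
  ≤-<-trans x≤y y<z z≤x = y<z (≤-trans z≤x x≤y)

  0<-respʳ-≈ : ∀ {x y} → x ≈ y → 0# < x → 0# < y
  0<-respʳ-≈ x≈y 0<x y≤0 = 0<x (≤-respˡ-≈ (sym x≈y) y≤0)

  gap-< : ∀ {x y} → x < y → 0# < y - x
  gap-< {x} {y} x<y y-x≤0 = x<y (≤-via (gap y-x≤0) (solve 2 (λ x y → x :- y := # 0 :- (y :- x)) x y))

  <-via : ∀ {x y t} → 0# < t → y - x ≈ t → x < y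
  <-via {x} {y} {t} 0<t eq y≤x = 0<t (≤-via (gap y≤x)
    (trans (+-congˡ (-‿cong (sym eq))) (solve 2 (λ x y → # 0 :- (y :- x) := x :- y) x y)))

  ⁻¹-pos : ∀ {x} → 0# < x → 0# < x ⁻¹
  ⁻¹-pos {x} 0<x x⁻¹≤0 = 0<1 (≤-via (<⇒≤ 0<x ⊠ gap x⁻¹≤0) (trans (+-congˡ (-‿cong (sym (⁻¹-inverse (0<⇒≉0 0<x)))))
    (solve 2 (λ x i → # 0 :- (x :* i) := x :* (# 0 :- i)) x (x ⁻¹))))

  *-pos : ∀ {x y} → 0# < x → 0# < y → 0# < x * y
  *-pos {x} {y} 0<x 0<y xy≤0 = 0<y (≤-via (gap xy≤0 ⊠ <⇒≤ (⁻¹-pos 0<x)) (begin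
    0# - y                     ≈⟨ solve 1 (λ y → # 0 :- y := (# 0 :- # 1 :* y)) y ⟩
    0# - 1# * y                ≈⟨ +-congˡ (-‿cong (*-congʳ (⁻¹-inverse (0<⇒≉0 0<x)))) ⟨
    0# - x * x ⁻¹ * y          ≈⟨ solve 3 (λ x i y → # 0 :- (x :* i) :* y := (# 0 :- x :* y) :* i) x (x ⁻¹) y ⟩
    (0# - x * y) * x ⁻¹        ∎))
    where open ≈-Reasoning

  +-pos-≤ : ∀ {x y} → 0# < x → 0# ≤ y → 0# < x + y
  +-pos-≤ {x} {y} 0<x 0≤y = <-≤-trans 0<x (≤-via 0≤y (solve 2 (λ x y → (x :+ y) :- x := y) x y))

  0<num : ∀ n → 0# < num (suc n)
  0<num zero    = 0<1
  0<num (suc n) = +-pos-≤ (0<num n) 0≤1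

  *-cancelˡ-≤ : ∀ {c x y} → 0# < c → c * x ≤ c * y → x ≤ y
  *-cancelˡ-≤ {c} {x} {y} 0<c cx≤cy with x ≤? y
  ... | yes x≤y = x≤y
  ... | no  y<x = ⊥-elim (*-pos 0<c (gap-< y<x) (≤-via (gap cx≤cy)
    (solve 3 (λ c x y → # 0 :- c :* (x :- y) := c :* y :- c :* x) c x y)))

  square-cancel-≤ : ∀ {x y} → 0# ≤ y → x * x ≤ y * y → x ≤ y
  square-cancel-≤ {x} {y} 0≤y xx≤yy with x ≤? y
  ... | yes x≤y = x≤y
  ... | no  y<x = ⊥-elim (*-pos (gap-< y<x) 0<x+y (≤-via (gap xx≤yy)
    (solve 2 (λ x y → # 0 :- (x :- y) :* (x :+ y) := y :* y :- x :* x) x y)))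
    where
    0<x+y : 0# < x + y
    0<x+y = +-pos-≤ (≤-<-trans 0≤y y<x) 0≤y

  -- Square roots of nonnegative numbers

  module _ {x : ℝ} (0≤x : 0# ≤ x) where
    private
      Below : ℝ → Set
      Below y = 0# ≤ y × y * y ≤ x

      zero-below : Below 0#
      zero-below = ≤-refl , ≤-respˡ-≈ (sym (zeroˡ 0#)) 0≤x

      bounded : BoundedAbove Below
      bounded = 1# + x , λ y (_ , yy≤x) → square-cancel-≤ (0≤1 ⊹ 0≤x) (≤-trans yy≤x (≤-via (0≤1 ⊹ 0≤x ⊹ 0≤x ⊠ 0≤x)
        (solve 1 (λ x → (# 1 :+ x) :* (# 1 :+ x) :- x := # 1 :+ (x :+ x :* x)) x)))

      s : ℝ
      s = √ x

    √-nonNeg : 0# ≤ √ x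
    √-nonNeg = sup-upper Below bounded 0# zero-below

    private
      2s+1 : ℝ
      2s+1 = s + s + 1#

      0<2s+1 : 0# < 2s+1
      0<2s+1 = 0<-respʳ-≈ (+-comm 1# (s + s)) (+-pos-≤ 0<1 (√-nonNeg ⊹ √-nonNeg))

      ss≤x : s * s ≤ x
      ss≤x with s * s ≤? x
      ... | yes p = p
      ... | no x<ss = ⊥-elim (absurd (sup-approx Below (0# , zero-below) bounded (s - ε) s-ε<s))
        where
        -- An element `y` of `Below` with `s - ε < y ≤ s` would give s² - x ≤ s² - y² = (s + y) (s -
        -- y) ≤ 2 s ε < (2 s + 1) ε = s² - x.
        ε : ℝ
        ε = (s * s - x) * 2s+1 ⁻¹

        0<ε : 0# < ε
        0<ε = *-pos (gap-< x<ss) (⁻¹-pos 0<2s+1)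

        ε-spec : 2s+1 * ε ≈ s * s - x
        ε-spec = trans (solve 3 (λ a b i → b :* (a :* i) := a :* (b :* i)) (s * s - x) 2s+1 (2s+1 ⁻¹))
                       (trans (*-congˡ (⁻¹-inverse (0<⇒≉0 0<2s+1))) (*-identityʳ _))

        s-ε<s : s - ε < s
        s-ε<s = <-via 0<ε (solve 2 (λ s e → s :- (s :- e) := e) s ε)

        absurd : ¬ (Σ[ y ∈ ℝ ] (Below y × s - ε < y))
        absurd (y , (0≤y , yy≤x) , s-ε<y) = 0<ε (≤-via
          (gap yy≤x ⊹ (√-nonNeg ⊹ 0≤y) ⊠ gap (<⇒≤ s-ε<y) ⊹ <⇒≤ 0<ε ⊠ gap (sup-upper Below bounded y (0≤y , yy≤x)))
          (begin
            0# - ε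
              ≈⟨ solve 3 (λ s x e → # 0 :- e := (s :* s :- x) :- (s :+ s :+ # 1) :* e :+ (x :- s :* s) :+ (s :+ s) :* e) s x ε ⟩
            (s * s - x) - 2s+1 * ε + (x - s * s) + (s + s) * ε
              ≈⟨ +-congʳ (+-congʳ (+-congˡ (-‿cong ε-spec))) ⟩
            (s * s - x) - (s * s - x) + (x - s * s) + (s + s) * ε
              ≈⟨ solve 4 (λ s x e y → (s :* s :- x) :- (s :* s :- x) :+ (x :- s :* s) :+ (s :+ s) :* e
                   := (x :- y :* y) :+ ((s :+ y) :* (y :- (s :- e)) :+ e :* (s :- y))) s x ε y ⟩
            (x - y * y) + ((s + y) * (y - (s - ε)) + ε * (s - y)) ∎))
          where open ≈-Reasoning

      x≤ss : x ≤ s * s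
      x≤ss with x ≤? s * s
      ... | yes p = p
      ... | no ss<x = ⊥-elim (0<δ (≤-via (gap (sup-upper Below bounded (s + δ) (√-nonNeg ⊹ <⇒≤ 0<δ , below)))
            (solve 2 (λ s d → # 0 :- d := s :- (s :+ d)) s δ)))
        where
        t : ℝ
        t = x - s * s

        0<t : 0# < t
        0<t = gap-< ss<x

        0<2s+1+t : 0# < 2s+1 + t
        0<2s+1+t = +-pos-≤ 0<2s+1 (<⇒≤ 0<t)

        -- The denominator makes δ ≤ 1 and (2 s + 1) δ ≤ t, whence (s + δ)² ≤ s² + (2 s + 1) δ ≤ x,
        -- and `s + δ` is an element of `Below` beyond its supremum.
        δ : ℝ
        δ = t * (2s+1 + t) ⁻¹

        0<δ : 0# < δ
        0<δ = *-pos 0<t (⁻¹-pos 0<2s+1+t)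

        δ-spec : (2s+1 + t) * δ ≈ t
        δ-spec = trans (solve 3 (λ a b i → b :* (a :* i) := a :* (b :* i)) t (2s+1 + t) ((2s+1 + t) ⁻¹))
                       (trans (*-congˡ (⁻¹-inverse (0<⇒≉0 0<2s+1+t))) (*-identityʳ _))

        0≤1-δ : 0# ≤ 1# - δ
        0≤1-δ = *-cancelˡ-≤ 0<2s+1+t (≤-via (<⇒≤ 0<2s+1) (begin
          (2s+1 + t) * (1# - δ) - (2s+1 + t) * 0#
            ≈⟨ solve 3 (λ a t d → (a :+ t) :* (# 1 :- d) :- (a :+ t) :* # 0 := (a :+ t) :- (a :+ t) :* d) 2s+1 t δ ⟩
          (2s+1 + t) - (2s+1 + t) * δ
            ≈⟨ +-congˡ (-‿cong δ-spec) ⟩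
          (2s+1 + t) - t
            ≈⟨ solve 2 (λ a t → (a :+ t) :- t := a) 2s+1 t ⟩
          2s+1 ∎))
          where open ≈-Reasoning

        below : (s + δ) * (s + δ) ≤ x
        below = ≤-via (<⇒≤ 0<δ ⊠ 0≤1-δ ⊹ <⇒≤ 0<δ ⊠ <⇒≤ 0<t) (begin
          x - (s + δ) * (s + δ)
            ≈⟨ solve 3 (λ x s d → x :- (s :+ d) :* (s :+ d) := (x :- s :* s) :- d :* (s :+ s) :- d :* d) x s δ ⟩
          t - δ * (s + s) - δ * δ
            ≈⟨ +-congʳ (+-congʳ δ-spec) ⟨
          (2s+1 + t) * δ - δ * (s + s) - δ * δ
            ≈⟨ solve 3 (λ s t d → (s :+ s :+ # 1 :+ t) :* d :- d :* (s :+ s) :- d :* d := d :* (# 1 :- d) :+ d :* t) s t δ ⟩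
          δ * (1# - δ) + δ * t ∎)
          where open ≈-Reasoning

    √-square : √ x * √ x ≈ x
    √-square = antisym ss≤x x≤ss

  -- Natural numbers and natural powers

  fromℕ-nonNeg : ∀ n → 0# ≤ fromℕ n
  fromℕ-nonNeg zero    = ≤-refl
  fromℕ-nonNeg (suc n) = 0≤1 ⊹ fromℕ-nonNeg n

  fromℕ-pos : ∀ n → 0# < fromℕ (suc n)
  fromℕ-pos n = +-pos-≤ 0<1 (fromℕ-nonNeg n)

  fromℕ-mono-≤ : ∀ {m n} → m ℕ.≤ n → fromℕ m ≤ fromℕ n
  fromℕ-mono-≤ {n = n} ℕ.z≤n   = fromℕ-nonNeg n
  fromℕ-mono-≤ (ℕ.s≤s m≤n) = +-mono-≤ ≤-refl (fromℕ-mono-≤ m≤n)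

  fromℕ-cancel-≤ : ∀ {m n} → fromℕ m ≤ fromℕ n → m ℕ.≤ n
  fromℕ-cancel-≤ {m} {n} p with m ℕ.≤? n
  ... | yes m≤n = m≤n
  ... | no m≰n = ⊥-elim (0<1 (≤-via (gap (≤-trans (fromℕ-mono-≤ (ℕ.≰⇒> m≰n)) p))
        (solve 1 (λ n → # 0 :- # 1 := n :- (# 1 :+ n)) (fromℕ n))))

  -- Otherwise the natural numbers are bounded by `x`; some `n` exceeds their supremum minus 1, and
  -- then `suc n` exceeds the supremum.
  archimedean : ∀ x → Σ[ n ∈ ℕ ] x ≤ fromℕ n
  archimedean x with excludedMiddle {P = Σ[ n ∈ ℕ ] x ≤ fromℕ n}
  ... | yes p = p
  ... | no ¬p = ⊥-elim (absurd (sup-approx Natural (0# , 0 , refl) bounded (sup Natural - 1#)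
                  (<-via 0<1 (solve 2 (λ s o → s :- (s :- o) := o) (sup Natural) 1#))))
    where
    Natural : ℝ → Set
    Natural y = Σ[ n ∈ ℕ ] y ≈ fromℕ n

    bounded : BoundedAbove Natural
    bounded = x , λ y (n , y≈n) → ≤-respˡ-≈ (sym y≈n) (≰⇒≥ λ x≤n → ¬p (n , x≤n))

    absurd : ¬ (Σ[ y ∈ ℝ ] (Natural y × sup Natural - 1# < y))
    absurd (y , (n , y≈n) , s-1<y) = s-1<y (≤-via (gap (sup-upper Natural bounded (fromℕ (suc n)) (suc n , refl)))
      (trans (+-congˡ (-‿cong y≈n)) (solve 3 (λ s n o → (s :- o) :- n := s :- (o :+ n)) (sup Natural) (fromℕ n) 1#)))

  ^-nonNeg : ∀ {x} → 0# ≤ x → ∀ n → 0# ≤ x ^ n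
  ^-nonNeg 0≤x zero    = 0≤1
  ^-nonNeg 0≤x (suc n) = 0≤x ⊠ ^-nonNeg 0≤x n

  ^-pos : ∀ {x} → 0# < x → ∀ n → 0# < x ^ n
  ^-pos 0<x zero    = 0<1
  ^-pos 0<x (suc n) = *-pos 0<x (^-pos 0<x n)

  ^-mono-≤ : ∀ {x y} → 0# ≤ x → x ≤ y → ∀ n → x ^ n ≤ y ^ n
  ^-mono-≤ 0≤x x≤y zero    = ≤-refl
  ^-mono-≤ 0≤x x≤y (suc n) = *-mono-≤ 0≤x (^-nonNeg (≤-trans 0≤x x≤y) n) x≤y (^-mono-≤ 0≤x x≤y n)

  1^n≈1 : ∀ n → 1# ^ n ≈ 1#
  1^n≈1 zero    = refl
  1^n≈1 (suc n) = trans (*-identityˡ _) (1^n≈1 n)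

  ^≤1 : ∀ {x} → 0# ≤ x → x ≤ 1# → ∀ n → x ^ n ≤ 1#
  ^≤1 0≤x x≤1 n = ≤-respʳ-≈ (1^n≈1 n) (^-mono-≤ 0≤x x≤1 n)

  1≤^ : ∀ {x} → 1# ≤ x → ∀ n → 1# ≤ x ^ n
  1≤^ 1≤x n = ≤-respˡ-≈ (1^n≈1 n) (^-mono-≤ 0≤1 1≤x n)

  ^-mono-≤-exponent : ∀ {x m n} → 1# ≤ x → m ℕ.≤ n → x ^ m ≤ x ^ n
  ^-mono-≤-exponent {n = n} 1≤x ℕ.z≤n = 1≤^ 1≤x n
  ^-mono-≤-exponent 1≤x (ℕ.s≤s m≤n) = *-monoˡ-≤ (≤-trans 0≤1 1≤x) (^-mono-≤-exponent 1≤x m≤n)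

  ^-cancel-≤ : ∀ {x y} → 0# ≤ y → ∀ n → x ^ suc n ≤ y ^ suc n → x ≤ y
  ^-cancel-≤ {x} {y} 0≤y n p with x ≤? y
  ... | yes x≤y = x≤y
  ... | no  y<x = ⊥-elim (strict n p)
    where
    0<x : 0# < x
    0<x = ≤-<-trans 0≤y y<x

    strict : ∀ n → ¬ (x ^ suc n ≤ y ^ suc n)
    strict n q = y<x (*-cancelˡ-≤ (^-pos 0<x n) (begin
      x ^ n * x    ≈⟨ *-comm _ _ ⟩
      x * x ^ n    ≤⟨ q ⟩
      y * y ^ n    ≤⟨ *-monoˡ-≤ 0≤y (^-mono-≤ 0≤y (<⇒≤ y<x) n) ⟩
      y * x ^ n    ≈⟨ *-comm _ _ ⟩
      x ^ n * y    ∎))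
      where open ≤-Reasoning

  bernoulli : ∀ {x} → 0# ≤ x → x ≤ 1# → ∀ n → 1# - fromℕ n * x ≤ (1# - x) ^ n
  bernoulli {x} 0≤x x≤1 zero = ≤-reflexive (solve 1 (λ x → # 1 :- # 0 :* x := # 1) x)
  bernoulli {x} 0≤x x≤1 (suc n) = ≤-trans
    (≤-via (fromℕ-nonNeg n ⊠ 0≤x ⊠ 0≤x)
      (solve 2 (λ x n → (# 1 :- x) :* (# 1 :- n :* x) :- (# 1 :- (# 1 :+ n) :* x) := n :* (x :* x)) x (fromℕ n)))
    (*-monoˡ-≤ (gap x≤1) (bernoulli 0≤x x≤1 n))

-- Real powers

module RealPowerProperties (ℛ : CompleteOrderedField) where
  open Theory ℛ
  open RealFieldProperties ℛ

  RationalPowerBelow : ℝ → ℝ → ℝ → Set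
  RationalPowerBelow a x y = Σ[ m ∈ ℕ ] Σ[ k ∈ ℕ ] Σ[ q ∈ ℕ ]
    (1 ℕ.≤ q × fromℕ m ≤ fromℕ q * x + fromℕ k × 0# ≤ y × y ^ q * a ^ k ≤ a ^ m)

  -- From m ≤ q x + k ≤ q N + k follows y^q a^k ≤ (a^N)^q a^k; cancel a^k and take the q-th root.
  -- This also shows that the set defining `pow≥1` is bounded.
  below-≤-^ : ∀ {a x y N} → 1# ≤ a → x ≤ fromℕ N → RationalPowerBelow a x y → y ≤ a ^ N
  below-≤-^ {a} {x} {y} {N} 1≤a x≤N (m , k , suc q , _ , m≤qx+k , 0≤y , le) =
    ^-cancel-≤ (^-nonNeg 0≤a N) q (*-cancelˡ-≤ (^-pos 0<a k) (begin
      a ^ k * y ^ suc q              ≈⟨ *-comm _ _ ⟩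
      y ^ suc q * a ^ k              ≤⟨ le ⟩
      a ^ m                          ≤⟨ ^-mono-≤-exponent {m = m} 1≤a (fromℕ-cancel-≤ {m} {suc q ℕ.* N ℕ.+ k} m≤qN+k) ⟩
      a ^ (suc q ℕ.* N ℕ.+ k)        ≈⟨ ^-homo-* a (suc q ℕ.* N) k ⟩
      a ^ (suc q ℕ.* N) * a ^ k      ≡⟨ ≡.cong (λ e → a ^ e * a ^ k) (ℕ.*-comm (suc q) N) ⟩
      a ^ (N ℕ.* suc q) * a ^ k      ≈⟨ *-congʳ (^-assocʳ a N (suc q)) ⟨
      (a ^ N) ^ suc q * a ^ k        ≈⟨ *-comm _ _ ⟩
      a ^ k * (a ^ N) ^ suc q        ∎))
    where
    open ≤-Reasoning
    0≤a : 0# ≤ a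
    0≤a = ≤-trans 0≤1 1≤a
    0<a : 0# < a
    0<a = <-≤-trans 0<1 1≤a
    m≤qN+k : fromℕ m ≤ fromℕ (suc q ℕ.* N ℕ.+ k)
    m≤qN+k = begin
      fromℕ m                                 ≤⟨ m≤qx+k ⟩
      fromℕ (suc q) * x + fromℕ k             ≤⟨ +-mono-≤ (*-monoˡ-≤ (fromℕ-nonNeg (suc q)) x≤N) ≤-refl ⟩
      fromℕ (suc q) * fromℕ N + fromℕ k       ≈⟨ +-congʳ (×1-homo-* (suc q) N) ⟨
      fromℕ (suc q ℕ.* N) + fromℕ k           ≈⟨ ×-homo-+ 1# (suc q ℕ.* N) k ⟨
      fromℕ (suc q ℕ.* N ℕ.+ k)               ∎

  below-bounded : ∀ {a} x → 1# ≤ a → BoundedAbove (RationalPowerBelow a x)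
  below-bounded {a} x 1≤a with archimedean x
  ... | N , x≤N = a ^ N , λ y → below-≤-^ {N = N} 1≤a x≤N

  below-≤-pow≥1 : ∀ {a x y} → 1# ≤ a → RationalPowerBelow a x y → y ≤ pow≥1 a x
  below-≤-pow≥1 {a} {x} {y} 1≤a = sup-upper (RationalPowerBelow a x) (below-bounded x 1≤a) y

  -- As `x` may be negative, the rational exponent has to be far enough to the left: it is -k for a
  -- natural number k ≥ -x.
  zero-below : ∀ a x → 1# ≤ a → RationalPowerBelow a x 0#
  zero-below a x 1≤a with archimedean (- x)
  ... | k , -x≤k = 0 , k , 1 , ℕ.≤-refl
    , ≤-via (gap -x≤k) (solve 2 (λ x k → (# 1 :+ # 0) :* x :+ k :- # 0 := k :- (:- x)) x (fromℕ k))
    , ≤-refl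
    , ≤-respˡ-≈ (sym (solve 1 (λ b → (# 0 :* # 1) :* b := # 0) (a ^ k))) 0≤1

  pow≥1-nonNeg : ∀ {a x} → 1# ≤ a → 0# ≤ pow≥1 a x
  pow≥1-nonNeg {a} {x} 1≤a = below-≤-pow≥1 1≤a (zero-below a x 1≤a)

  pow≥1-least : ∀ {a x u} → 1# ≤ a → (∀ y → RationalPowerBelow a x y → y ≤ u) → pow≥1 a x ≤ u
  pow≥1-least {a} {x} {u} 1≤a bound with pow≥1 a x ≤? u
  ... | yes p = p
  ... | no ¬p with sup-approx (RationalPowerBelow a x) (0# , zero-below a x 1≤a) (below-bounded x 1≤a) u ¬p
  ...   | y , y∈ , u<y = ⊥-elim (u<y (bound y y∈))

  ^-≤-pow≥1 : ∀ {a} → 1# ≤ a → ∀ K → a ^ K ≤ pow≥1 a (fromℕ K)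
  ^-≤-pow≥1 {a} 1≤a K = below-≤-pow≥1 1≤a
    ( K , 0 , 1 , ℕ.≤-refl
    , ≤-reflexive (solve 1 (λ k → k := (# 1 :+ # 0) :* k :+ # 0) (fromℕ K))
    , ^-nonNeg (≤-trans 0≤1 1≤a) K
    , ≤-reflexive (solve 1 (λ b → (b :* # 1) :* # 1 := b) (a ^ K)))

  pow≥1-≤-^ : ∀ {a} → 1# ≤ a → ∀ K → pow≥1 a (fromℕ K) ≤ a ^ K
  pow≥1-≤-^ 1≤a K = pow≥1-least 1≤a λ y → below-≤-^ {N = K} 1≤a ≤-refl

  ^ʳ-≥1 : ∀ {a} x → 1# ≤ a → a ^ʳ x ≡.≡ pow≥1 a x
  ^ʳ-≥1 {a} x 1≤a = ≡.cong
    (λ b → if b then pow≥1 a x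
      else if does (a ≤? 0#) then (if does (x ≟ 0#) then 1# else 0#)
      else (pow≥1 (a ⁻¹) x) ⁻¹)
    (dec-true (1# ≤? a) 1≤a)

  1≤⁻¹ : ∀ {a} → 0# < a → a ≤ 1# → 1# ≤ a ⁻¹
  1≤⁻¹ {a} 0<a a≤1 = *-cancelˡ-≤ 0<a (≤-respˡ-≈ (sym (*-identityʳ a)) (≤-respʳ-≈ (sym (⁻¹-inverse (0<⇒≉0 0<a))) a≤1))

  -- An upper bound is what the theorem asks for, since this power occurs there in an exponent with
  -- a minus sign. The exponent is positive so that the base 0 fits the convention `0ˣ = 0`.
  ^ʳ-fromℕ-≤ : ∀ {a} → 0# ≤ a → ∀ k → a ^ʳ fromℕ (suc k) ≤ a ^ suc k
  ^ʳ-fromℕ-≤ {a} 0≤a k with 1# ≤? a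
  ... | yes 1≤a = pow≥1-≤-^ 1≤a (suc k)
  ... | no a<1 with a ≤? 0#
  ...   | yes a≤0 with fromℕ (suc k) ≟ 0#
  ...     | yes k+1≈0 = ⊥-elim (0<⇒≉0 (fromℕ-pos k) k+1≈0)
  ...     | no _ = ^-nonNeg 0≤a (suc k)
  ^ʳ-fromℕ-≤ {a} 0≤a k | no a<1 | no 0<a = *-cancelˡ-≤ 0<P (begin
    P * P ⁻¹                             ≈⟨ ⁻¹-inverse (0<⇒≉0 0<P) ⟩
    1#                                   ≈⟨ 1^n≈1 (suc k) ⟨
    1# ^ suc k                           ≈⟨ ^-congˡ (suc k) (⁻¹-inverse (0<⇒≉0 0<a)) ⟨
    (a * a ⁻¹) ^ suc k                   ≈⟨ ^-distrib-* a (a ⁻¹) (suc k) ⟩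
    a ^ suc k * (a ⁻¹) ^ suc k           ≤⟨ *-monoˡ-≤ (^-nonNeg 0≤a (suc k)) (^-≤-pow≥1 1≤b (suc k)) ⟩
    a ^ suc k * P                        ≈⟨ *-comm _ _ ⟩
    P * a ^ suc k                        ∎)
    where
    open ≤-Reasoning
    P : ℝ
    P = pow≥1 (a ⁻¹) (fromℕ (suc k))
    1≤b : 1# ≤ a ⁻¹
    1≤b = 1≤⁻¹ 0<a (<⇒≤ a<1)
    0<P : 0# < P
    0<P = <-≤-trans (^-pos (<-≤-trans 0<1 1≤b) (suc k)) (^-≤-pow≥1 1≤b (suc k))

  -- By induction from (1 - t) (1 + (n + 1) t) = 1 + n t - (n + 1) t². For t = 1 / n it says (1 - 1
  -- / n)^n ≤ 1 / 2.
  [1-t]^n*[1+nt]≤1 : ∀ {t} → 0# ≤ t → t ≤ 1# → ∀ n → (1# - t) ^ n * (1# + fromℕ n * t) ≤ 1#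
  [1-t]^n*[1+nt]≤1 {t} 0≤t t≤1 zero = ≤-reflexive (solve 1 (λ t → # 1 :* (# 1 :+ # 0 :* t) := # 1) t)
  [1-t]^n*[1+nt]≤1 {t} 0≤t t≤1 (suc n) = ≤-trans
    (≤-via (^-nonNeg (gap t≤1) n ⊠ (0≤1 ⊹ fromℕ-nonNeg n) ⊠ 0≤t ⊠ 0≤t)
      (solve 3 (λ t n P → P :* (# 1 :+ n :* t) :- ((# 1 :- t) :* P) :* (# 1 :+ (# 1 :+ n) :* t)
         := P :* ((# 1 :+ n) :* (t :* t))) t (fromℕ n) ((1# - t) ^ n)))
    ([1-t]^n*[1+nt]≤1 0≤t t≤1 n)

  [1-1/q]^q*2≤1 : ∀ q → (1# - fromℕ (suc q) ⁻¹) ^ suc q * fromℕ 2 ≤ 1#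
  [1-1/q]^q*2≤1 q = ≤-respˡ-≈ (*-congˡ 1+qt≈2) ([1-t]^n*[1+nt]≤1 (<⇒≤ (⁻¹-pos (fromℕ-pos q))) t≤1 (suc q))
    where
    t : ℝ
    t = fromℕ (suc q) ⁻¹
    qt≈1 : fromℕ (suc q) * t ≈ 1#
    qt≈1 = ⁻¹-inverse (0<⇒≉0 (fromℕ-pos q))
    1+qt≈2 : 1# + fromℕ (suc q) * t ≈ fromℕ 2
    1+qt≈2 = +-congˡ (trans qt≈1 (sym (+-identityʳ 1#)))
    t≤1 : t ≤ 1#
    t≤1 = ≤-respʳ-≈ qt≈1 (≤-via (fromℕ-nonNeg q ⊠ <⇒≤ (⁻¹-pos (fromℕ-pos q)))
      (solve 2 (λ n t → (# 1 :+ n) :* t :- t := n :* t) (fromℕ q) t))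

  1≤2 : 1# ≤ fromℕ 2
  1≤2 = ≤-via (fromℕ-nonNeg 1) (solve 1 (λ o → (o :+ (o :+ # 0)) :- o := o :+ # 0) 1#)

  2^ʳ-nonNeg : ∀ x → 0# ≤ fromℕ 2 ^ʳ x
  2^ʳ-nonNeg x = ≡.subst (0# ≤_) (≡.sym (^ʳ-≥1 x 1≤2)) (pow≥1-nonNeg 1≤2)

  -- 1 - j / q ≤ (1 - 1 / q) ^ j and (1 - 1 / q) ^ q ≤ 1 / 2.
  [1-j/q]^N≤2^ʳ : ∀ {j q N X z} → z * fromℕ (suc q) ≈ fromℕ j → z ≤ 1# → fromℕ (suc q) * X ≤ fromℕ (j ℕ.* N) →
                  (1# - z) ^ N ≤ fromℕ 2 ^ʳ (- X)
  [1-j/q]^N≤2^ʳ {j} {q} {N} {X} {z} zq≈j z≤1 qX≤jN = ≡.subst ((1# - z) ^ N ≤_) (≡.sym (^ʳ-≥1 (- X) 1≤2))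
    (below-≤-pow≥1 1≤2
      -- The rational exponent (0 - j N) / (q + 1), which is at most -X. What remains is that the (q
      -- + 1)-st power of (1 - z)^N, multiplied by 2^(j N), is at most 1.
      ( 0 , j ℕ.* N , suc q , ℕ.s≤s ℕ.z≤n
      , ≤-via (gap qX≤jN) (solve 3 (λ q x k → q :* (:- x) :+ k :- # 0 := k :- q :* x) (fromℕ (suc q)) X (fromℕ (j ℕ.* N)))
      , ^-nonNeg (gap z≤1) N
      , small))
    where
    open ≤-Reasoning
    t : ℝ
    t = fromℕ (suc q) ⁻¹
    0≤t : 0# ≤ t
    0≤t = <⇒≤ (⁻¹-pos (fromℕ-pos q))
    qt≈1 : fromℕ (suc q) * t ≈ 1#
    qt≈1 = ⁻¹-inverse (0<⇒≉0 (fromℕ-pos q))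
    t≤1 : t ≤ 1#
    t≤1 = ≤-respʳ-≈ qt≈1 (≤-via (fromℕ-nonNeg q ⊠ 0≤t)
      (solve 2 (λ n t → (# 1 :+ n) :* t :- t := n :* t) (fromℕ q) t))
    z≈jt : z ≈ fromℕ j * t
    z≈jt = begin-equality
      z                           ≈⟨ *-identityʳ z ⟨
      z * 1#                      ≈⟨ *-congˡ qt≈1 ⟨
      z * (fromℕ (suc q) * t)     ≈⟨ *-assoc _ _ _ ⟨
      z * fromℕ (suc q) * t       ≈⟨ *-congʳ zq≈j ⟩
      fromℕ j * t                 ∎
    1-z≤ : 1# - z ≤ (1# - t) ^ j
    1-z≤ = ≤-respˡ-≈ (+-congˡ (-‿cong (sym z≈jt))) (bernoulli 0≤t t≤1 j)
    exponents : (j ℕ.* N) ℕ.* suc q ≡.≡ suc q ℕ.* (j ℕ.* N)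
    exponents = ℕ.*-comm (j ℕ.* N) (suc q)
    small : ((1# - z) ^ N) ^ suc q * fromℕ 2 ^ (j ℕ.* N) ≤ 1#
    small = begin
      ((1# - z) ^ N) ^ suc q * fromℕ 2 ^ (j ℕ.* N)
        ≤⟨ *-monoʳ-≤ (^-nonNeg (≤-trans 0≤1 1≤2) (j ℕ.* N)) (^-mono-≤ (^-nonNeg (gap z≤1) N) (^-mono-≤ (gap z≤1) 1-z≤ N) (suc q)) ⟩
      (((1# - t) ^ j) ^ N) ^ suc q * fromℕ 2 ^ (j ℕ.* N)
        ≈⟨ *-congʳ (^-congˡ (suc q) (^-assocʳ (1# - t) j N)) ⟩
      ((1# - t) ^ (j ℕ.* N)) ^ suc q * fromℕ 2 ^ (j ℕ.* N)
        ≈⟨ *-congʳ (^-assocʳ (1# - t) (j ℕ.* N) (suc q)) ⟩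
      (1# - t) ^ ((j ℕ.* N) ℕ.* suc q) * fromℕ 2 ^ (j ℕ.* N)
        ≡⟨ ≡.cong (λ e → (1# - t) ^ e * fromℕ 2 ^ (j ℕ.* N)) exponents ⟩
      (1# - t) ^ (suc q ℕ.* (j ℕ.* N)) * fromℕ 2 ^ (j ℕ.* N)
        ≈⟨ *-congʳ (^-assocʳ (1# - t) (suc q) (j ℕ.* N)) ⟨
      ((1# - t) ^ suc q) ^ (j ℕ.* N) * fromℕ 2 ^ (j ℕ.* N)
        ≈⟨ ^-distrib-* _ _ (j ℕ.* N) ⟨
      ((1# - t) ^ suc q * fromℕ 2) ^ (j ℕ.* N)
        ≤⟨ ^≤1 (^-nonNeg (gap t≤1) (suc q) ⊠ ≤-trans 0≤1 1≤2) ([1-1/q]^q*2≤1 q) (j ℕ.* N) ⟩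
      1# ∎

  fromℕ-^ : ∀ n k → fromℕ (n ℕ.^ k) ≈ fromℕ n ^ k
  fromℕ-^ n zero    = +-identityʳ 1#
  fromℕ-^ n (suc k) = trans (×1-homo-* n (n ℕ.^ k)) (*-congˡ (fromℕ-^ n k))

  -- The exponent c d (d / n) ^ C of the theorem, for c = h = 1 / (2 (Q + 1)) and C = k + 1.
  [1-ν[d/n]^k]^N≤2^ʳ : ∀ (Q d n N k : ℕ) .{{_ : NonZero n}} {ν h} → ν * fromℕ (suc Q) ≈ 1# → h + h ≈ ν →
    d ℕ.≤ n → d ℕ.≤ 2 ℕ.* N →
    (1# - ν * (fromℕ d * fromℕ n ⁻¹) ^ suc k) ^ N
      ≤ fromℕ 2 ^ʳ (- (h * (fromℕ d * (fromℕ d * fromℕ n ⁻¹) ^ʳ fromℕ (suc k))))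
  -- With `ν` = 1 / (Q + 1) the number `z` is the fraction d^K / ((Q + 1) n^K). Abstracting its
  -- denominator allows a match on a successor, as the preceding lemma requires.
  [1-ν[d/n]^k]^N≤2^ʳ Q d n@(suc n-1) N k {ν} {h} νQ≈1 hh≈ν d≤n d≤2N = go (suc Q ℕ.* n ℕ.^ K) ≡.refl
    where
    open ≤-Reasoning
    K : ℕ
    K = suc k
    ρ z X : ℝ
    ρ = fromℕ d * fromℕ n ⁻¹
    z = ν * ρ ^ K
    X = h * (fromℕ d * ρ ^ʳ fromℕ K)
    nn⁻¹≈1 : fromℕ n * fromℕ n ⁻¹ ≈ 1#
    nn⁻¹≈1 = ⁻¹-inverse (0<⇒≉0 (fromℕ-pos n-1))
    ρn≈d : ρ * fromℕ n ≈ fromℕ d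
    ρn≈d = trans (solve 3 (λ d i n → (d :* i) :* n := d :* (n :* i)) (fromℕ d) (fromℕ n ⁻¹) (fromℕ n))
                 (trans (*-congˡ nn⁻¹≈1) (*-identityʳ _))
    0≤ρ : 0# ≤ ρ
    0≤ρ = fromℕ-nonNeg d ⊠ <⇒≤ (⁻¹-pos (fromℕ-pos n-1))
    ρ≤1 : ρ ≤ 1#
    ρ≤1 = ≤-respʳ-≈ nn⁻¹≈1 (*-monoʳ-≤ (<⇒≤ (⁻¹-pos (fromℕ-pos n-1))) (fromℕ-mono-≤ d≤n))
    0≤ν : 0# ≤ ν
    0≤ν = *-cancelˡ-≤ (fromℕ-pos Q) (≤-respˡ-≈ (sym (zeroʳ _)) (≤-respʳ-≈ (sym (trans (*-comm _ _) νQ≈1)) 0≤1))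
    ν≤1 : ν ≤ 1#
    ν≤1 = ≤-respʳ-≈ νQ≈1 (≤-via (0≤ν ⊠ fromℕ-nonNeg Q) (solve 2 (λ v q → v :* (# 1 :+ q) :- v := v :* q) ν (fromℕ Q)))
    0≤h : 0# ≤ h
    0≤h = *-cancelˡ-≤ (0<num 1) (≤-via 0≤ν (trans (solve 1 (λ h → # 2 :* h :- # 2 :* # 0 := h :+ h) h) hh≈ν))
    go : ∀ q → q ≡.≡ suc Q ℕ.* n ℕ.^ K → (1# - z) ^ N ≤ fromℕ 2 ^ʳ (- X)
    go zero    eq = ⊥-elim (ℕ.n≮0 (≡.subst (1 ℕ.≤_) (≡.sym eq) (ℕ.≤-trans (ℕ.m^n>0 n K) (ℕ.m≤m+n (n ℕ.^ K) (Q ℕ.* n ℕ.^ K)))))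
    go (suc q) eq = [1-j/q]^N≤2^ʳ {j = d ℕ.^ K} {q} {N} zq≈j (≤-trans (*-monoˡ-≤ 0≤ν (^≤1 0≤ρ ρ≤1 K)) (≤-respˡ-≈ (sym (*-identityʳ ν)) ν≤1)) (begin
        fromℕ (suc q) * X
          ≤⟨ *-monoˡ-≤ (fromℕ-nonNeg (suc q)) (*-monoˡ-≤ 0≤h (*-monoˡ-≤ (fromℕ-nonNeg d) (^ʳ-fromℕ-≤ 0≤ρ k))) ⟩
        fromℕ (suc q) * (h * (fromℕ d * ρ ^ K))
          ≤⟨ *-monoˡ-≤ (fromℕ-nonNeg (suc q)) (*-monoˡ-≤ 0≤h (*-monoʳ-≤ (^-nonNeg 0≤ρ K) (≤-respʳ-≈ (×1-homo-* 2 N) (fromℕ-mono-≤ d≤2N)))) ⟩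
        fromℕ (suc q) * (h * ((fromℕ 2 * fromℕ N) * ρ ^ K))
          ≈⟨ solve 4 (λ q h N r → q :* (h :* (((# 1 :+ (# 1 :+ # 0)) :* N) :* r)) := (((h :+ h) :* r) :* q) :* N) (fromℕ (suc q)) h (fromℕ N) (ρ ^ K) ⟩
        (h + h) * ρ ^ K * fromℕ (suc q) * fromℕ N
          ≈⟨ *-congʳ (*-congʳ (*-congʳ hh≈ν)) ⟩
        z * fromℕ (suc q) * fromℕ N
          ≈⟨ *-congʳ zq≈j ⟩
        fromℕ (d ℕ.^ K) * fromℕ N
          ≈⟨ ×1-homo-* (d ℕ.^ K) N ⟨
        fromℕ (d ℕ.^ K ℕ.* N) ∎)
      where
      zq≈j : z * fromℕ (suc q) ≈ fromℕ (d ℕ.^ K)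
      zq≈j = begin-equality
        ν * ρ ^ K * fromℕ (suc q)                             ≡⟨ ≡.cong (λ e → z * fromℕ e) eq ⟩
        ν * ρ ^ K * fromℕ (suc Q ℕ.* n ℕ.^ K)                 ≈⟨ *-congˡ (×1-homo-* (suc Q) (n ℕ.^ K)) ⟩
        ν * ρ ^ K * (fromℕ (suc Q) * fromℕ (n ℕ.^ K))         ≈⟨ *-congˡ (*-congˡ (fromℕ-^ n K)) ⟩
        ν * ρ ^ K * (fromℕ (suc Q) * fromℕ n ^ K)             ≈⟨ solve 4 (λ a b c d → (a :* b) :* (c :* d) := (a :* c) :* (b :* d)) ν (ρ ^ K) (fromℕ (suc Q)) (fromℕ n ^ K) ⟩
        ν * fromℕ (suc Q) * (ρ ^ K * fromℕ n ^ K)             ≈⟨ *-cong νQ≈1 (sym (^-distrib-* ρ (fromℕ n) K)) ⟩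
        1# * (ρ * fromℕ n) ^ K                                ≈⟨ *-identityˡ _ ⟩
        (ρ * fromℕ n) ^ K                                     ≈⟨ ^-congˡ K ρn≈d ⟩
        fromℕ d ^ K                                           ≈⟨ fromℕ-^ d K ⟨
        fromℕ (d ℕ.^ K)                                       ∎

-- Finite sums and products

module FiniteSums (ℛ : CompleteOrderedField) (R : CommutativeRing 0ℓ 0ℓ) where
  open Theory ℛ using (words)
  open CommutativeRing R hiding (zero)
  open RawSemiringDefinitions (RawRing.rawSemiring rawRing) using (product)
  open CommutativeSemigroupProperties (CommutativeRing.*-commutativeSemigroup R) using (x∙yz≈y∙xz)
  open import Relation.Binary.Reasoning.Setoid setoid

  private
    sum : {A : Set} → List A → (A → Carrier) → Carrier
    sum xs f = List.foldr (λ a b → f a + b) 0# xs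

    variable
      A A′ A″ : Set
      f g : A → Carrier

  ∑-cong : (∀ a → f a ≈ g a) → ∀ xs → sum xs f ≈ sum xs g
  ∑-cong f≈g []       = refl
  ∑-cong f≈g (x ∷ xs) = +-cong (f≈g x) (∑-cong f≈g xs)

  ∑-zero : (∀ a → f a ≈ 0#) → ∀ xs → sum xs f ≈ 0#
  ∑-zero f≈0 []       = refl
  ∑-zero f≈0 (x ∷ xs) = trans (+-cong (f≈0 x) (∑-zero f≈0 xs)) (+-identityˡ 0#)

  ∑-+ : ∀ xs (f g : A → Carrier) → sum xs (λ a → f a + g a) ≈ sum xs f + sum xs g
  ∑-+ []       f g = sym (+-identityˡ 0#)
  ∑-+ (x ∷ xs) f g = begin
    f x + g x + sum xs (λ a → f a + g a)        ≈⟨ +-congˡ (∑-+ xs f g) ⟩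
    f x + g x + (sum xs f + sum xs g)           ≈⟨ +-interchange (f x) (g x) _ _ ⟩
    f x + sum xs f + (g x + sum xs g)           ∎
    where open CommutativeSemigroupProperties (CommutativeRing.+-commutativeSemigroup R) renaming (interchange to +-interchange)

  ∑-sub : ∀ xs (f g : A → Carrier) → sum xs (λ a → f a - g a) ≈ sum xs f - sum xs g
  ∑-sub xs f g = trans (∑-+ xs f (λ a → - g a)) (+-congˡ (∑-neg xs))
    where
    open AbelianGroupProperties (CommutativeRing.+-abelianGroup R) using (⁻¹-∙-comm; ε⁻¹≈ε)
    ∑-neg : ∀ xs → sum xs (λ a → - g a) ≈ - sum xs g
    ∑-neg []       = sym ε⁻¹≈ε
    ∑-neg (x ∷ xs) = trans (+-congˡ (∑-neg xs)) (⁻¹-∙-comm (g x) (sum xs g))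

  *-distribˡ-∑ : ∀ c xs (f : A → Carrier) → c * sum xs f ≈ sum xs (λ a → c * f a)
  *-distribˡ-∑ c []       f = zeroʳ c
  *-distribˡ-∑ c (x ∷ xs) f = trans (distribˡ c _ _) (+-congˡ (*-distribˡ-∑ c xs f))

  *-distribʳ-∑ : ∀ c xs (f : A → Carrier) → sum xs f * c ≈ sum xs (λ a → f a * c)
  *-distribʳ-∑ c []       f = zeroˡ c
  *-distribʳ-∑ c (x ∷ xs) f = trans (distribʳ c _ _) (+-congˡ (*-distribʳ-∑ c xs f))

  ∑-* : ∀ xs (f : A → Carrier) ys (g : A′ → Carrier) → sum xs f * sum ys g ≈ sum xs (λ a → sum ys (λ b → f a * g b))
  ∑-* xs f ys g = trans (*-distribʳ-∑ (sum ys g) xs f) (∑-cong (λ a → *-distribˡ-∑ (f a) ys g) xs)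

  ∑-swap : ∀ xs ys (f : A → A′ → Carrier) → sum xs (λ a → sum ys (f a)) ≈ sum ys (λ b → sum xs (λ a → f a b))
  ∑-swap []       ys f = sym (∑-zero (λ _ → refl) ys)
  ∑-swap (x ∷ xs) ys f = trans (+-congˡ (∑-swap xs ys f)) (sym (∑-+ ys (f x) _))

  ∑-++ : ∀ xs ys (f : A → Carrier) → sum (xs List.++ ys) f ≈ sum xs f + sum ys f
  ∑-++ []       ys f = sym (+-identityˡ _)
  ∑-++ (x ∷ xs) ys f = trans (+-congˡ (∑-++ xs ys f)) (sym (+-assoc _ _ _))

  ∑-map : ∀ (h : A → A′) xs (f : A′ → Carrier) → sum (List.map h xs) f ≈ sum xs (f ∘ h)
  ∑-map h []       f = refl
  ∑-map h (x ∷ xs) f = +-congˡ (∑-map h xs f)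

  ∑-cartesianProductWith : ∀ (h : A → A′ → A″) xs ys (f : A″ → Carrier) →
    sum (cartesianProductWith h xs ys) f ≈ sum xs (λ a → sum ys (λ b → f (h a b)))
  ∑-cartesianProductWith h []       ys f = refl
  ∑-cartesianProductWith h (x ∷ xs) ys f = begin
    sum (List.map (h x) ys List.++ cartesianProductWith h xs ys) f
      ≈⟨ ∑-++ (List.map (h x) ys) _ f ⟩
    sum (List.map (h x) ys) f + sum (cartesianProductWith h xs ys) f
      ≈⟨ +-cong (∑-map (h x) ys f) (∑-cartesianProductWith h xs ys f) ⟩
    sum ys (f ∘ h x) + sum xs (λ a → sum ys (λ b → f (h a b))) ∎

  ∑-allFin-suc : ∀ n (f : Fin (suc n) → Carrier) → sum (allFin (suc n)) f ≈ f zero + sum (allFin n) (f ∘ suc)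
  ∑-allFin-suc n f = +-congˡ (begin
    sum (List.tabulate suc) f              ≡⟨ ≡.cong (λ xs → sum xs f) (map-tabulate (λ i → i) suc) ⟨
    sum (List.map suc (allFin n)) f        ≈⟨ ∑-map suc (allFin n) f ⟩
    sum (allFin n) (f ∘ suc)               ∎)

  ∑-single : ∀ {n} (i : Fin n) (f : Fin n → Carrier) → (∀ j → j ≢ i → f j ≈ 0#) → sum (allFin n) f ≈ f i
  ∑-single {suc n} zero f f≈0 = begin
    sum (allFin (suc n)) f                ≈⟨ ∑-allFin-suc n f ⟩
    f zero + sum (allFin n) (f ∘ suc)     ≈⟨ +-congˡ (∑-zero (λ j → f≈0 (suc j) λ ()) (allFin n)) ⟩
    f zero + 0#                           ≈⟨ +-identityʳ _ ⟩
    f zero                                ∎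
  ∑-single {suc n} (suc i) f f≈0 = begin
    sum (allFin (suc n)) f                ≈⟨ ∑-allFin-suc n f ⟩
    f zero + sum (allFin n) (f ∘ suc)     ≈⟨ +-cong (f≈0 zero λ ()) (∑-single i (f ∘ suc) λ j j≢i → f≈0 (suc j) λ { ≡.refl → j≢i ≡.refl }) ⟩
    0# + f (suc i)                        ≈⟨ +-identityˡ _ ⟩
    f (suc i)                             ∎

  -- The position `i` is arbitrary because the peeling argument looks at every coordinate of a word
  -- and not only at the first.
  ∑-words-suc : ∀ (as : List A) n (f : Vec A (suc n) → Carrier) (i : Fin (suc n)) →
    sum (words as (suc n)) f ≈ sum as (λ a → sum (words as n) (λ w → f (insertAt w i a)))
  ∑-words-suc as n       f zero    = ∑-cartesianProductWith Vec._∷_ as (words as n) f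
  ∑-words-suc as (suc n) f (suc i) = begin
    sum (words as (suc (suc n))) f
      ≈⟨ ∑-cartesianProductWith Vec._∷_ as (words as (suc n)) f ⟩
    sum as (λ b → sum (words as (suc n)) (λ w → f (b Vec.∷ w)))
      ≈⟨ ∑-cong (λ b → ∑-words-suc as n (λ w → f (b Vec.∷ w)) i) as ⟩
    sum as (λ b → sum as (λ a → sum (words as n) (λ w → f (b Vec.∷ insertAt w i a))))
      ≈⟨ ∑-swap as as _ ⟩
    sum as (λ a → sum as (λ b → sum (words as n) (λ w → f (b Vec.∷ insertAt w i a))))
      ≈⟨ ∑-cong (λ a → ∑-cartesianProductWith Vec._∷_ as (words as n) (λ w → f (insertAt w (suc i) a))) as ⟨
    sum as (λ a → sum (words as (suc n)) (λ w → f (insertAt w (suc i) a))) ∎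

  ∏-insertAt : ∀ {n} (w : Vec A n) i a (f : A → Carrier) →
    product (λ j → f (lookup (insertAt w i a) j)) ≈ f a * product (λ j → f (lookup w j))
  ∏-insertAt w           zero    a f = refl
  ∏-insertAt (b Vec.∷ w) (suc i) a f = trans (*-congˡ (∏-insertAt w i a f)) (x∙yz≈y∙xz _ _ _)

  ∏-insertAt₂ : ∀ {n} (v : Vec A n) (w : Vec A′ n) i a b (f : A → A′ → Carrier) →
    product (λ j → f (lookup (insertAt v i a) j) (lookup (insertAt w i b) j)) ≈ f a b * product (λ j → f (lookup v j) (lookup w j))
  ∏-insertAt₂ v           w           zero    a b f = refl
  ∏-insertAt₂ (c Vec.∷ v) (d Vec.∷ w) (suc i) a b f = trans (*-congˡ (∏-insertAt₂ v w i a b f)) (x∙yz≈y∙xz _ _ _)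

-- Complex numbers

module ComplexProperties (ℛ : CompleteOrderedField) where
  open Theory ℛ hiding (zero)
  open RealFieldProperties ℛ
  open FiniteSums ℛ commutativeRing public

  ≈ᶜ-isEquivalence : IsEquivalence _≈ᶜ_
  ≈ᶜ-isEquivalence = record
    { refl  = refl , refl
    ; sym   = λ (p , q) → sym p , sym q
    ; trans = λ (p , q) (p′ , q′) → trans p p′ , trans q q′ }

  ℂ-commutativeRing : CommutativeRing 0ℓ 0ℓ
  ℂ-commutativeRing = record
    { Carrier = ℂ ; _≈_ = _≈ᶜ_ ; _+_ = _+ᶜ_ ; _*_ = _*ᶜ_ ; -_ = -ᶜ_ ; 0# = 0ᶜ ; 1# = 1ᶜ
    ; isCommutativeRing = record
      { isRing = record
        { +-isAbelianGroup = record
          { isGroup = record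
            { isMonoid = record
              { isSemigroup = record
                { isMagma = record
                  { isEquivalence = ≈ᶜ-isEquivalence
                  ; ∙-cong = λ (p , q) (p′ , q′) → +-cong p p′ , +-cong q q′ }
                ; assoc = λ x y z → +-assoc _ _ _ , +-assoc _ _ _ }
              ; identity = (λ x → +-identityˡ _ , +-identityˡ _) , (λ x → +-identityʳ _ , +-identityʳ _) }
            ; inverse = (λ x → -‿inverseˡ _ , -‿inverseˡ _) , (λ x → -‿inverseʳ _ , -‿inverseʳ _)
            ; ⁻¹-cong = λ (p , q) → -‿cong p , -‿cong q }
          ; comm = λ x y → +-comm _ _ , +-comm _ _ }
        ; *-cong = λ (p , q) (p′ , q′) → +-cong (*-cong p p′) (-‿cong (*-cong q q′)) , +-cong (*-cong p q′) (*-cong q p′)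
        ; *-assoc = λ x y z →
            solve 6 (λ a b c d e f → (a :* c :- b :* d) :* e :- (a :* d :+ b :* c) :* f := a :* (c :* e :- d :* f) :- b :* (c :* f :+ d :* e))
              (re x) (im x) (re y) (im y) (re z) (im z) ,
            solve 6 (λ a b c d e f → (a :* c :- b :* d) :* f :+ (a :* d :+ b :* c) :* e := a :* (c :* f :+ d :* e) :+ b :* (c :* e :- d :* f))
              (re x) (im x) (re y) (im y) (re z) (im z)
        ; *-identity =
            (λ x → solve 2 (λ a b → # 1 :* a :- # 0 :* b := a) (re x) (im x) ,
                   solve 2 (λ a b → # 1 :* b :+ # 0 :* a := b) (re x) (im x)) ,
            (λ x → solve 2 (λ a b → a :* # 1 :- b :* # 0 := a) (re x) (im x) ,
                   solve 2 (λ a b → a :* # 0 :+ b :* # 1 := b) (re x) (im x))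
        ; distrib =
            (λ x y z →
              solve 6 (λ a b c d e f → a :* (c :+ e) :- b :* (d :+ f) := (a :* c :- b :* d) :+ (a :* e :- b :* f))
                (re x) (im x) (re y) (im y) (re z) (im z) ,
              solve 6 (λ a b c d e f → a :* (d :+ f) :+ b :* (c :+ e) := (a :* d :+ b :* c) :+ (a :* f :+ b :* e))
                (re x) (im x) (re y) (im y) (re z) (im z)) ,
            (λ x y z →
              solve 6 (λ a b c d e f → (c :+ e) :* a :- (d :+ f) :* b := (c :* a :- d :* b) :+ (e :* a :- f :* b))
                (re x) (im x) (re y) (im y) (re z) (im z) ,
              solve 6 (λ a b c d e f → (c :+ e) :* b :+ (d :+ f) :* a := (c :* b :+ d :* a) :+ (e :* b :+ f :* a))
                (re x) (im x) (re y) (im y) (re z) (im z)) }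
      ; *-comm = λ x y →
          solve 4 (λ a b c d → a :* c :- b :* d := c :* a :- d :* b) (re x) (im x) (re y) (im y) ,
          solve 4 (λ a b c d → a :* d :+ b :* c := c :* b :+ d :* a) (re x) (im x) (re y) (im y) } }

  module ℂᴿ = CommutativeRing ℂ-commutativeRing
  module ℂ-Reasoning = Relation.Binary.Reasoning.Setoid ℂᴿ.setoid
  module ℂ∑ = FiniteSums ℛ ℂ-commutativeRing
  open IntegerCoefficients ℂ-commutativeRing public using ()
    renaming (solve to solveᶜ; #_ to #ᶜ_; _:+_ to _⊕_; _:*_ to _⊗_; :-_ to ⊝_; _:-_ to _⊖_; _:=_ to _⊜_)

  -- Polynomial expressions for the real and the imaginary part of a complex number.
  Polynomialᶜ : ℕ → Set
  Polynomialᶜ n = Polynomial n × Polynomial n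

  infixl 6 _:+ᶜ_ _:-ᶜ_
  infixl 7 _:*ᶜ_

  _:+ᶜ_ _:-ᶜ_ _:*ᶜ_ : ∀ {n} → Polynomialᶜ n → Polynomialᶜ n → Polynomialᶜ n
  (a , b) :+ᶜ (c , d) = a :+ c , b :+ d
  (a , b) :-ᶜ (c , d) = a :- c , b :- d
  (a , b) :*ᶜ (c , d) = a :* c :- b :* d , a :* d :+ b :* c

  :conj : ∀ {n} → Polynomialᶜ n → Polynomialᶜ n
  :conj (a , b) = a , :- b

  :∣_∣² : ∀ {n} → Polynomialᶜ n → Polynomial n
  :∣ a , b ∣² = a :* a :+ b :* b

  ι : ℝ → ℂ
  ι r = r +i 0#

  ·ᶜ≈ι* : ∀ r z → r ·ᶜ z ≈ᶜ ι r *ᶜ z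
  ·ᶜ≈ι* r z = solve 3 (λ r a b → r :* a := r :* a :- # 0 :* b) r (re z) (im z) ,
              solve 3 (λ r a b → r :* b := r :* b :+ # 0 :* a) r (re z) (im z)

  conj-cong : ∀ {w z} → w ≈ᶜ z → conj w ≈ᶜ conj z
  conj-cong (p , q) = p , -‿cong q

  conj-* : ∀ w z → conj (w *ᶜ z) ≈ᶜ conj w *ᶜ conj z
  conj-* w z = solve 4 (λ a b c d → a :* c :- b :* d := a :* c :- (:- b) :* (:- d)) (re w) (im w) (re z) (im z) ,
               solve 4 (λ a b c d → :- (a :* d :+ b :* c) := a :* (:- d) :+ (:- b) :* c) (re w) (im w) (re z) (im z)

  conj-+ : ∀ w z → conj (w +ᶜ z) ≈ᶜ conj w +ᶜ conj z
  conj-+ w z = refl , solve 2 (λ a b → :- (a :+ b) := (:- a) :+ (:- b)) (im w) (im z)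

  z*conj[z] : ∀ z → z *ᶜ conj z ≈ᶜ ι ∣ z ∣²
  z*conj[z] z = solve 2 (λ a b → a :* a :- b :* (:- b) := a :* a :+ b :* b) (re z) (im z) ,
                solve 2 (λ a b → a :* (:- b) :+ b :* a := # 0) (re z) (im z)

  ∣∣²-cong : ∀ {w z} → w ≈ᶜ z → ∣ w ∣² ≈ ∣ z ∣²
  ∣∣²-cong (p , q) = +-cong (*-cong p p) (*-cong q q)

  ∣∣²-nonNeg : ∀ z → 0# ≤ ∣ z ∣²
  ∣∣²-nonNeg z = square-nonNeg (re z) ⊹ square-nonNeg (im z)

  ∣∣²-* : ∀ w z → ∣ w *ᶜ z ∣² ≈ ∣ w ∣² * ∣ z ∣²
  ∣∣²-* w z = solve 4 (λ a b c d → :∣ (a , b) :*ᶜ (c , d) ∣² := :∣ a , b ∣² :* :∣ c , d ∣²) (re w) (im w) (re z) (im z)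

  ∣∣²-conj : ∀ z → ∣ conj z ∣² ≈ ∣ z ∣²
  ∣∣²-conj z = solve 2 (λ a b → :∣ :conj (a , b) ∣² := :∣ a , b ∣²) (re z) (im z)

  ∣0∣² : ∣ 0ᶜ ∣² ≈ 0#
  ∣0∣² = solve 0 (# 0 :* # 0 :+ # 0 :* # 0 := # 0)

  ∣∣²-sub-≤ : ∀ w z → ∣ w -ᶜ z ∣² ≤ num 2 * (∣ w ∣² + ∣ z ∣²)
  ∣∣²-sub-≤ w z = ≤-via (∣∣²-nonNeg (w +ᶜ z))
    (solve 4 (λ a b c d → # 2 :* (:∣ a , b ∣² :+ :∣ c , d ∣²) :- :∣ (a , b) :-ᶜ (c , d) ∣² := :∣ (a , b) :+ᶜ (c , d) ∣²)
      (re w) (im w) (re z) (im z))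

  ∣∣²-+₃-≤ : ∀ u w z → ∣ u +ᶜ w +ᶜ z ∣² ≤ num 3 * (∣ u ∣² + ∣ w ∣² + ∣ z ∣²)
  ∣∣²-+₃-≤ u w z = ≤-via (∣∣²-nonNeg (u -ᶜ w) ⊹ ∣∣²-nonNeg (u -ᶜ z) ⊹ ∣∣²-nonNeg (w -ᶜ z))
    (solve 6 (λ a b c d e f → # 3 :* (:∣ a , b ∣² :+ :∣ c , d ∣² :+ :∣ e , f ∣²) :- :∣ (a , b) :+ᶜ (c , d) :+ᶜ (e , f) ∣² :=
        :∣ (a , b) :-ᶜ (c , d) ∣² :+ (:∣ (a , b) :-ᶜ (e , f) ∣² :+ :∣ (c , d) :-ᶜ (e , f) ∣²))
      (re u) (im u) (re w) (im w) (re z) (im z))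

  re²≤∣∣² : ∀ z → re z * re z ≤ ∣ z ∣²
  re²≤∣∣² z = ≤-via (square-nonNeg (im z)) (solve 2 (λ a b → (a :* a :+ b :* b) :- a :* a := b :* b) (re z) (im z))

  ∣∣-nonNeg : ∀ z → 0# ≤ ∣ z ∣
  ∣∣-nonNeg z = √-nonNeg (∣∣²-nonNeg z)

  ∣∣-square : ∀ z → ∣ z ∣ * ∣ z ∣ ≈ ∣ z ∣²
  ∣∣-square z = √-square (∣∣²-nonNeg z)

  re≤∣∣ : ∀ z → re z ≤ ∣ z ∣
  re≤∣∣ z = square-cancel-≤ (∣∣-nonNeg z) (≤-respʳ-≈ (sym (∣∣-square z)) (re²≤∣∣² z))

  ∣∣≤ : ∀ {z b} → 0# ≤ b → ∣ z ∣² ≤ b * b → ∣ z ∣ ≤ b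
  ∣∣≤ {z} 0≤b zz≤bb = square-cancel-≤ 0≤b (≤-respˡ-≈ (sym (∣∣-square z)) zz≤bb)

  private variable
    A : Set

  ∑-mono-≤ : ∀ {f g : A → ℝ} → (∀ a → f a ≤ g a) → ∀ xs → ∑ xs f ≤ ∑ xs g
  ∑-mono-≤ f≤g []       = ≤-refl
  ∑-mono-≤ f≤g (x ∷ xs) = +-mono-≤ (f≤g x) (∑-mono-≤ f≤g xs)

  ∑-nonNeg : ∀ {f : A → ℝ} → (∀ a → 0# ≤ f a) → ∀ xs → 0# ≤ ∑ xs f
  ∑-nonNeg 0≤f []       = ≤-refl
  ∑-nonNeg 0≤f (x ∷ xs) = 0≤f x ⊹ ∑-nonNeg 0≤f xs

  term≤∑ : ∀ {f : A → ℝ} → (∀ a → 0# ≤ f a) → ∀ {x xs} → x ∈ˡ xs → f x ≤ ∑ xs f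
  term≤∑ {f = f} 0≤f {x} {.x ∷ xs} (here ≡.refl) = ≤-via (∑-nonNeg 0≤f xs)
    (solve 2 (λ a b → (a :+ b) :- a := b) (f x) (∑ xs f))
  term≤∑ {f = f} 0≤f {x} {y ∷ xs} (there x∈xs) = ≤-trans (term≤∑ 0≤f x∈xs)
    (≤-via (0≤f y) (solve 2 (λ a b → (a :+ b) :- b := a) (f y) (∑ xs f)))

  re-∑ᶜ : ∀ xs (f : A → ℂ) → re (∑ᶜ xs f) ≈ ∑ xs (λ a → re (f a))
  re-∑ᶜ []       f = refl
  re-∑ᶜ (x ∷ xs) f = +-congˡ (re-∑ᶜ xs f)

  im-∑ᶜ : ∀ xs (f : A → ℂ) → im (∑ᶜ xs f) ≈ ∑ xs (λ a → im (f a))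
  im-∑ᶜ []       f = refl
  im-∑ᶜ (x ∷ xs) f = +-congˡ (im-∑ᶜ xs f)

  conj-∑ᶜ : ∀ xs (f : A → ℂ) → conj (∑ᶜ xs f) ≈ᶜ ∑ᶜ xs (λ a → conj (f a))
  conj-∑ᶜ []       f = refl , solve 0 (:- # 0 := # 0)
  conj-∑ᶜ (x ∷ xs) f = ℂᴿ.trans (conj-+ (f x) (∑ᶜ xs f)) (ℂᴿ.+-congˡ (conj-∑ᶜ xs f))

  ‖_‖²⟨_⟩ : (A → ℂ) → List A → ℝ
  ‖ v ‖²⟨ xs ⟩ = ∑ xs (λ a → ∣ v a ∣²)

  ‖‖²-nonNeg : ∀ (v : A → ℂ) xs → 0# ≤ ‖ v ‖²⟨ xs ⟩
  ‖‖²-nonNeg v = ∑-nonNeg (λ a → ∣∣²-nonNeg (v a))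

  -- The inequality of the arithmetic and geometric means without square roots, where `x` is in the
  -- place of 2 √(a b).
  amgm : ∀ {x a b} → 0# ≤ a → 0# ≤ b → x * x ≤ num 4 * (a * b) → x ≤ a + b
  amgm {x} {a} {b} 0≤a 0≤b xx≤4ab = square-cancel-≤ (0≤a ⊹ 0≤b) (≤-trans xx≤4ab
    (≤-via (square-nonNeg (a - b)) (solve 2 (λ a b → (a :+ b) :* (a :+ b) :- # 4 :* (a :* b) := (a :- b) :* (a :- b)) a b)))

  -- Induction on the list. Expanding both sides leaves the induction hypothesis and the cross term
  -- 2 Re (v w conj s), which is bounded by `amgm` and, once more, the induction hypothesis.
  cauchy-schwarz : ∀ xs (v w : A → ℂ) → ∣ ∑ᶜ xs (λ a → v a *ᶜ w a) ∣² ≤ ‖ v ‖²⟨ xs ⟩ * ‖ w ‖²⟨ xs ⟩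
  cauchy-schwarz [] v w = ≤-reflexive (trans ∣0∣² (sym (zeroˡ 0#)))
  cauchy-schwarz (x ∷ xs) v w = ≤-via
    (gap (cauchy-schwarz xs v w) ⊹ gap cross)
    (solve 8 (λ a b c d e f V W → (:∣ a , b ∣² :+ V) :* (:∣ c , d ∣² :+ W) :- :∣ (a , b) :*ᶜ (c , d) :+ᶜ (e , f) ∣² :=
        (V :* W :- :∣ e , f ∣²) :+ ((:∣ a , b ∣² :* W :+ V :* :∣ c , d ∣²) :- # 2 :* proj₁ ((a , b) :*ᶜ (c , d) :*ᶜ :conj (e , f))))
      (re (v x)) (im (v x)) (re (w x)) (im (w x)) (re s) (im s) V W)
    where
    s : ℂ
    s = ∑ᶜ xs (λ a → v a *ᶜ w a)
    V W : ℝ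
    V = ‖ v ‖²⟨ xs ⟩
    W = ‖ w ‖²⟨ xs ⟩
    open ≤-Reasoning
    cross : num 2 * re (v x *ᶜ w x *ᶜ conj s) ≤ ∣ v x ∣² * W + V * ∣ w x ∣²
    cross = amgm (∣∣²-nonNeg (v x) ⊠ ‖‖²-nonNeg w xs) (‖‖²-nonNeg v xs ⊠ ∣∣²-nonNeg (w x)) (begin
      num 2 * re t * (num 2 * re t)
        ≈⟨ solve 1 (λ r → # 2 :* r :* (# 2 :* r) := # 4 :* (r :* r)) (re t) ⟩
      num 4 * (re t * re t)
        ≤⟨ *-monoˡ-≤ (0≤num 4) (re²≤∣∣² t) ⟩
      num 4 * ∣ t ∣²
        ≈⟨ *-congˡ (solve 6 (λ a b c d e f → :∣ (a , b) :*ᶜ (c , d) :*ᶜ :conj (e , f) ∣² := :∣ a , b ∣² :* :∣ c , d ∣² :* :∣ e , f ∣²)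
             (re (v x)) (im (v x)) (re (w x)) (im (w x)) (re s) (im s)) ⟩
      num 4 * (∣ v x ∣² * ∣ w x ∣² * ∣ s ∣²)
        ≤⟨ *-monoˡ-≤ (0≤num 4) (*-monoˡ-≤ (∣∣²-nonNeg (v x) ⊠ ∣∣²-nonNeg (w x)) (cauchy-schwarz xs v w)) ⟩
      num 4 * (∣ v x ∣² * ∣ w x ∣² * (V * W))
        ≈⟨ *-congˡ (solve 4 (λ a b c d → a :* b :* (c :* d) := a :* d :* (c :* b)) ∣ v x ∣² ∣ w x ∣² V W) ⟩
      num 4 * (∣ v x ∣² * W * (V * ∣ w x ∣²)) ∎)
      where
      t : ℂ
      t = v x *ᶜ w x *ᶜ conj s

  ⟪_,_⟫⟨_⟩ : (A → ℂ) → (A → ℂ) → List A → ℂ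
  ⟪ v , w ⟫⟨ xs ⟩ = ∑ᶜ xs (λ a → v a *ᶜ conj (w a))

  ∣⟪⟫∣²≤ : ∀ xs (v w : A → ℂ) → ∣ ⟪ v , w ⟫⟨ xs ⟩ ∣² ≤ ‖ v ‖²⟨ xs ⟩ * ‖ w ‖²⟨ xs ⟩
  ∣⟪⟫∣²≤ xs v w = ≤-respʳ-≈ (*-congˡ (∑-cong (λ a → ∣∣²-conj (w a)) xs)) (cauchy-schwarz xs v (λ a → conj (w a)))

-- Expectations and marginals

module ExpectationProperties (ℛ : CompleteOrderedField) where
  open Theory ℛ hiding (zero)
  open RealFieldProperties ℛ
  open ComplexProperties ℛ

  NonNegative : ∀ {Ω} → Weighted Ω → Set
  NonNegative μ = ∀ ω → 0# ≤ weight μ ω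

  module _ {Ω : Set} (μ : Weighted Ω) where

    𝔼-cong : ∀ {f g : Ω → ℝ} → (∀ ω → f ω ≈ g ω) → 𝔼 μ f ≈ 𝔼 μ g
    𝔼-cong f≈g = ∑-cong (λ ω → *-congˡ (f≈g ω)) (points μ)

    𝔼-+ : ∀ (f g : Ω → ℝ) → 𝔼 μ (λ ω → f ω + g ω) ≈ 𝔼 μ f + 𝔼 μ g
    𝔼-+ f g = trans (∑-cong (λ ω → distribˡ _ _ _) (points μ)) (∑-+ (points μ) _ _)

    𝔼-sub : ∀ (f g : Ω → ℝ) → 𝔼 μ (λ ω → f ω - g ω) ≈ 𝔼 μ f - 𝔼 μ g
    𝔼-sub f g = trans (∑-cong (λ ω → solve 3 (λ w a b → w :* (a :- b) := w :* a :- w :* b) (weight μ ω) (f ω) (g ω)) (points μ)) (∑-sub (points μ) _ _)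

    𝔼-*ˡ : ∀ c (f : Ω → ℝ) → 𝔼 μ (λ ω → c * f ω) ≈ c * 𝔼 μ f
    𝔼-*ˡ c f = trans (∑-cong (λ ω → solve 3 (λ w c a → w :* (c :* a) := c :* (w :* a)) (weight μ ω) c (f ω)) (points μ))
                     (sym (*-distribˡ-∑ c (points μ) _))

    𝔼-∑ : ∀ {A : Set} (xs : List A) (f : A → Ω → ℝ) → 𝔼 μ (λ ω → ∑ xs (λ a → f a ω)) ≈ ∑ xs (λ a → 𝔼 μ (f a))
    𝔼-∑ xs f = trans (∑-cong (λ ω → *-distribˡ-∑ (weight μ ω) xs (λ a → f a ω)) (points μ)) (∑-swap (points μ) xs _)

    𝔼ᶜ-cong : ∀ {f g : Ω → ℂ} → (∀ ω → f ω ≈ᶜ g ω) → 𝔼ᶜ μ f ≈ᶜ 𝔼ᶜ μ g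
    𝔼ᶜ-cong f≈g = ℂ∑.∑-cong (λ ω → *-congˡ (proj₁ (f≈g ω)) , *-congˡ (proj₂ (f≈g ω))) (points μ)

    𝔼ᶜ≈∑ι : ∀ (f : Ω → ℂ) → 𝔼ᶜ μ f ≈ᶜ ∑ᶜ (points μ) (λ ω → ι (weight μ ω) *ᶜ f ω)
    𝔼ᶜ≈∑ι f = ℂ∑.∑-cong (λ ω → ·ᶜ≈ι* (weight μ ω) (f ω)) (points μ)

    𝔼ᶜ-+ : ∀ (f g : Ω → ℂ) → 𝔼ᶜ μ (λ ω → f ω +ᶜ g ω) ≈ᶜ 𝔼ᶜ μ f +ᶜ 𝔼ᶜ μ g
    𝔼ᶜ-+ f g = ℂᴿ.trans (ℂ∑.∑-cong (λ ω → distribˡ _ _ _ , distribˡ _ _ _) (points μ)) (ℂ∑.∑-+ (points μ) _ _)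

    𝔼ᶜ-*ˡ : ∀ c (f : Ω → ℂ) → 𝔼ᶜ μ (λ ω → c *ᶜ f ω) ≈ᶜ c *ᶜ 𝔼ᶜ μ f
    𝔼ᶜ-*ˡ c f = begin
      𝔼ᶜ μ (λ ω → c *ᶜ f ω)                                         ≈⟨ 𝔼ᶜ≈∑ι _ ⟩
      ∑ᶜ (points μ) (λ ω → ι (weight μ ω) *ᶜ (c *ᶜ f ω))            ≈⟨ ℂ∑.∑-cong (λ ω → solveᶜ 3 (λ w c a → w ⊗ (c ⊗ a) ⊜ c ⊗ (w ⊗ a)) (ι (weight μ ω)) c (f ω)) (points μ) ⟩
      ∑ᶜ (points μ) (λ ω → c *ᶜ (ι (weight μ ω) *ᶜ f ω))            ≈⟨ ℂ∑.*-distribˡ-∑ c (points μ) _ ⟨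
      c *ᶜ ∑ᶜ (points μ) (λ ω → ι (weight μ ω) *ᶜ f ω)              ≈⟨ ℂᴿ.*-congˡ (𝔼ᶜ≈∑ι f) ⟨
      c *ᶜ 𝔼ᶜ μ f ∎
      where open ℂ-Reasoning

    𝔼ᶜ-∑ : ∀ {A : Set} (xs : List A) (f : A → Ω → ℂ) → 𝔼ᶜ μ (λ ω → ∑ᶜ xs (λ a → f a ω)) ≈ᶜ ∑ᶜ xs (λ a → 𝔼ᶜ μ (f a))
    𝔼ᶜ-∑ xs f = begin
      𝔼ᶜ μ (λ ω → ∑ᶜ xs (λ a → f a ω))                                      ≈⟨ 𝔼ᶜ≈∑ι _ ⟩
      ∑ᶜ (points μ) (λ ω → ι (weight μ ω) *ᶜ ∑ᶜ xs (λ a → f a ω))           ≈⟨ ℂ∑.∑-cong (λ ω → ℂ∑.*-distribˡ-∑ _ xs _) (points μ) ⟩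
      ∑ᶜ (points μ) (λ ω → ∑ᶜ xs (λ a → ι (weight μ ω) *ᶜ f a ω))           ≈⟨ ℂ∑.∑-swap (points μ) xs _ ⟩
      ∑ᶜ xs (λ a → ∑ᶜ (points μ) (λ ω → ι (weight μ ω) *ᶜ f a ω))           ≈⟨ ℂ∑.∑-cong (λ a → 𝔼ᶜ≈∑ι (f a)) xs ⟨
      ∑ᶜ xs (λ a → 𝔼ᶜ μ (f a)) ∎
      where open ℂ-Reasoning

    re-𝔼ᶜ : ∀ (f : Ω → ℂ) → re (𝔼ᶜ μ f) ≈ 𝔼 μ (λ ω → re (f ω))
    re-𝔼ᶜ f = re-∑ᶜ (points μ) _

    im-𝔼ᶜ : ∀ (f : Ω → ℂ) → im (𝔼ᶜ μ f) ≈ 𝔼 μ (λ ω → im (f ω))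
    im-𝔼ᶜ f = im-∑ᶜ (points μ) _

    module _ (μ≥0 : NonNegative μ) where

      ¬supp⇒≈0 : ∀ {ω} → ¬ supp μ ω → weight μ ω ≈ 0#
      ¬supp⇒≈0 {ω} ω∉ with weight μ ω ≤? 0#
      ... | yes w≤0 = antisym w≤0 (μ≥0 ω)
      ... | no  0<w with () ← ω∉ 0<w

      weighted-nonNeg : ∀ {t ω} → (supp μ ω → 0# ≤ t) → 0# ≤ weight μ ω * t
      weighted-nonNeg {t} {ω} 0≤t with weight μ ω ≤? 0#
      ... | yes w≤0 = ≤-respʳ-≈ (sym (trans (*-congʳ (antisym w≤0 (μ≥0 ω))) (zeroˡ t))) ≤-refl
      ... | no  0<w = μ≥0 ω ⊠ 0≤t 0<w

      𝔼-nonNeg : ∀ {f : Ω → ℝ} → (∀ ω → supp μ ω → 0# ≤ f ω) → 0# ≤ 𝔼 μ f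
      𝔼-nonNeg 0≤f = ∑-nonNeg (λ ω → weighted-nonNeg (0≤f ω)) (points μ)

      𝔼-mono-≤ : ∀ {f g : Ω → ℝ} → (∀ ω → supp μ ω → f ω ≤ g ω) → 𝔼 μ f ≤ 𝔼 μ g
      𝔼-mono-≤ {f} {g} f≤g = ≤-via (𝔼-nonNeg (λ ω ω∈ → gap (f≤g ω ω∈))) (sym (𝔼-sub g f))

      𝔼-cong-supp : ∀ {f g : Ω → ℝ} → (∀ ω → supp μ ω → f ω ≈ g ω) → 𝔼 μ f ≈ 𝔼 μ g
      𝔼-cong-supp f≈g = antisym (𝔼-mono-≤ λ ω ω∈ → ≤-reflexive (f≈g ω ω∈)) (𝔼-mono-≤ λ ω ω∈ → ≤-reflexive (sym (f≈g ω ω∈)))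

      𝔼ᶜ-cong-supp : ∀ {f g : Ω → ℂ} → (∀ ω → supp μ ω → f ω ≈ᶜ g ω) → 𝔼ᶜ μ f ≈ᶜ 𝔼ᶜ μ g
      𝔼ᶜ-cong-supp {f} {g} f≈g =
        trans (re-𝔼ᶜ f) (trans (𝔼-cong-supp λ ω ω∈ → proj₁ (f≈g ω ω∈)) (sym (re-𝔼ᶜ g))) ,
        trans (im-𝔼ᶜ f) (trans (𝔼-cong-supp λ ω ω∈ → proj₂ (f≈g ω ω∈)) (sym (im-𝔼ᶜ g)))

      weighted≤𝔼 : ∀ {f : Ω → ℝ} → (∀ ω → supp μ ω → 0# ≤ f ω) → ∀ {ω} → ω ∈ˡ points μ → weight μ ω * f ω ≤ 𝔼 μ f
      weighted≤𝔼 0≤f = term≤∑ (λ ω → weighted-nonNeg (0≤f ω))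

    𝔼-const : ∑ (points μ) (weight μ) ≈ 1# → ∀ c → 𝔼 μ (λ _ → c) ≈ c
    𝔼-const total c = trans (sym (*-distribʳ-∑ c (points μ) (weight μ))) (trans (*-congʳ total) (*-identityˡ c))

  -- Marginals of a distribution on triples

  module Marginals {s g p} (μ : Fin s × Fin g × Fin p → ℝ) where

    triple∈ : ∀ ω → ω ∈ˡ points (dist μ)
    triple∈ (x , y , z) = ∈-cartesianProduct⁺ (∈-allFin x) (∈-cartesianProduct⁺ (∈-allFin y) (∈-allFin z))

    ∑-triples : ∀ (f : Fin s × Fin g × Fin p → ℝ) → ∑ (points (dist μ)) f ≈
      ∑ (allFin s) λ x → ∑ (allFin g) λ y → ∑ (allFin p) λ z → f (x , y , z)
    ∑-triples f = trans (∑-cartesianProductWith _,_ (allFin s) _ f)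
      (∑-cong (λ x → ∑-cartesianProductWith _,_ (allFin g) (allFin p) _) (allFin s))

    𝔼-x : ∀ f → 𝔼 (dist μ) (λ (x , y , z) → f x) ≈ 𝔼 (marginalˣ μ) f
    𝔼-x f = trans (∑-triples _) (∑-cong (λ x → begin
      (∑ (allFin g) λ y → ∑ (allFin p) λ z → μ (x , y , z) * f x)
        ≈⟨ ∑-cong (λ y → *-distribʳ-∑ (f x) (allFin p) _) (allFin g) ⟨
      (∑ (allFin g) λ y → (∑ (allFin p) λ z → μ (x , y , z)) * f x)
        ≈⟨ *-distribʳ-∑ (f x) (allFin g) _ ⟨
      weight (marginalˣ μ) x * f x ∎) (allFin s))
      where open ≈-Reasoning

    ∑-yz-first : ∀ (f : Fin s × Fin g × Fin p → ℝ) →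
      (∑ (allFin s) λ x → ∑ (allFin g) λ y → ∑ (allFin p) λ z → f (x , y , z)) ≈
      (∑ (allFin g) λ y → ∑ (allFin p) λ z → ∑ (allFin s) λ x → f (x , y , z))
    ∑-yz-first f = trans (∑-swap (allFin s) (allFin g) _) (∑-cong (λ y → ∑-swap (allFin s) (allFin p) _) (allFin g))

    𝔼-yz : (∀ y z → weight (marginalʸᶻ μ) (y , z) ≈ weight (marginalʸ μ) y * weight (marginalᶻ μ) z) →
      ∀ (f : Fin g → ℝ) (h : Fin p → ℝ) → 𝔼 (dist μ) (λ (x , y , z) → f y * h z) ≈ 𝔼 (marginalʸ μ) f * 𝔼 (marginalᶻ μ) h
    𝔼-yz product f h = begin
      𝔼 (dist μ) (λ (x , y , z) → f y * h z)
        ≈⟨ trans (∑-triples _) (∑-yz-first _) ⟩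
      (∑ (allFin g) λ y → ∑ (allFin p) λ z → ∑ (allFin s) λ x → μ (x , y , z) * (f y * h z))
        ≈⟨ ∑-cong (λ y → ∑-cong (λ z → trans (sym (*-distribʳ-∑ (f y * h z) (allFin s) _)) (*-congʳ (product y z))) (allFin p)) (allFin g) ⟩
      (∑ (allFin g) λ y → ∑ (allFin p) λ z → (weight (marginalʸ μ) y * weight (marginalᶻ μ) z) * (f y * h z))
        ≈⟨ ∑-cong (λ y → ∑-cong (λ z → solve 4 (λ a b c d → (a :* b) :* (c :* d) := (a :* c) :* (b :* d))
             (weight (marginalʸ μ) y) (weight (marginalᶻ μ) z) (f y) (h z)) (allFin p)) (allFin g) ⟩
      (∑ (allFin g) λ y → ∑ (allFin p) λ z → (weight (marginalʸ μ) y * f y) * (weight (marginalᶻ μ) z * h z))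
        ≈⟨ ∑-* (allFin g) _ (allFin p) _ ⟨
      𝔼 (marginalʸ μ) f * 𝔼 (marginalᶻ μ) h ∎
      where open ≈-Reasoning

    module _ (μ≥0 : NonNegative (dist μ)) where

      marginalˣ-nonNeg : NonNegative (marginalˣ μ)
      marginalˣ-nonNeg x = ∑-nonNeg (λ y → ∑-nonNeg (λ z → μ≥0 _) (allFin p)) (allFin g)

      marginalʸ-nonNeg : NonNegative (marginalʸ μ)
      marginalʸ-nonNeg y = ∑-nonNeg (λ x → ∑-nonNeg (λ z → μ≥0 _) (allFin p)) (allFin s)

      marginalᶻ-nonNeg : NonNegative (marginalᶻ μ)
      marginalᶻ-nonNeg z = ∑-nonNeg (λ x → ∑-nonNeg (λ y → μ≥0 _) (allFin g)) (allFin s)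

      μ≤marginalˣ : ∀ x y z → μ (x , y , z) ≤ weight (marginalˣ μ) x
      μ≤marginalˣ x y z = ≤-trans (term≤∑ (λ z → μ≥0 _) (∈-allFin z))
        (term≤∑ (λ y → ∑-nonNeg (λ z → μ≥0 _) (allFin p)) (∈-allFin y))

      μ≤marginalʸ : ∀ x y z → μ (x , y , z) ≤ weight (marginalʸ μ) y
      μ≤marginalʸ x y z = ≤-trans (term≤∑ (λ z → μ≥0 _) (∈-allFin z))
        (term≤∑ (λ x → ∑-nonNeg (λ z → μ≥0 _) (allFin p)) (∈-allFin x))

      μ≤marginalᶻ : ∀ x y z → μ (x , y , z) ≤ weight (marginalᶻ μ) z
      μ≤marginalᶻ x y z = ≤-trans (term≤∑ (λ y → μ≥0 _) (∈-allFin y))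
        (term≤∑ (λ x → ∑-nonNeg (λ y → μ≥0 _) (allFin g)) (∈-allFin x))

      -- A decidable conclusion spares the choice of a point above `x`: if it failed, no point above
      -- `x` would lie in the support, and the marginal weight of `x` would be a sum of zeros.
      ≤-on-suppˣ : ∀ {x t u} → supp (marginalˣ μ) x → (∀ y z → supp (dist μ) (x , y , z) → t ≤ u) → t ≤ u
      ≤-on-suppˣ {x} {t} {u} 0<x bound with t ≤? u
      ... | yes t≤u = t≤u
      ... | no  u<t with () ← 0<⇒≉0 0<x (∑-zero (λ y → ∑-zero (λ z →
              ¬supp⇒≈0 (dist μ) μ≥0 {x , y , z} λ ω∈ → u<t (bound y z ω∈)) (allFin p)) (allFin g))

      -- Independence of y and z: if y and z′ both have positive marginal weight, then so has (y ,
      -- z′), hence some point of the support lies above this mixed pair.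
      ≤-on-suppʸᶻ : (∀ y z → weight (marginalʸᶻ μ) (y , z) ≈ weight (marginalʸ μ) y * weight (marginalᶻ μ) z) →
        ∀ {x y z x′ y′ z′ t u} → supp (dist μ) (x , y , z) → supp (dist μ) (x′ , y′ , z′) →
        (∀ x → supp (dist μ) (x , y , z′) → t ≤ u) → t ≤ u
      ≤-on-suppʸᶻ product {x} {y} {z} {x′} {y′} {z′} {t} {u} ω∈ ω′∈ bound with t ≤? u
      ... | yes t≤u = t≤u
      ... | no  u<t with () ← 0<⇒≉0
              (*-pos (<-≤-trans ω∈ (μ≤marginalʸ x y z)) (<-≤-trans ω′∈ (μ≤marginalᶻ x′ y′ z′)))
              (trans (sym (product y z′)) (∑-zero (λ x → ¬supp⇒≈0 (dist μ) μ≥0 {x , y , z′} λ ω∈ → u<t (bound x ω∈)) (allFin s)))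

    marginalˣ-total : ∑ (points (dist μ)) μ ≈ 1# → ∑ (allFin s) (weight (marginalˣ μ)) ≈ 1#
    marginalˣ-total total = trans (sym (∑-triples μ)) total

-- Polarisation of bounded bilinear families

module BilinearForms (ℛ : CompleteOrderedField) where
  open Theory ℛ hiding (zero)
  open RealFieldProperties ℛ
  open ComplexProperties ℛ
  open ExpectationProperties ℛ

  record BilinearFamily (I Y Z : Set) : Set where
    field
      L       : I → (Y → ℂ) → (Z → ℂ) → ℂ
      linearˡ : ∀ i ω G G′ H → L i (λ w → G w +ᶜ ω *ᶜ G′ w) H ≈ᶜ L i G H +ᶜ ω *ᶜ L i G′ H
      linearʳ : ∀ i ω G H H′ → L i G (λ w → H w +ᶜ ω *ᶜ H′ w) ≈ᶜ L i G H +ᶜ ω *ᶜ L i G H′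

  norm-combination : ∀ {Y} (ν : Weighted Y) (G G′ : Y → ℂ) ω → 𝔼 ν (λ w → ∣ G w +ᶜ ω *ᶜ G′ w ∣²) ≈
    𝔼 ν (λ w → ∣ G w ∣²) + ∣ ω ∣² * 𝔼 ν (λ w → ∣ G′ w ∣²)
      + num 2 * (re ω * re ⟨ G , G′ ⟩[ ν ] + im ω * im ⟨ G , G′ ⟩[ ν ])
  norm-combination ν G G′ ω = begin
    𝔼 ν (λ w → ∣ G w +ᶜ ω *ᶜ G′ w ∣²)
      ≈⟨ 𝔼-cong ν (λ w → solve 6 (λ a b c d e f → :∣ (c , d) :+ᶜ (a , b) :*ᶜ (e , f) ∣² :=
           :∣ c , d ∣² :+ :∣ a , b ∣² :* :∣ e , f ∣² :+
           (# 2 :* a :* proj₁ ((c , d) :*ᶜ :conj (e , f)) :+ # 2 :* b :* proj₂ ((c , d) :*ᶜ :conj (e , f))))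
           (re ω) (im ω) (re (G w)) (im (G w)) (re (G′ w)) (im (G′ w))) ⟩
    𝔼 ν (λ w → ∣ G w ∣² + ∣ ω ∣² * ∣ G′ w ∣² + (num 2 * re ω * re (G w *ᶜ conj (G′ w)) + num 2 * im ω * im (G w *ᶜ conj (G′ w))))
      ≈⟨ trans (𝔼-+ ν _ _) (+-cong (𝔼-+ ν _ _) (𝔼-+ ν _ _)) ⟩
    𝔼 ν (λ w → ∣ G w ∣²) + 𝔼 ν (λ w → ∣ ω ∣² * ∣ G′ w ∣²)
      + (𝔼 ν (λ w → num 2 * re ω * re (G w *ᶜ conj (G′ w))) + 𝔼 ν (λ w → num 2 * im ω * im (G w *ᶜ conj (G′ w))))
      ≈⟨ +-cong (+-congˡ (𝔼-*ˡ ν _ _)) (+-cong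
           (trans (𝔼-*ˡ ν _ _) (*-congˡ (sym (re-𝔼ᶜ ν _)))) (trans (𝔼-*ˡ ν _ _) (*-congˡ (sym (im-𝔼ᶜ ν _))))) ⟩
    𝔼 ν (λ w → ∣ G w ∣²) + ∣ ω ∣² * 𝔼 ν (λ w → ∣ G′ w ∣²)
      + (num 2 * re ω * re ⟨ G , G′ ⟩[ ν ] + num 2 * im ω * im ⟨ G , G′ ⟩[ ν ])
      ≈⟨ +-congˡ (solve 5 (λ t a b c d → t :* a :* c :+ t :* b :* d := t :* (a :* c :+ b :* d)) (num 2) (re ω) (im ω) _ _) ⟩
    𝔼 ν (λ w → ∣ G w ∣²) + ∣ ω ∣² * 𝔼 ν (λ w → ∣ G′ w ∣²)
      + num 2 * (re ω * re ⟨ G , G′ ⟩[ ν ] + im ω * im ⟨ G , G′ ⟩[ ν ]) ∎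
    where open ≈-Reasoning

  module Defect {I Y Z : Set} (X : List I) (ν : Weighted Y) (ξ : Weighted Z) (𝒰 : BilinearFamily I Y Z) (D : ℝ) where
    open BilinearFamily 𝒰

    u : (Y → ℂ) → (Z → ℂ) → I → ℂ
    u G H i = L i G H

    defect : (Y → ℂ) → (Z → ℂ) → ℝ
    defect G H = D * (𝔼 ν (λ w → ∣ G w ∣²) * 𝔼 ξ (λ w → ∣ H w ∣²)) - ‖ u G H ‖²⟨ X ⟩

    Bounded : Set
    Bounded = ∀ G H → ‖ u G H ‖²⟨ X ⟩ ≤ D * (𝔼 ν (λ w → ∣ G w ∣²) * 𝔼 ξ (λ w → ∣ H w ∣²))

    -- The sesquilinear form behind `defect`: on the diagonal, `Δ G G H H` is `defect G H`.
    Δ : (G G′ : Y → ℂ) (H H′ : Z → ℂ) → ℂ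
    Δ G G′ H H′ = ι D *ᶜ (⟨ G , G′ ⟩[ ν ] *ᶜ ⟨ H , H′ ⟩[ ξ ]) -ᶜ ⟪ u G H , u G′ H′ ⟫⟨ X ⟩

    module _ (bounded : Bounded) (G G′ : Y → ℂ) (H H′ : Z → ℂ) where
      private
        P P′ Q Q′ : ℝ
        P  = 𝔼 ν (λ w → ∣ G w ∣²)
        P′ = 𝔼 ν (λ w → ∣ G′ w ∣²)
        Q  = 𝔼 ξ (λ w → ∣ H w ∣²)
        Q′ = 𝔼 ξ (λ w → ∣ H′ w ∣²)
        A B : ℂ
        A = ⟨ G , G′ ⟩[ ν ]
        B = ⟨ H , H′ ⟩[ ξ ]

        -- The expansion of `L i` at G + ω η G′ and H + conj ω H′. Its four coefficients are 1, conj
        -- ω, ω η and η, so the first and the last term keep a cross term free of ω. The two middle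
        -- terms meet with conj ω², which ±1 alone would not average to 0; hence fourth roots of
        -- unity.
        w∙ : ℂ → ℂ → I → ℂ
        w∙ ω η i = L i G H +ᶜ conj ω *ᶜ L i G H′ +ᶜ ω *ᶜ η *ᶜ (L i G′ H +ᶜ conj ω *ᶜ L i G′ H′)

        rotated : ∀ ω η →
          ‖ w∙ ω η ‖²⟨ X ⟩ ≤ D * ((P + ∣ ω *ᶜ η ∣² * P′ + num 2 * (re (ω *ᶜ η) * re A + im (ω *ᶜ η) * im A))
                                * (Q + ∣ conj ω ∣² * Q′ + num 2 * (re (conj ω) * re B + im (conj ω) * im B)))
        rotated ω η = ≤-respˡ-≈
          (∑-cong (λ i → ∣∣²-cong (ℂᴿ.trans (linearˡ i (ω *ᶜ η) G G′ _)
            (ℂᴿ.+-cong (linearʳ i (conj ω) G H H′) (ℂᴿ.*-congˡ (linearʳ i (conj ω) G′ H H′))))) X)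
          (≤-respʳ-≈ (*-congˡ (*-cong (norm-combination ν G G′ (ω *ᶜ η)) (norm-combination ξ H H′ (conj ω))))
            (bounded _ _))

        roots : ∀ η → ‖ w∙ 1ᶜ η ‖²⟨ X ⟩ + ‖ w∙ (-ᶜ 1ᶜ) η ‖²⟨ X ⟩ + (‖ w∙ (0# +i 1#) η ‖²⟨ X ⟩ + ‖ w∙ (0# +i (- 1#)) η ‖²⟨ X ⟩)
          ≈ num 4 * ((‖ u G H ‖²⟨ X ⟩ + ‖ u G H′ ‖²⟨ X ⟩ + ∣ η ∣² * (‖ u G′ H ‖²⟨ X ⟩ + ‖ u G′ H′ ‖²⟨ X ⟩))
                     + num 2 * (re η * re ⟪ u G H , u G′ H′ ⟫⟨ X ⟩ + im η * im ⟪ u G H , u G′ H′ ⟫⟨ X ⟩))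
        roots η = begin
          ‖ w∙ 1ᶜ η ‖²⟨ X ⟩ + ‖ w∙ (-ᶜ 1ᶜ) η ‖²⟨ X ⟩ + (‖ w∙ (0# +i 1#) η ‖²⟨ X ⟩ + ‖ w∙ (0# +i (- 1#)) η ‖²⟨ X ⟩)
            ≈⟨ trans (+-cong (sym (∑-+ X _ _)) (sym (∑-+ X _ _))) (sym (∑-+ X _ _)) ⟩
          ∑ X (λ i → ∣ w∙ 1ᶜ η i ∣² + ∣ w∙ (-ᶜ 1ᶜ) η i ∣² + (∣ w∙ (0# +i 1#) η i ∣² + ∣ w∙ (0# +i (- 1#)) η i ∣²))
            ≈⟨ ∑-cong (λ i → solve 10 (λ h₁ h₂ a₁ a₂ b₁ b₂ c₁ c₂ d₁ d₂ →
                 let h = h₁ , h₂ ; a = a₁ , a₂ ; b = b₁ , b₂ ; c = c₁ , c₂ ; d = d₁ , d₂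
                     w = λ ω → :∣ a :+ᶜ :conj ω :*ᶜ b :+ᶜ ω :*ᶜ h :*ᶜ (c :+ᶜ :conj ω :*ᶜ d) ∣² in
                 w (# 1 , # 0) :+ w (:- # 1 , :- # 0) :+ (w (# 0 , # 1) :+ w (# 0 , :- # 1))
                 := # 4 :* ((:∣ a ∣² :+ :∣ b ∣² :+ :∣ h ∣² :* (:∣ c ∣² :+ :∣ d ∣²))
                                 :+ # 2 :* (h₁ :* proj₁ (a :*ᶜ :conj d) :+ h₂ :* proj₂ (a :*ᶜ :conj d))))
                 (re η) (im η) (re (L i G H)) (im (L i G H)) (re (L i G H′)) (im (L i G H′))
                 (re (L i G′ H)) (im (L i G′ H)) (re (L i G′ H′)) (im (L i G′ H′))) X ⟩
          ∑ X (λ i → num 4 * ((∣ u G H i ∣² + ∣ u G H′ i ∣² + ∣ η ∣² * (∣ u G′ H i ∣² + ∣ u G′ H′ i ∣²))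
            + num 2 * (re η * re (u G H i *ᶜ conj (u G′ H′ i)) + im η * im (u G H i *ᶜ conj (u G′ H′ i)))))
            ≈⟨ *-distribˡ-∑ (num 4) X _ ⟨
          num 4 * ∑ X (λ i → (∣ u G H i ∣² + ∣ u G H′ i ∣² + ∣ η ∣² * (∣ u G′ H i ∣² + ∣ u G′ H′ i ∣²))
            + num 2 * (re η * re (u G H i *ᶜ conj (u G′ H′ i)) + im η * im (u G H i *ᶜ conj (u G′ H′ i))))
            ≈⟨ *-congˡ (trans (∑-+ X _ _) (+-cong
                 (trans (∑-+ X _ _) (+-cong (∑-+ X _ _) (trans (sym (*-distribˡ-∑ ∣ η ∣² X _)) (*-congˡ (∑-+ X _ _)))))
                 (trans (sym (*-distribˡ-∑ (num 2) X _)) (*-congˡ (trans (∑-+ X _ _) (+-cong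
                   (trans (sym (*-distribˡ-∑ (re η) X _)) (*-congˡ (sym (re-∑ᶜ X _))))
                   (trans (sym (*-distribˡ-∑ (im η) X _)) (*-congˡ (sym (im-∑ᶜ X _)))))))))) ⟩
          num 4 * ((‖ u G H ‖²⟨ X ⟩ + ‖ u G H′ ‖²⟨ X ⟩ + ∣ η ∣² * (‖ u G′ H ‖²⟨ X ⟩ + ‖ u G′ H′ ‖²⟨ X ⟩))
                     + num 2 * (re η * re ⟪ u G H , u G′ H′ ⟫⟨ X ⟩ + im η * im ⟪ u G H , u G′ H′ ⟫⟨ X ⟩)) ∎
          where open ≈-Reasoning

      -- The average of defect (G + ω η G′) (H + ω̄ H′) over the fourth roots of
      -- unity ω: the averaging removes every cross term except those of Δ.
      polarisation : ∀ η → 0# ≤ (defect G H + defect G H′ + ∣ η ∣² * (defect G′ H + defect G′ H′))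
                                + num 2 * (re η * re (Δ G G′ H H′) + im η * im (Δ G G′ H H′))
      polarisation η = *-cancelˡ-≤ (0<num 3) (≤-via
        (gap (rotated 1ᶜ η) ⊹ gap (rotated (-ᶜ 1ᶜ) η) ⊹ gap (rotated (0# +i 1#) η) ⊹ gap (rotated (0# +i (- 1#)) η))
        (begin
          num 4 * ((defect G H + defect G H′ + ∣ η ∣² * (defect G′ H + defect G′ H′))
                                + num 2 * (re η * re (Δ G G′ H H′) + im η * im (Δ G G′ H H′))) - num 4 * 0#
            ≈⟨ solve 17 (λ D P P′ Q Q′ a₁ a₂ b₁ b₂ h₁ h₂ U₁ U₂ U₃ U₄ V₁ V₂ →
                 let h = h₁ , h₂ ; a = a₁ , a₂ ; b = b₁ , b₂
                     δ = (D , # 0) :*ᶜ (a :*ᶜ b) :-ᶜ (V₁ , V₂)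
                 in # 4 :* (((D :* (P :* Q) :- U₁) :+ (D :* (P :* Q′) :- U₂) :+ :∣ h ∣² :* ((D :* (P′ :* Q) :- U₃) :+ (D :* (P′ :* Q′) :- U₄)))
                      :+ # 2 :* (h₁ :* proj₁ δ :+ h₂ :* proj₂ δ)) :- # 4 :* # 0
                    := # 4 :* (D :* ((P :+ :∣ h ∣² :* P′) :* (Q :+ Q′) :+ # 2 :* (h₁ :* proj₁ (a :*ᶜ b) :+ h₂ :* proj₂ (a :*ᶜ b))))
                       :- # 4 :* ((U₁ :+ U₂ :+ :∣ h ∣² :* (U₃ :+ U₄)) :+ # 2 :* (h₁ :* V₁ :+ h₂ :* V₂)))
                 D P P′ Q Q′ (re A) (im A) (re B) (im B) (re η) (im η)
                 ‖ u G H ‖²⟨ X ⟩ ‖ u G H′ ‖²⟨ X ⟩ ‖ u G′ H ‖²⟨ X ⟩ ‖ u G′ H′ ‖²⟨ X ⟩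
                 (re ⟪ u G H , u G′ H′ ⟫⟨ X ⟩) (im ⟪ u G H , u G′ H′ ⟫⟨ X ⟩) ⟩
          num 4 * (D * ((P + ∣ η ∣² * P′) * (Q + Q′) + num 2 * (re η * re (A *ᶜ B) + im η * im (A *ᶜ B)))) - num 4 * _
            ≈⟨ +-congˡ (-‿cong (roots η)) ⟨
          num 4 * (D * ((P + ∣ η ∣² * P′) * (Q + Q′) + num 2 * (re η * re (A *ᶜ B) + im η * im (A *ᶜ B))))
            - (‖ w∙ 1ᶜ η ‖²⟨ X ⟩ + ‖ w∙ (-ᶜ 1ᶜ) η ‖²⟨ X ⟩ + (‖ w∙ (0# +i 1#) η ‖²⟨ X ⟩ + ‖ w∙ (0# +i (- 1#)) η ‖²⟨ X ⟩))
            ≈⟨ solve 15 (λ D P P′ Q Q′ a₁ a₂ b₁ b₂ h₁ h₂ N₁ N₂ N₃ N₄ →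
                 let h = h₁ , h₂ ; a = a₁ , a₂ ; b = b₁ , b₂
                     r = λ ω → D :* ((P :+ :∣ ω :*ᶜ h ∣² :* P′ :+ # 2 :* (proj₁ (ω :*ᶜ h) :* a₁ :+ proj₂ (ω :*ᶜ h) :* a₂))
                                    :* (Q :+ :∣ :conj ω ∣² :* Q′ :+ # 2 :* (proj₁ (:conj ω) :* b₁ :+ proj₂ (:conj ω) :* b₂)))
                 in # 4 :* (D :* ((P :+ :∣ h ∣² :* P′) :* (Q :+ Q′) :+ # 2 :* (h₁ :* proj₁ (a :*ᶜ b) :+ h₂ :* proj₂ (a :*ᶜ b))))
                     :- (N₁ :+ N₂ :+ (N₃ :+ N₄))
                    := (r (# 1 , # 0) :- N₁) :+ ((r (:- # 1 , :- # 0) :- N₂)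
                       :+ ((r (# 0 , # 1) :- N₃) :+ (r (# 0 , :- # 1) :- N₄))))
                 D P P′ Q Q′ (re A) (im A) (re B) (im B) (re η) (im η)
                 ‖ w∙ 1ᶜ η ‖²⟨ X ⟩ ‖ w∙ (-ᶜ 1ᶜ) η ‖²⟨ X ⟩ ‖ w∙ (0# +i 1#) η ‖²⟨ X ⟩ ‖ w∙ (0# +i (- 1#)) η ‖²⟨ X ⟩ ⟩
          _ ∎))
        where open ≈-Reasoning

      -- Polarisation at η = 1, -1, i, -i puts the real part a and the imaginary part b of Δ into
      -- [-2 ε, 2 ε]. The certificate is (2 ε + a) (2 ε - a) + (2 ε + b) (2 ε - b) = 8 ε² - a² - b².
      ∣Δ∣²≤ : ∀ {ε} → defect G H ≤ ε → defect G H′ ≤ ε → defect G′ H ≤ ε → defect G′ H′ ≤ ε →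
              ∣ Δ G G′ H H′ ∣² ≤ num 8 * (ε * ε)
      ∣Δ∣²≤ {ε} p q r s = ≤-via
        (side 1ᶜ refl ⊠ side (-ᶜ 1ᶜ) unit₂ ⊹ side (0# +i 1#) unit₃ ⊠ side (0# +i (- 1#)) unit₄)
        (solve 3 (λ a b e → let r = λ h₁ h₂ → # 2 :* e :+ (h₁ :* a :+ h₂ :* b) in
             # 8 :* (e :* e) :- :∣ a , b ∣² :=
             r (# 1) (# 0) :* r (:- # 1) (:- # 0) :+ r (# 0) (# 1) :* r (# 0) (:- # 1))
           (re d) (im d) ε)
        where
        d : ℂ
        d = Δ G G′ H H′
        unit₂ : ∣ -ᶜ 1ᶜ ∣² ≈ ∣ 1ᶜ ∣²
        unit₂ = solve 0 (:∣ :- # 1 , :- # 0 ∣² := :∣ # 1 , # 0 ∣²)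
        unit₃ : ∣ 0# +i 1# ∣² ≈ ∣ 1ᶜ ∣²
        unit₃ = solve 0 (:∣ # 0 , # 1 ∣² := :∣ # 1 , # 0 ∣²)
        unit₄ : ∣ 0# +i (- 1#) ∣² ≈ ∣ 1ᶜ ∣²
        unit₄ = solve 0 (:∣ # 0 , :- # 1 ∣² := :∣ # 1 , # 0 ∣²)
        side : ∀ η → ∣ η ∣² ≈ ∣ 1ᶜ ∣² → 0# ≤ num 2 * ε + (re η * re d + im η * im d)
        side η unit = *-cancelˡ-≤ (0<num 1) (≤-via
          (≤-respʳ-≈ (+-congʳ (+-congˡ (*-congʳ unit))) (polarisation η) ⊹ gap p ⊹ gap q ⊹ gap r ⊹ gap s)
          (solve 6 (λ e x a b c f → # 2 :* (# 2 :* e :+ x) :- # 2 :* # 0 :=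
              ((a :+ b :+ :∣ # 1 , # 0 ∣² :* (c :+ f)) :+ # 2 :* x) :+ ((e :- a) :+ ((e :- b) :+ ((e :- c) :+ (e :- f)))))
            ε (re η * re d + im η * im d) (defect G H) (defect G H′) (defect G′ H) (defect G′ H′)))

-- Peeling one coordinate of large influence

module OneCoordinate (ℛ : CompleteOrderedField) where
  open Theory ℛ hiding (zero)
  open RealFieldProperties ℛ
  open ComplexProperties ℛ
  open ExpectationProperties ℛ
  open BilinearForms ℛ

  module Pairs {s g p} (μ : Fin s × Fin g × Fin p → ℝ) (μ≥0 : NonNegative (dist μ)) (Σ′ : Subset s) where
    open Marginals μ

    private
      mx : Weighted (Fin s)
      mx = marginalˣ μ

    both : Fin s → Fin s → Bool
    both x x′ = does (x ∈? Σ′) ∧ does (x′ ∈? Σ′)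

    -- The averaging of `effectiveInfluence` with its kernel left free: it recovers the influence of
    -- φ for the kernel `∣ φ x -ᶜ φ x′ ∣²`, and is applied to the squared distances of vectors as
    -- well.
    pairs : (Fin s → Fin s → ℝ) → ℝ
    pairs K = 𝔼 mx λ x → 𝔼 mx λ x′ → if both x x′ then K x x′ else 0#

    restrict-≤ : ∀ b {t u} → (b ≡.≡ true → t ≤ u) → 0# ≤ u → (if b then t else 0#) ≤ u
    restrict-≤ true  t≤u 0≤u = t≤u ≡.refl
    restrict-≤ false t≤u 0≤u = 0≤u

    restrict-nonNeg : ∀ b {t} → 0# ≤ t → 0# ≤ (if b then t else 0#)
    restrict-nonNeg true  0≤t = 0≤t
    restrict-nonNeg false 0≤t = ≤-refl

    pairs-≤ : ∑ (allFin s) (weight mx) ≈ 1# → ∀ {K B} → 0# ≤ B →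
      (∀ x x′ → both x x′ ≡.≡ true → supp mx x → supp mx x′ → K x x′ ≤ B) → pairs K ≤ B
    pairs-≤ total {K} {B} 0≤B K≤B = ≤-respʳ-≈ (𝔼-const mx total B) (𝔼-mono-≤ mx (marginalˣ-nonNeg μ≥0) λ x x∈ →
      ≤-respʳ-≈ (𝔼-const mx total B) (𝔼-mono-≤ mx (marginalˣ-nonNeg μ≥0) λ x′ x′∈ →
        restrict-≤ (both x x′) (λ b → K≤B x x′ b x∈ x′∈) 0≤B))

    weighted≤pairs : ∀ {K} → (∀ x x′ → 0# ≤ K x x′) → ∀ x x′ → both x x′ ≡.≡ true →
      weight mx x * (weight mx x′ * K x x′) ≤ pairs K
    weighted≤pairs {K} 0≤K x x′ b = ≤-trans
      (*-monoˡ-≤ (marginalˣ-nonNeg μ≥0 x)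
        (≤-respˡ-≈ (*-congˡ (reflexive (≡.cong (λ c → if c then K x x′ else 0#) b)))
          (weighted≤𝔼 mx (marginalˣ-nonNeg μ≥0) (λ x′ _ → restrict-nonNeg (both x x′) (0≤K x x′)) (∈-allFin x′))))
      (weighted≤𝔼 mx (marginalˣ-nonNeg μ≥0)
        (λ x _ → 𝔼-nonNeg mx (marginalˣ-nonNeg μ≥0) λ x′ _ → restrict-nonNeg (both x x′) (0≤K x x′)) (∈-allFin x))

    effectiveInfluence≤4‖‖² : ∑ (allFin s) (weight mx) ≈ 1# → ∀ φ →
      effectiveInfluence μ Σ′ φ ≤ num 4 * 𝔼 mx (λ x → ∣ φ x ∣²)
    effectiveInfluence≤4‖‖² total φ = begin
      effectiveInfluence μ Σ′ φ
        ≤⟨ 𝔼-mono-≤ mx mx≥0 (λ x _ → 𝔼-mono-≤ mx mx≥0 λ x′ _ → restrict-≤ (both x x′) (λ _ → ∣∣²-sub-≤ (φ x) (φ x′))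
             (0≤num 2 ⊠ (∣∣²-nonNeg (φ x) ⊹ ∣∣²-nonNeg (φ x′)))) ⟩
      (𝔼 mx λ x → 𝔼 mx λ x′ → num 2 * (∣ φ x ∣² + ∣ φ x′ ∣²))
        ≈⟨ 𝔼-cong mx (λ x → trans (𝔼-*ˡ mx _ _) (*-congˡ (trans (𝔼-+ mx _ _) (+-congʳ (𝔼-const mx total _))))) ⟩
      (𝔼 mx λ x → num 2 * (∣ φ x ∣² + N))
        ≈⟨ trans (𝔼-*ˡ mx _ _) (*-congˡ (trans (𝔼-+ mx _ _) (+-congˡ (𝔼-const mx total _)))) ⟩
      num 2 * (N + N)
        ≈⟨ solve 1 (λ n → # 2 :* (n :+ n) := # 4 :* n) N ⟩
      num 4 * N ∎
      where
      open ≤-Reasoning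
      mx≥0 : NonNegative mx
      mx≥0 = marginalˣ-nonNeg μ≥0
      N : ℝ
      N = 𝔼 mx (λ x → ∣ φ x ∣²)

  module Setting {s g p} (μ : Fin s × Fin g × Fin p → ℝ) (Σ′ : Subset s) (T : Fin s × Fin g × Fin p → ℂ)
    (μ≥0 : NonNegative (dist μ)) (total : ∑ (points (dist μ)) μ ≈ 1#)
    (∣T∣²≤1 : ∀ ω → supp (dist μ) ω → ∣ T ω ∣² ≤ 1#)
    (product : ∀ y z → weight (marginalʸᶻ μ) (y , z) ≈ weight (marginalʸ μ) y * weight (marginalᶻ μ) z)
    (A : ℝ) (1≤A : 1# ≤ A) (1≤Aμ : ∀ ω → supp (dist μ) ω → 1# ≤ A * μ ω) where

    open Marginals μ
    open Pairs μ μ≥0 Σ′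

    private
      E : (Fin s × Fin g × Fin p → ℝ) → ℝ
      E = 𝔼 (dist μ)
      mx : Weighted (Fin s)
      mx = marginalˣ μ
      mx≥0 : NonNegative mx
      mx≥0 = marginalˣ-nonNeg μ≥0
      mx-total : ∑ (allFin s) (weight mx) ≈ 1#
      mx-total = marginalˣ-total total
      0≤A : 0# ≤ A
      0≤A = ≤-trans 0≤1 1≤A

    -- The passage from averages to atoms: a nonnegative function cannot exceed its mean by more
    -- than the reciprocal of the weight of the atom.
    ≤A𝔼 : ∀ {f} → (∀ ω → supp (dist μ) ω → 0# ≤ f ω) → ∀ ω → supp (dist μ) ω → f ω ≤ A * E f
    ≤A𝔼 {f} 0≤f ω ω∈ = begin
      f ω                 ≈⟨ *-identityˡ _ ⟨
      1# * f ω            ≤⟨ *-monoʳ-≤ (0≤f ω ω∈) (1≤Aμ ω ω∈) ⟩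
      A * μ ω * f ω       ≈⟨ *-assoc _ _ _ ⟩
      A * (μ ω * f ω)     ≤⟨ *-monoˡ-≤ 0≤A (weighted≤𝔼 (dist μ) μ≥0 0≤f (triple∈ ω)) ⟩
      A * E f             ∎
      where open ≤-Reasoning

    -- The influence gap freed of square roots by 2 t a b c ≤ a² + t² b² c² for the three norms a,
    -- b, c. The parameter `t` balances the two sides; it is taken to be `D`, the scale at which T φ
    -- compares with the product of the other two functions.
    BaseInequality : ℝ → ℝ → Set
    BaseInequality τ κ = ∀ (φ : Fin s → ℂ) (γ : Fin g → ℂ) (θ : Fin p → ℂ) → τ * 𝔼 mx (λ x → ∣ φ x ∣²) ≤ effectiveInfluence μ Σ′ φ → ∀ t → 0# ≤ t →
      num 2 * (t * re (𝔼ᶜ (dist μ) (λ (x , y , z) → φ x *ᶜ γ y *ᶜ θ z *ᶜ T (x , y , z))))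
        ≤ (1# - κ) * (𝔼 mx (λ x → ∣ φ x ∣²) + t * t * (𝔼 (marginalʸ μ) (λ y → ∣ γ y ∣²) * 𝔼 (marginalᶻ μ) (λ z → ∣ θ z ∣²)))

    -- The argument at one coordinate, abstracted from characters. `f` is known only through 𝔼 ‖f‖²
    -- = S and through its pairing with T u, whose mean is S as well; `D′` is D times the squared
    -- norms of the unsliced functions, computed from their slices.
    module Slices {I Y Z : Set} (X : List I) (ν : Weighted Y) (ξ : Weighted Z) (𝒰 : BilinearFamily I Y Z)
      (D : ℝ) (0≤D : 0# ≤ D) (ν≥0 : NonNegative ν) (ξ≥0 : NonNegative ξ)
      (bounded : Defect.Bounded X ν ξ 𝒰 D)
      (G : Fin g → Y → ℂ) (H : Fin p → Z → ℂ) (f : Fin s → I → ℂ) (S D′ : ℝ)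
      (𝔼‖f‖²≈S : 𝔼 mx (λ x → ‖ f x ‖²⟨ X ⟩) ≈ S)
      (pairing≈S : 𝔼 (dist μ) (λ (x , y , z) → ∑ X (λ i → re (T (x , y , z) *ᶜ (f x i *ᶜ BilinearFamily.L 𝒰 i (G y) (H z))))) ≈ S)
      (D′≈ : D * (𝔼 (marginalʸ μ) (λ y → 𝔼 ν (λ w → ∣ G y w ∣²)) * 𝔼 (marginalᶻ μ) (λ z → 𝔼 ξ (λ w → ∣ H z w ∣²))) ≈ D′) where

      open Defect X ν ξ 𝒰 D

      private
        U : Fin s × Fin g × Fin p → I → ℂ
        U (x , y , z) = u (G y) (H z)

        F : Fin s × Fin g × Fin p → I → ℂ
        F (x , y , z) = f x

        PQ : Fin s × Fin g × Fin p → ℝ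
        PQ (x , y , z) = D * (𝔼 ν (λ w → ∣ G y w ∣²) * 𝔼 ξ (λ w → ∣ H z w ∣²))

        err : Fin s × Fin g × Fin p → I → ℂ
        err ω i = T ω *ᶜ F ω i -ᶜ conj (U ω i)

        loss : Fin s × Fin g × Fin p → ℝ
        loss ω = (1# - ∣ T ω ∣²) * ‖ F ω ‖²⟨ X ⟩

        def : Fin s × Fin g × Fin p → ℝ
        def (x , y , z) = defect (G y) (H z)

        slack : Fin s × Fin g × Fin p → ℝ
        slack ω = ‖ err ω ‖²⟨ X ⟩ + (loss ω + def ω)

        0≤loss : ∀ ω → supp (dist μ) ω → 0# ≤ loss ω
        0≤loss ω ω∈ = gap (∣T∣²≤1 ω ω∈) ⊠ ‖‖²-nonNeg (F ω) X

        0≤def : ∀ ω → 0# ≤ def ω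
        0≤def (x , y , z) = gap (bounded (G y) (H z))

        0≤slack : ∀ ω → supp (dist μ) ω → 0# ≤ slack ω
        0≤slack ω ω∈ = ‖‖²-nonNeg (err ω) X ⊹ 0≤loss ω ω∈ ⊹ 0≤def ω

        0≤PQ : ∀ ω → 0# ≤ PQ ω
        0≤PQ (x , y , z) = 0≤D ⊠ (𝔼-nonNeg ν ν≥0 (λ w _ → ∣∣²-nonNeg (G y w)) ⊠ 𝔼-nonNeg ξ ξ≥0 (λ w _ → ∣∣²-nonNeg (H z w)))

        pairing : Fin s × Fin g × Fin p → ℝ
        pairing ω = ∑ X (λ i → re (T ω *ᶜ (F ω i *ᶜ U ω i)))

        ‖err‖² : ∀ ω → ‖ err ω ‖²⟨ X ⟩ ≈ ∣ T ω ∣² * ‖ F ω ‖²⟨ X ⟩ + ‖ U ω ‖²⟨ X ⟩ - num 2 * pairing ω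
        ‖err‖² ω = begin
          ‖ err ω ‖²⟨ X ⟩
            ≈⟨ ∑-cong (λ i → solve 6 (λ a b c d e h → :∣ (a , b) :*ᶜ (c , d) :-ᶜ :conj (e , h) ∣²
                 := :∣ a , b ∣² :* :∣ c , d ∣² :+ :∣ e , h ∣² :- # 2 :* proj₁ ((a , b) :*ᶜ ((c , d) :*ᶜ (e , h))))
                 (re (T ω)) (im (T ω)) (re (F ω i)) (im (F ω i)) (re (U ω i)) (im (U ω i))) X ⟩
          ∑ X (λ i → ∣ T ω ∣² * ∣ F ω i ∣² + ∣ U ω i ∣² - num 2 * re (T ω *ᶜ (F ω i *ᶜ U ω i)))
            ≈⟨ trans (∑-sub X _ _) (+-cong (trans (∑-+ X _ _) (+-congʳ (sym (*-distribˡ-∑ ∣ T ω ∣² X _)))) (-‿cong (sym (*-distribˡ-∑ (num 2) X _)))) ⟩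
          ∣ T ω ∣² * ‖ F ω ‖²⟨ X ⟩ + ‖ U ω ‖²⟨ X ⟩ - num 2 * pairing ω ∎
          where open ≈-Reasoning

        𝔼PQ : E PQ ≈ D′
        𝔼PQ = trans (𝔼-*ˡ (dist μ) D _) (trans (*-congˡ (𝔼-yz product _ _)) D′≈)

        𝔼‖F‖² : E (λ ω → ‖ F ω ‖²⟨ X ⟩) ≈ S
        𝔼‖F‖² = trans (𝔼-x _) 𝔼‖f‖²≈S

      -- ‖T f - conj u‖² + (1 - |T|²) ‖f‖² + (D |G|² |H|² - ‖u‖²) has all its
      -- summands nonnegative, and the terms |T|² ‖f‖² and ‖u‖² cancel.
      𝔼slack : E slack ≈ D′ - S
      𝔼slack = begin
        E slack
          ≈⟨ 𝔼-cong (dist μ) (λ ω → trans (+-congʳ (‖err‖² ω))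
               (solve 5 (λ t F U c q → (t :* F :+ U :- # 2 :* c) :+ ((# 1 :- t) :* F :+ (q :- U)) := (F :+ q) :- # 2 :* c)
                 ∣ T ω ∣² ‖ F ω ‖²⟨ X ⟩ ‖ U ω ‖²⟨ X ⟩ (pairing ω) (PQ ω))) ⟩
        E (λ ω → (‖ F ω ‖²⟨ X ⟩ + PQ ω) - num 2 * pairing ω)
          ≈⟨ trans (𝔼-sub (dist μ) _ _) (+-cong (𝔼-+ (dist μ) _ _) (-‿cong (𝔼-*ˡ (dist μ) (num 2) pairing))) ⟩
        E (λ ω → ‖ F ω ‖²⟨ X ⟩) + E PQ - num 2 * E pairing
          ≈⟨ +-cong (+-cong 𝔼‖F‖² 𝔼PQ) (-‿cong (*-congˡ pairing≈S)) ⟩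
        S + D′ - num 2 * S
          ≈⟨ solve 2 (λ S D → S :+ D :- # 2 :* S := D :- S) S D′ ⟩
        D′ - S ∎
        where open ≈-Reasoning

      S≤D′ : S ≤ D′
      S≤D′ = ≤-via (𝔼-nonNeg (dist μ) μ≥0 0≤slack) (sym 𝔼slack)

      0≤S : 0# ≤ S
      0≤S = ≤-respʳ-≈ 𝔼‖F‖² (𝔼-nonNeg (dist μ) μ≥0 λ ω _ → ‖‖²-nonNeg (F ω) X)

      -- J bounds the effective influence of every test function φ below, and B the
      -- squared distance of f x and f x′ for x, x′ in Σ′.
      module Gain (κ τ J ε B : ℝ) (0<κ : 0# < κ) (0≤τ : 0# ≤ τ) (0≤B : 0# ≤ B)
        (base : BaseInequality τ κ)
        (D′-S≤ε : D′ - S ≤ ε) (ε≤D′ : ε ≤ D′)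
        -- The two conditions on `J` serve the two cases of `influence≤J`. Here 124 = 4 · 31, where
        -- 31 comes from the bound on κ ‖φ‖² and 4 from the comparison of the influence with ‖φ‖².
        (κJ : num 124 * ((A * ε) * (A * D′)) ≤ κ * J)
        (τJ : τ * ((A * D′) * (A * D′)) ≤ J)
        (JB : num 4 * (A * A * J + num 4 * ((A * D′) * (A * ε))) ≤ B * B) where

        private
          e m : ℝ
          e = A * ε
          m = A * D′

          0≤D′ : 0# ≤ D′
          0≤D′ = ≤-trans 0≤S S≤D′

          0≤ε : 0# ≤ ε
          0≤ε = ≤-trans (gap S≤D′) D′-S≤ε

          0≤e : 0# ≤ e
          0≤e = 0≤A ⊠ 0≤ε

          0≤m : 0# ≤ m
          0≤m = 0≤A ⊠ 0≤D′

          e≤m : e ≤ m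
          e≤m = *-monoˡ-≤ 0≤A ε≤D′

          D′≤m : D′ ≤ m
          D′≤m = ≤-respˡ-≈ (*-identityˡ D′) (*-monoʳ-≤ 0≤D′ 1≤A)

          slack≤e : ∀ ω → supp (dist μ) ω → slack ω ≤ e
          slack≤e ω ω∈ = ≤-trans (≤A𝔼 0≤slack ω ω∈) (*-monoˡ-≤ 0≤A (≤-respˡ-≈ (sym 𝔼slack) D′-S≤ε))

          err≤e : ∀ ω → supp (dist μ) ω → ‖ err ω ‖²⟨ X ⟩ ≤ e
          err≤e ω ω∈ = ≤-trans (≤-via (0≤loss ω ω∈ ⊹ 0≤def ω) (solve 2 (λ a b → (a :+ b) :- a := b) _ _)) (slack≤e ω ω∈)

          loss≤e : ∀ ω → supp (dist μ) ω → loss ω ≤ e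
          loss≤e ω ω∈ = ≤-trans (≤-via (‖‖²-nonNeg (err ω) X ⊹ 0≤def ω) (solve 3 (λ a b c → (a :+ (b :+ c)) :- b := a :+ c) _ _ _)) (slack≤e ω ω∈)

          def≤e : ∀ ω → supp (dist μ) ω → def ω ≤ e
          def≤e ω ω∈ = ≤-trans (≤-via (‖‖²-nonNeg (err ω) X ⊹ 0≤loss ω ω∈) (solve 3 (λ a b c → (a :+ (b :+ c)) :- c := a :+ b) _ _ _)) (slack≤e ω ω∈)

          ‖F‖²≤m : ∀ ω → supp (dist μ) ω → ‖ F ω ‖²⟨ X ⟩ ≤ m
          ‖F‖²≤m ω ω∈ = ≤-trans (≤A𝔼 (λ ω _ → ‖‖²-nonNeg (F ω) X) ω ω∈) (*-monoˡ-≤ 0≤A (≤-respˡ-≈ (sym 𝔼‖F‖²) S≤D′))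

          ‖U‖²≤m : ∀ ω → supp (dist μ) ω → ‖ U ω ‖²⟨ X ⟩ ≤ m
          ‖U‖²≤m ω@(x , y , z) ω∈ = ≤-trans (bounded (G y) (H z))
            (≤-trans (≤A𝔼 (λ ω _ → 0≤PQ ω) ω ω∈) (*-monoˡ-≤ 0≤A (≤-reflexive 𝔼PQ)))

        module Test (ω₀ : Fin s × Fin g × Fin p) (ω₀∈ : supp (dist μ) ω₀) where
          private
            y₀ : Fin g
            y₀ = proj₁ (proj₂ ω₀)
            z₀ : Fin p
            z₀ = proj₂ (proj₂ ω₀)

          -- This vector is close to the conjugate of u at the atom `ω₀`, and unlike u it is a
          -- multiple of a value of `f`. The resulting function `φ` depends on x alone, as a test
          -- function for the base case must.
          v : I → ℂ
          v i = T ω₀ *ᶜ F ω₀ i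

          φ : Fin s → ℂ
          φ x = ⟪ f x , v ⟫⟨ X ⟩

          private
            γ : Fin g → ℂ
            γ y = ⟨ G y , G y₀ ⟩[ ν ]

            θ : Fin p → ℂ
            θ z = ⟨ H z , H z₀ ⟩[ ξ ]

            ‖v‖²≤m : ‖ v ‖²⟨ X ⟩ ≤ m
            ‖v‖²≤m = begin
              ‖ v ‖²⟨ X ⟩                       ≈⟨ trans (∑-cong (λ i → ∣∣²-* (T ω₀) (F ω₀ i)) X) (sym (*-distribˡ-∑ _ X _)) ⟩
              ∣ T ω₀ ∣² * ‖ F ω₀ ‖²⟨ X ⟩        ≤⟨ *-monoʳ-≤ (‖‖²-nonNeg (F ω₀) X) (∣T∣²≤1 ω₀ ω₀∈) ⟩
              1# * ‖ F ω₀ ‖²⟨ X ⟩               ≈⟨ *-identityˡ _ ⟩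
              ‖ F ω₀ ‖²⟨ X ⟩                    ≤⟨ ‖F‖²≤m ω₀ ω₀∈ ⟩
              m                                 ∎
              where open ≤-Reasoning

            r : Fin s × Fin g × Fin p → ℂ
            r (x , y , z) = T (x , y , z) *ᶜ φ x -ᶜ ι D *ᶜ (conj (γ y) *ᶜ conj (θ z))

            -- The errors of three replacements in ⟨T f x, v⟩: of T f x by the conjugate of u, of
            -- `v` by the conjugate of u at `ω₀`, and of the inner product of the two u's by its
            -- polarised value.
            r₁ r₂ r₃ : Fin s × Fin g × Fin p → ℂ
            r₁ ω = ⟪ err ω , v ⟫⟨ X ⟩
            r₂ ω = ⟪ (λ i → conj (U ω i)) , err ω₀ ⟫⟨ X ⟩
            r₃ (x , y , z) = Δ (G y) (G y₀) (H z) (H z₀)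

            r-split : ∀ ω → r ω ≈ᶜ r₁ ω +ᶜ r₂ ω -ᶜ conj (r₃ ω)
            r-split ω@(x , y , z) = begin
              T ω *ᶜ φ x -ᶜ ι D *ᶜ (conj (γ y) *ᶜ conj (θ z))
                ≈⟨ ℂᴿ.+-congʳ (ℂ∑.*-distribˡ-∑ (T ω) X _) ⟩
              ∑ᶜ X (λ i → T ω *ᶜ (f x i *ᶜ conj (v i))) -ᶜ ι D *ᶜ (conj (γ y) *ᶜ conj (θ z))
                ≈⟨ ℂᴿ.+-congʳ (ℂ∑.∑-cong (λ i → split (T ω) (f x i) (U ω i) (v i) (U ω₀ i)) X) ⟩
              ∑ᶜ X (λ i → err ω i *ᶜ conj (v i) +ᶜ conj (U ω i) *ᶜ conj (err ω₀ i) +ᶜ conj (U ω i *ᶜ conj (U ω₀ i)))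
                -ᶜ ι D *ᶜ (conj (γ y) *ᶜ conj (θ z))
                ≈⟨ ℂᴿ.+-congʳ (ℂᴿ.trans (ℂ∑.∑-+ X _ _) (ℂᴿ.+-cong (ℂ∑.∑-+ X _ _) (ℂᴿ.sym (conj-∑ᶜ X _)))) ⟩
              r₁ ω +ᶜ r₂ ω +ᶜ conj ⟪ U ω , U ω₀ ⟫⟨ X ⟩ -ᶜ ι D *ᶜ (conj (γ y) *ᶜ conj (θ z))
                ≈⟨ merge (r₁ ω +ᶜ r₂ ω) ⟪ U ω , U ω₀ ⟫⟨ X ⟩ (γ y) (θ z) ⟩
              r₁ ω +ᶜ r₂ ω -ᶜ conj (r₃ ω) ∎
              where
              open ℂ-Reasoning
              split : ∀ t a b c d → t *ᶜ (a *ᶜ conj c) ≈ᶜ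
                (t *ᶜ a -ᶜ conj b) *ᶜ conj c +ᶜ conj b *ᶜ conj (c -ᶜ conj d) +ᶜ conj (b *ᶜ conj d)
              split t a b c d =
                solve 10 (λ t₁ t₂ a₁ a₂ b₁ b₂ c₁ c₂ d₁ d₂ → let t = t₁ , t₂ ; a = a₁ , a₂ ; b = b₁ , b₂ ; c = c₁ , c₂ ; d = d₁ , d₂ in
                  proj₁ (t :*ᶜ (a :*ᶜ :conj c)) := proj₁ ((t :*ᶜ a :-ᶜ :conj b) :*ᶜ :conj c :+ᶜ :conj b :*ᶜ :conj (c :-ᶜ :conj d) :+ᶜ :conj (b :*ᶜ :conj d)))
                  (re t) (im t) (re a) (im a) (re b) (im b) (re c) (im c) (re d) (im d) ,
                solve 10 (λ t₁ t₂ a₁ a₂ b₁ b₂ c₁ c₂ d₁ d₂ → let t = t₁ , t₂ ; a = a₁ , a₂ ; b = b₁ , b₂ ; c = c₁ , c₂ ; d = d₁ , d₂ in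
                  proj₂ (t :*ᶜ (a :*ᶜ :conj c)) := proj₂ ((t :*ᶜ a :-ᶜ :conj b) :*ᶜ :conj c :+ᶜ :conj b :*ᶜ :conj (c :-ᶜ :conj d) :+ᶜ :conj (b :*ᶜ :conj d)))
                  (re t) (im t) (re a) (im a) (re b) (im b) (re c) (im c) (re d) (im d)
              merge : ∀ a c γ θ → a +ᶜ conj c -ᶜ ι D *ᶜ (conj γ *ᶜ conj θ) ≈ᶜ a -ᶜ conj (ι D *ᶜ (γ *ᶜ θ) -ᶜ c)
              merge a c γ θ =
                solve 9 (λ D a₁ a₂ c₁ c₂ γ₁ γ₂ θ₁ θ₂ → let a = a₁ , a₂ ; c = c₁ , c₂ ; γ = γ₁ , γ₂ ; θ = θ₁ , θ₂ ; D = D , # 0 in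
                  proj₁ (a :+ᶜ :conj c :-ᶜ D :*ᶜ (:conj γ :*ᶜ :conj θ)) := proj₁ (a :-ᶜ :conj (D :*ᶜ (γ :*ᶜ θ) :-ᶜ c)))
                  D (re a) (im a) (re c) (im c) (re γ) (im γ) (re θ) (im θ) ,
                solve 9 (λ D a₁ a₂ c₁ c₂ γ₁ γ₂ θ₁ θ₂ → let a = a₁ , a₂ ; c = c₁ , c₂ ; γ = γ₁ , γ₂ ; θ = θ₁ , θ₂ ; D = D , # 0 in
                  proj₂ (a :+ᶜ :conj c :-ᶜ D :*ᶜ (:conj γ :*ᶜ :conj θ)) := proj₂ (a :-ᶜ :conj (D :*ᶜ (γ :*ᶜ θ) :-ᶜ c)))
                  D (re a) (im a) (re c) (im c) (re γ) (im γ) (re θ) (im θ)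

            -- 30 = 3 (1 + 1 + 8): the factor 3 for a sum of three terms, one `e * m` for each of
            -- `r₁` and `r₂` by Cauchy-Schwarz, and 8 from `∣Δ∣²≤`.
            ∣r∣²≤ : ∀ ω → supp (dist μ) ω → ∣ r ω ∣² ≤ num 30 * (e * m)
            ∣r∣²≤ ω@(x , y , z) ω∈ = begin
              ∣ r ω ∣²
                ≈⟨ ∣∣²-cong (r-split ω) ⟩
              ∣ r₁ ω +ᶜ r₂ ω -ᶜ conj (r₃ ω) ∣²
                ≤⟨ ∣∣²-+₃-≤ (r₁ ω) (r₂ ω) (-ᶜ conj (r₃ ω)) ⟩
              num 3 * (∣ r₁ ω ∣² + ∣ r₂ ω ∣² + ∣ -ᶜ conj (r₃ ω) ∣²)
                ≤⟨ *-monoˡ-≤ (0≤num 3) (+-mono-≤ (+-mono-≤ r₁≤ r₂≤) r₃≤) ⟩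
              num 3 * (e * m + m * e + num 8 * (e * m))
                ≈⟨ solve 2 (λ e m → # 3 :* (e :* m :+ m :* e :+ # 8 :* (e :* m)) := # 30 :* (e :* m)) e m ⟩
              num 30 * (e * m) ∎
              where
              open ≤-Reasoning
              r₁≤ : ∣ r₁ ω ∣² ≤ e * m
              r₁≤ = ≤-trans (∣⟪⟫∣²≤ X (err ω) v) (*-mono-≤ (‖‖²-nonNeg (err ω) X) 0≤m (err≤e ω ω∈) ‖v‖²≤m)
              r₂≤ : ∣ r₂ ω ∣² ≤ m * e
              r₂≤ = ≤-trans (∣⟪⟫∣²≤ X _ (err ω₀)) (*-mono-≤ (‖‖²-nonNeg (λ i → conj (U ω i)) X) 0≤e
                (≤-respˡ-≈ (∑-cong (λ i → sym (∣∣²-conj (U ω i))) X) (‖U‖²≤m ω ω∈)) (err≤e ω₀ ω₀∈))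
              r₃≤ : ∣ -ᶜ conj (r₃ ω) ∣² ≤ num 8 * (e * m)
              r₃≤ = begin
                ∣ -ᶜ conj (r₃ ω) ∣²    ≈⟨ solve 2 (λ a b → :∣ :- a , :- (:- b) ∣² := :∣ a , b ∣²) (re (r₃ ω)) (im (r₃ ω)) ⟩
                ∣ r₃ ω ∣²              ≤⟨ ∣Δ∣²≤ bounded (G y) (G y₀) (H z) (H z₀) (def≤e ω ω∈)
                                            -- Polarisation also needs the defects at the mixed
                                            -- pairs (y , z₀) and (y₀ , z). Some atoms of the
                                            -- support lie above these pairs, and `def` does not
                                            -- depend on x.
                                            (≤-on-suppʸᶻ μ≥0 product ω∈ ω₀∈ λ x′ → def≤e (x′ , y , z₀))
                                            (≤-on-suppʸᶻ μ≥0 product ω₀∈ ω∈ λ x′ → def≤e (x′ , y₀ , z)) (def≤e ω₀ ω₀∈) ⟩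
                num 8 * (e * e)        ≤⟨ *-monoˡ-≤ (0≤num 8) (*-monoˡ-≤ 0≤e e≤m) ⟩
                num 8 * (e * m)        ∎

            ‖φ‖² ‖γθ‖² : ℝ
            ‖φ‖²  = 𝔼 mx (λ x → ∣ φ x ∣²)
            ‖γθ‖² = 𝔼 (marginalʸ μ) (λ y → ∣ γ y ∣²) * 𝔼 (marginalᶻ μ) (λ z → ∣ θ z ∣²)

            φ≤ : ∀ x → ∣ φ x ∣² ≤ ‖ f x ‖²⟨ X ⟩ * m
            φ≤ x = ≤-trans (∣⟪⟫∣²≤ X (f x) v) (*-monoˡ-≤ (‖‖²-nonNeg (f x) X) ‖v‖²≤m)

            ‖φ‖²≤ : ‖φ‖² ≤ m * m
            ‖φ‖²≤ = begin
              ‖φ‖²                                   ≤⟨ 𝔼-mono-≤ mx mx≥0 (λ x _ → φ≤ x) ⟩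
              𝔼 mx (λ x → ‖ f x ‖²⟨ X ⟩ * m)         ≈⟨ 𝔼-cong mx (λ x → *-comm _ _) ⟩
              𝔼 mx (λ x → m * ‖ f x ‖²⟨ X ⟩)         ≈⟨ 𝔼-*ˡ mx m _ ⟩
              m * 𝔼 mx (λ x → ‖ f x ‖²⟨ X ⟩)         ≈⟨ *-congˡ 𝔼‖f‖²≈S ⟩
              m * S                                  ≤⟨ *-monoˡ-≤ 0≤m (≤-trans S≤D′ D′≤m) ⟩
              m * m                                  ∎
              where open ≤-Reasoning

            lost : Fin s × Fin g × Fin p → ℝ
            lost (x , y , z) = (1# - ∣ T (x , y , z) ∣²) * ∣ φ x ∣²

            lost≤ : ∀ ω → supp (dist μ) ω → lost ω ≤ e * m
            lost≤ ω@(x , y , z) ω∈ = begin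
              lost ω                                             ≤⟨ *-monoˡ-≤ (gap (∣T∣²≤1 ω ω∈)) (φ≤ x) ⟩
              (1# - ∣ T ω ∣²) * (‖ f x ‖²⟨ X ⟩ * m)              ≈⟨ *-assoc _ _ _ ⟨
              loss ω * m                                         ≤⟨ *-monoʳ-≤ 0≤m (loss≤e ω ω∈) ⟩
              e * m                                              ∎
              where open ≤-Reasoning

            test : Fin s × Fin g × Fin p → ℂ
            test (x , y , z) = φ x *ᶜ γ y *ᶜ θ z *ᶜ T (x , y , z)

            -- `lost` supplies the part (1 - |T|²) |φ|² that is absent from |r|². The sum therefore
            -- has a mean made only of norms and of the correlation in the base case.
            𝔼[∣r∣²+lost] : E (λ ω → ∣ r ω ∣² + lost ω) ≈ ‖φ‖² + D * D * ‖γθ‖² - num 2 * (D * re (𝔼ᶜ (dist μ) test))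
            𝔼[∣r∣²+lost] = begin
              E (λ ω → ∣ r ω ∣² + lost ω)
                ≈⟨ 𝔼-cong (dist μ) (λ (x , y , z) → solve 9 (λ D t₁ t₂ φ₁ φ₂ γ₁ γ₂ θ₁ θ₂ →
                     let t = t₁ , t₂ ; φ = φ₁ , φ₂ ; γ = γ₁ , γ₂ ; θ = θ₁ , θ₂ in
                     :∣ t :*ᶜ φ :-ᶜ (D , # 0) :*ᶜ (:conj γ :*ᶜ :conj θ) ∣² :+ (# 1 :- :∣ t ∣²) :* :∣ φ ∣²
                     := :∣ φ ∣² :+ D :* D :* (:∣ γ ∣² :* :∣ θ ∣²) :- # 2 :* D :* proj₁ (φ :*ᶜ γ :*ᶜ θ :*ᶜ t))
                     D (re (T (x , y , z))) (im (T (x , y , z))) (re (φ x)) (im (φ x)) (re (γ y)) (im (γ y)) (re (θ z)) (im (θ z))) ⟩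
              E (λ (x , y , z) → ∣ φ x ∣² + D * D * (∣ γ y ∣² * ∣ θ z ∣²) - num 2 * D * re (test (x , y , z)))
                ≈⟨ trans (𝔼-sub (dist μ) _ _) (+-cong (𝔼-+ (dist μ) _ _) (-‿cong (𝔼-*ˡ (dist μ) (num 2 * D) _))) ⟩
              E (λ (x , y , z) → ∣ φ x ∣²) + E (λ (x , y , z) → D * D * (∣ γ y ∣² * ∣ θ z ∣²)) - num 2 * D * E (λ ω → re (test ω))
                ≈⟨ +-cong (+-cong (𝔼-x _) (trans (𝔼-*ˡ (dist μ) (D * D) _) (*-congˡ (𝔼-yz product _ _))))
                     (-‿cong (trans (*-assoc _ _ _) (*-congˡ (*-congˡ (sym (re-𝔼ᶜ (dist μ) test)))))) ⟩
              ‖φ‖² + D * D * ‖γθ‖² - num 2 * (D * re (𝔼ᶜ (dist μ) test)) ∎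
              where open ≈-Reasoning

            -- The test functions miss saturation by at most 31 e m, 30 for `r` and 1 for `lost`,
            -- whereas the base case forces a deficit of at least κ (‖φ‖² + D² ‖γθ‖²).
            κ‖φ‖²≤ : τ * ‖φ‖² ≤ effectiveInfluence μ Σ′ φ → κ * ‖φ‖² ≤ num 31 * (e * m)
            κ‖φ‖²≤ influential = ≤-via
              (gap (base φ γ θ influential D 0≤D) ⊹ gap upper ⊹ <⇒≤ 0<κ ⊠ 0≤D ⊠ 0≤D ⊠ 0≤‖γθ‖²)
              (solve 6 (λ κ N D W R e → e :- κ :* N :=
                 ((# 1 :- κ) :* (N :+ D :* D :* W) :- # 2 :* (D :* R)) :+
                 ((e :- (N :+ D :* D :* W :- # 2 :* (D :* R))) :+ κ :* (D :* (D :* W))))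
                 κ ‖φ‖² D ‖γθ‖² (re (𝔼ᶜ (dist μ) test)) (num 31 * (e * m)))
              where
              0≤‖γθ‖² : 0# ≤ ‖γθ‖²
              0≤‖γθ‖² = 𝔼-nonNeg (marginalʸ μ) (marginalʸ-nonNeg μ≥0) (λ y _ → ∣∣²-nonNeg (γ y))
                ⊠ 𝔼-nonNeg (marginalᶻ μ) (marginalᶻ-nonNeg μ≥0) (λ z _ → ∣∣²-nonNeg (θ z))
              upper : ‖φ‖² + D * D * ‖γθ‖² - num 2 * (D * re (𝔼ᶜ (dist μ) test)) ≤ num 31 * (e * m)
              upper = ≤-respˡ-≈ 𝔼[∣r∣²+lost] (≤-respʳ-≈ (𝔼-const (dist μ) total _) (𝔼-mono-≤ (dist μ) μ≥0 λ ω ω∈ →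
                ≤-trans (+-mono-≤ (∣r∣²≤ ω ω∈) (lost≤ ω ω∈))
                  (≤-reflexive (solve 1 (λ x → # 30 :* x :+ x := # 31 :* x) (e * m)))))

          -- Below the threshold the influence is at most τ ‖φ‖² ≤ τ m². Above it the base case
          -- makes ‖φ‖² itself small, and the influence is at most 4 ‖φ‖².
          influence≤J : effectiveInfluence μ Σ′ φ ≤ J
          influence≤J with τ * ‖φ‖² ≤? effectiveInfluence μ Σ′ φ
          ... | no small = ≤-trans (≰⇒≥ small) (≤-trans (*-monoˡ-≤ 0≤τ ‖φ‖²≤) τJ)
          ... | yes influential = *-cancelˡ-≤ 0<κ (begin
            κ * effectiveInfluence μ Σ′ φ     ≤⟨ *-monoˡ-≤ (<⇒≤ 0<κ) (effectiveInfluence≤4‖‖² mx-total φ) ⟩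
            κ * (num 4 * ‖φ‖²)                ≈⟨ solve 2 (λ k n → k :* (# 4 :* n) := # 4 :* (k :* n)) κ ‖φ‖² ⟩
            num 4 * (κ * ‖φ‖²)                ≤⟨ *-monoˡ-≤ (0≤num 4) (κ‖φ‖²≤ influential) ⟩
            num 4 * (num 31 * (e * m))        ≈⟨ solve 1 (λ x → # 4 :* (# 31 :* x) := # 124 :* x) (e * m) ⟩
            num 124 * (e * m)                 ≤⟨ κJ ⟩
            κ * J                             ∎)
            where open ≤-Reasoning

        private
          1≤Amx : ∀ ω → supp (dist μ) ω → 1# ≤ A * weight mx (proj₁ ω)
          1≤Amx ω@(x , y , z) ω∈ = ≤-trans (1≤Aμ ω ω∈) (*-monoˡ-≤ 0≤A (μ≤marginalˣ μ≥0 x y z))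

          ‖f-f‖² : Fin s → Fin s → ℝ
          ‖f-f‖² x x′ = ‖ (λ i → f x i -ᶜ f x′ i) ‖²⟨ X ⟩

          0≤‖f-f‖² : ∀ x x′ → 0# ≤ ‖f-f‖² x x′
          0≤‖f-f‖² x x′ = ‖‖²-nonNeg _ X

          bound : ℝ
          bound = A * A * J + num 4 * (m * e)

          -- The test function of `ω₀` sees this inner product c only multiplied by the conjugate of
          -- T at `ω₀`, which may be small. The share (1 - |T|²) |c|² that it does not see is
          -- covered by `loss` at `ω₀`.
          separated : ∀ ω ω′ → supp (dist μ) ω → supp (dist μ) ω′ → both (proj₁ ω) (proj₁ ω′) ≡.≡ true →
            ∀ ω₀ → supp (dist μ) ω₀ → ∣ ⟪ (λ i → F ω i -ᶜ F ω′ i) , F ω₀ ⟫⟨ X ⟩ ∣² ≤ bound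
          separated ω@(x , _ , _) ω′@(x′ , _ , _) ω∈ ω′∈ b ω₀ ω₀∈ = begin
            ∣ c ∣²                                              ≈⟨ solve 2 (λ t c → c := t :* c :+ (# 1 :- t) :* c) ∣ T ω₀ ∣² ∣ c ∣² ⟩
            ∣ T ω₀ ∣² * ∣ c ∣² + (1# - ∣ T ω₀ ∣²) * ∣ c ∣²       ≤⟨ +-mono-≤ seen unseen ⟩
            A * A * J + num 4 * (m * e)                         ∎
            where
            open ≤-Reasoning
            open Test ω₀ ω₀∈
            c : ℂ
            c = ⟪ (λ i → f x i -ᶜ f x′ i) , F ω₀ ⟫⟨ X ⟩

            φ-φ : φ x -ᶜ φ x′ ≈ᶜ conj (T ω₀) *ᶜ c
            φ-φ = R.begin
              φ x -ᶜ φ x′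
                R.≈⟨ ℂᴿ.+-congˡ (ℂᴿ.trans (solveᶜ 1 (λ a → ⊝ a ⊜ ⊝ #ᶜ 1 ⊗ a) (φ x′)) (ℂ∑.*-distribˡ-∑ (-ᶜ 1ᶜ) X _)) ⟩
              φ x +ᶜ ∑ᶜ X (λ i → (-ᶜ 1ᶜ) *ᶜ (f x′ i *ᶜ conj (v i)))
                R.≈⟨ ℂ∑.∑-+ X _ _ ⟨
              ∑ᶜ X (λ i → f x i *ᶜ conj (v i) +ᶜ (-ᶜ 1ᶜ) *ᶜ (f x′ i *ᶜ conj (v i)))
                R.≈⟨ ℂ∑.∑-cong (λ i → ℂᴿ.trans (ℂᴿ.+-cong (ℂᴿ.*-congˡ (conj-* (T ω₀) (F ω₀ i))) (ℂᴿ.*-congˡ (ℂᴿ.*-congˡ (conj-* (T ω₀) (F ω₀ i)))))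
                     (solveᶜ 4 (λ a b t h → a ⊗ (t ⊗ h) ⊕ ⊝ #ᶜ 1 ⊗ (b ⊗ (t ⊗ h)) ⊜ t ⊗ ((a ⊖ b) ⊗ h)) (f x i) (f x′ i) (conj (T ω₀)) (conj (F ω₀ i)))) X ⟩
              ∑ᶜ X (λ i → conj (T ω₀) *ᶜ ((f x i -ᶜ f x′ i) *ᶜ conj (F ω₀ i)))
                R.≈⟨ ℂ∑.*-distribˡ-∑ (conj (T ω₀)) X _ ⟨
              conj (T ω₀) *ᶜ c R.∎
              where module R = ℂ-Reasoning

            seen : ∣ T ω₀ ∣² * ∣ c ∣² ≤ A * A * J
            seen = begin
              ∣ T ω₀ ∣² * ∣ c ∣²
                ≈⟨ trans (*-congʳ (sym (∣∣²-conj (T ω₀)))) (trans (sym (∣∣²-* (conj (T ω₀)) c)) (∣∣²-cong (ℂᴿ.sym φ-φ))) ⟩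
              t
                ≤⟨ enlarge ⟩
              (A * weight mx x) * ((A * weight mx x′) * t)
                ≈⟨ solve 4 (λ a w w′ t → (a :* w) :* ((a :* w′) :* t) := a :* a :* (w :* (w′ :* t))) A (weight mx x) (weight mx x′) t ⟩
              A * A * (weight mx x * (weight mx x′ * t))
                ≤⟨ *-monoˡ-≤ (0≤A ⊠ 0≤A) (≤-trans (weighted≤pairs (λ x x′ → ∣∣²-nonNeg (φ x -ᶜ φ x′)) x x′ b) influence≤J) ⟩
              A * A * J ∎
              where
              t : ℝ
              t = ∣ φ x -ᶜ φ x′ ∣²
              0≤t : 0# ≤ t
              0≤t = ∣∣²-nonNeg (φ x -ᶜ φ x′)
              t≤At : t ≤ (A * weight mx x′) * t
              t≤At = ≤-respˡ-≈ (*-identityˡ t) (*-monoʳ-≤ 0≤t (1≤Amx ω′ ω′∈))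
              enlarge : t ≤ (A * weight mx x) * ((A * weight mx x′) * t)
              enlarge = ≤-trans t≤At (≤-respˡ-≈ (*-identityˡ _) (*-monoʳ-≤ (≤-trans 0≤t t≤At) (1≤Amx ω ω∈)))

            unseen : (1# - ∣ T ω₀ ∣²) * ∣ c ∣² ≤ num 4 * (m * e)
            unseen = begin
              (1# - ∣ T ω₀ ∣²) * ∣ c ∣²
                ≤⟨ *-monoˡ-≤ (gap (∣T∣²≤1 ω₀ ω₀∈)) (∣⟪⟫∣²≤ X _ (F ω₀)) ⟩
              (1# - ∣ T ω₀ ∣²) * (‖f-f‖² x x′ * ‖ F ω₀ ‖²⟨ X ⟩)
                ≈⟨ solve 3 (λ a b c → a :* (b :* c) := b :* (a :* c)) (1# - ∣ T ω₀ ∣²) (‖f-f‖² x x′) ‖ F ω₀ ‖²⟨ X ⟩ ⟩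
              ‖f-f‖² x x′ * loss ω₀
                ≤⟨ *-mono-≤ (0≤‖f-f‖² x x′) 0≤e ‖f-f‖²≤4m (loss≤e ω₀ ω₀∈) ⟩
              num 4 * m * e
                ≈⟨ *-assoc _ _ _ ⟩
              num 4 * (m * e) ∎
              where
              ‖f-f‖²≤4m : ‖f-f‖² x x′ ≤ num 4 * m
              ‖f-f‖²≤4m = begin
                ‖f-f‖² x x′                                                 ≤⟨ ∑-mono-≤ (λ i → ∣∣²-sub-≤ (f x i) (f x′ i)) X ⟩
                ∑ X (λ i → num 2 * (∣ f x i ∣² + ∣ f x′ i ∣²))              ≈⟨ trans (sym (*-distribˡ-∑ (num 2) X _)) (*-congˡ (∑-+ X _ _)) ⟩
                num 2 * (‖ f x ‖²⟨ X ⟩ + ‖ f x′ ‖²⟨ X ⟩)                    ≤⟨ *-monoˡ-≤ (0≤num 2) (+-mono-≤ (‖F‖²≤m ω ω∈) (‖F‖²≤m ω′ ω′∈)) ⟩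
                num 2 * (m + m)                                             ≈⟨ solve 1 (λ m → # 2 :* (m :+ m) := # 4 :* m) m ⟩
                num 4 * m                                                   ∎

          -- The squared distance is the difference of the inner products of f x - f x′ with f x and
          -- with f x′, so the two atoms `ω` and `ω′` serve as test atoms.
          ‖f-f‖²≤B : ∀ ω ω′ → supp (dist μ) ω → supp (dist μ) ω′ → both (proj₁ ω) (proj₁ ω′) ≡.≡ true →
            ‖f-f‖² (proj₁ ω) (proj₁ ω′) ≤ B
          ‖f-f‖²≤B ω@(x , _ , _) ω′@(x′ , _ , _) ω∈ ω′∈ b = square-cancel-≤ 0≤B (begin
            ‖f-f‖² x x′ * ‖f-f‖² x x′
              ≈⟨ *-cong ‖f-f‖²≈ ‖f-f‖²≈ ⟩
            re (c₁ -ᶜ c₂) * re (c₁ -ᶜ c₂)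
              ≤⟨ re²≤∣∣² (c₁ -ᶜ c₂) ⟩
            ∣ c₁ -ᶜ c₂ ∣²
              ≤⟨ ∣∣²-sub-≤ c₁ c₂ ⟩
            num 2 * (∣ c₁ ∣² + ∣ c₂ ∣²)
              ≤⟨ *-monoˡ-≤ (0≤num 2) (+-mono-≤ (separated ω ω′ ω∈ ω′∈ b ω ω∈) (separated ω ω′ ω∈ ω′∈ b ω′ ω′∈)) ⟩
            num 2 * (bound + bound)
              ≈⟨ solve 1 (λ m → # 2 :* (m :+ m) := # 4 :* m) bound ⟩
            num 4 * bound
              ≤⟨ JB ⟩
            B * B ∎)
            where
            open ≤-Reasoning
            c₁ c₂ : ℂ
            c₁ = ⟪ (λ i → f x i -ᶜ f x′ i) , f x ⟫⟨ X ⟩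
            c₂ = ⟪ (λ i → f x i -ᶜ f x′ i) , f x′ ⟫⟨ X ⟩
            ‖f-f‖²≈ : ‖f-f‖² x x′ ≈ re (c₁ -ᶜ c₂)
            ‖f-f‖²≈ = trans (trans (∑-cong (λ i → solve 4 (λ a b c d → let f = a , b ; f′ = c , d in
                        :∣ f :-ᶜ f′ ∣² := proj₁ ((f :-ᶜ f′) :*ᶜ :conj f) :- proj₁ ((f :-ᶜ f′) :*ᶜ :conj f′))
                        (re (f x i)) (im (f x i)) (re (f x′ i)) (im (f x′ i))) X) (∑-sub X _ _))
                      (+-cong (sym (re-∑ᶜ X _)) (-‿cong (sym (re-∑ᶜ X _))))

        pairs‖f-f‖²≤B : pairs (λ x x′ → ‖ (λ i → f x i -ᶜ f x′ i) ‖²⟨ X ⟩) ≤ B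
        pairs‖f-f‖²≤B = pairs-≤ mx-total 0≤B λ x x′ b x∈ x′∈ →
          ≤-on-suppˣ μ≥0 x∈ λ y z ω∈ → ≤-on-suppˣ μ≥0 x′∈ λ y′ z′ ω′∈ →
            ‖f-f‖²≤B (x , y , z) (x′ , y′ , z′) ω∈ ω′∈ b

-- Tensor powers

module TensorPowers (ℛ : CompleteOrderedField) where
  open Theory ℛ hiding (zero)
  open RealFieldProperties ℛ
  open ComplexProperties ℛ
  open ExpectationProperties ℛ

  ∏-nonNeg : ∀ n (f : Fin n → ℝ) → (∀ i → 0# ≤ f i) → 0# ≤ ∏ f
  ∏-nonNeg zero    f 0≤f = 0≤1
  ∏-nonNeg (suc n) f 0≤f = 0≤f zero ⊠ ∏-nonNeg n (λ i → f (suc i)) (λ i → 0≤f (suc i))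

  module _ {Ω : Set} (μ : Weighted Ω) where

    ^⊗-nonNeg : NonNegative μ → ∀ n → NonNegative (μ ^⊗ n)
    ^⊗-nonNeg μ≥0 n ω = ∏-nonNeg n _ (λ i → μ≥0 (lookup ω i))

    𝔼-slice : ∀ {n} (i : Fin (suc n)) (f : Vec Ω (suc n) → ℝ) →
      𝔼 (μ ^⊗ suc n) f ≈ 𝔼 μ (λ a → 𝔼 (μ ^⊗ n) (λ w → f (insertAt w i a)))
    𝔼-slice {n} i f = begin
      𝔼 (μ ^⊗ suc n) f
        ≈⟨ ∑-words-suc (points μ) n _ i ⟩
      ∑ (points μ) (λ a → ∑ (words (points μ) n) (λ w → weight (μ ^⊗ suc n) (insertAt w i a) * f (insertAt w i a)))
        ≈⟨ ∑-cong (λ a → trans (∑-cong (λ w → trans (*-congʳ (∏-insertAt w i a (weight μ))) (*-assoc _ _ _)) (words (points μ) n))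
                           (sym (*-distribˡ-∑ (weight μ a) (words (points μ) n) _))) (points μ) ⟩
      𝔼 μ (λ a → 𝔼 (μ ^⊗ n) (λ w → f (insertAt w i a))) ∎
      where open ≈-Reasoning

    𝔼ᶜ-slice : ∀ {n} (i : Fin (suc n)) (f : Vec Ω (suc n) → ℂ) →
      𝔼ᶜ (μ ^⊗ suc n) f ≈ᶜ 𝔼ᶜ μ (λ a → 𝔼ᶜ (μ ^⊗ n) (λ w → f (insertAt w i a)))
    𝔼ᶜ-slice {n} i f =
      trans (re-𝔼ᶜ (μ ^⊗ suc n) f) (trans (𝔼-slice i (λ w → re (f w)))
        (trans (𝔼-cong μ (λ a → sym (re-𝔼ᶜ (μ ^⊗ n) (λ w → f (insertAt w i a))))) (sym (re-𝔼ᶜ μ _)))) ,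
      trans (im-𝔼ᶜ (μ ^⊗ suc n) f) (trans (𝔼-slice i (λ w → im (f w)))
        (trans (𝔼-cong μ (λ a → sym (im-𝔼ᶜ (μ ^⊗ n) (λ w → f (insertAt w i a))))) (sym (im-𝔼ᶜ μ _))))

  module Correlation {s g p} (μ : Fin s × Fin g × Fin p → ℝ) (T : Fin s × Fin g × Fin p → ℂ) where

    slice : ∀ {A : Set} {n} → Fin (suc n) → A → (Vec A (suc n) → ℂ) → Vec A n → ℂ
    slice i a F w = F (insertAt w i a)

    module _ (n : ℕ) where
      private
        W : Weighted (Vec (Fin s × Fin g × Fin p) n)
        W = dist μ ^⊗ n
        xs : Vec (Fin s × Fin g × Fin p) n → Vec (Fin s) n
        xs = Vec.map proj₁
        ys : Vec (Fin s × Fin g × Fin p) n → Vec (Fin g) n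
        ys = Vec.map (λ t → proj₁ (proj₂ t))
        zs : Vec (Fin s × Fin g × Fin p) n → Vec (Fin p) n
        zs = Vec.map (λ t → proj₂ (proj₂ t))
        ts : Vec (Fin s × Fin g × Fin p) n → ℂ
        ts w = ∏ᶜ (λ i → T (lookup w i))
        term : (Vec (Fin s) n → ℂ) → (Vec (Fin g) n → ℂ) → (Vec (Fin p) n → ℂ) → Vec (Fin s × Fin g × Fin p) n → ℂ
        term F G H w = F (xs w) *ᶜ G (ys w) *ᶜ H (zs w) *ᶜ ts w

      correlation-congˣ : ∀ {F F′} → (∀ x → F x ≈ᶜ F′ x) → ∀ G H → correlation μ T n F G H ≈ᶜ correlation μ T n F′ G H
      correlation-congˣ {F} {F′} F≈F′ G H = 𝔼ᶜ-cong W {term F G H} {term F′ G H} λ w →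
        ℂᴿ.*-congʳ {ts w} (ℂᴿ.*-congʳ {H (zs w)} (ℂᴿ.*-congʳ {G (ys w)} (F≈F′ (xs w))))

      correlation-*ˣ : ∀ c F G H → correlation μ T n (λ x → c *ᶜ F x) G H ≈ᶜ c *ᶜ correlation μ T n F G H
      correlation-*ˣ c F G H = ℂᴿ.trans
        (𝔼ᶜ-cong W (λ w → solveᶜ 5 (λ c a b d e → c ⊗ a ⊗ b ⊗ d ⊗ e ⊜ c ⊗ (a ⊗ b ⊗ d ⊗ e)) c (F (xs w)) (G (ys w)) (H (zs w)) (ts w)))
        (𝔼ᶜ-*ˡ W c (term F G H))

      correlation-∑ˣ : ∀ {A : Set} (as : List A) (F : A → Vec (Fin s) n → ℂ) G H →
        correlation μ T n (λ x → ∑ᶜ as (λ a → F a x)) G H ≈ᶜ ∑ᶜ as (λ a → correlation μ T n (F a) G H)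
      correlation-∑ˣ as F G H = ℂᴿ.trans
        (𝔼ᶜ-cong W {term (λ x → ∑ᶜ as (λ a → F a x)) G H} (λ w →
          ℂᴿ.trans (ℂᴿ.*-congʳ {ts w} (ℂᴿ.trans (ℂᴿ.*-congʳ {H (zs w)} (ℂ∑.*-distribʳ-∑ (G (ys w)) as (λ a → F a (xs w))))
            (ℂ∑.*-distribʳ-∑ (H (zs w)) as (λ a → F a (xs w) *ᶜ G (ys w))))) (ℂ∑.*-distribʳ-∑ (ts w) as (λ a → F a (xs w) *ᶜ G (ys w) *ᶜ H (zs w)))))
        (𝔼ᶜ-∑ W as (λ a → term (F a) G H))

      correlation-linearʸ : ∀ ω F G G′ H →
        correlation μ T n F (λ y → G y +ᶜ ω *ᶜ G′ y) H ≈ᶜ correlation μ T n F G H +ᶜ ω *ᶜ correlation μ T n F G′ H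
      correlation-linearʸ ω F G G′ H = ℂᴿ.trans
        (𝔼ᶜ-cong W (λ w → solveᶜ 6 (λ o a b b′ d e → a ⊗ (b ⊕ o ⊗ b′) ⊗ d ⊗ e ⊜ a ⊗ b ⊗ d ⊗ e ⊕ o ⊗ (a ⊗ b′ ⊗ d ⊗ e))
          ω (F (xs w)) (G (ys w)) (G′ (ys w)) (H (zs w)) (ts w)))
        (ℂᴿ.trans (𝔼ᶜ-+ W (term F G H) (λ w → ω *ᶜ term F G′ H w)) (ℂᴿ.+-congˡ {correlation μ T n F G H} (𝔼ᶜ-*ˡ W ω (term F G′ H))))

      correlation-linearᶻ : ∀ ω F G H H′ →
        correlation μ T n F G (λ z → H z +ᶜ ω *ᶜ H′ z) ≈ᶜ correlation μ T n F G H +ᶜ ω *ᶜ correlation μ T n F G H′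
      correlation-linearᶻ ω F G H H′ = ℂᴿ.trans
        (𝔼ᶜ-cong W (λ w → solveᶜ 6 (λ o a b d d′ e → a ⊗ b ⊗ (d ⊕ o ⊗ d′) ⊗ e ⊜ a ⊗ b ⊗ d ⊗ e ⊕ o ⊗ (a ⊗ b ⊗ d′ ⊗ e))
          ω (F (xs w)) (G (ys w)) (H (zs w)) (H′ (zs w)) (ts w)))
        (ℂᴿ.trans (𝔼ᶜ-+ W (term F G H) (λ w → ω *ᶜ term F G H′ w)) (ℂᴿ.+-congˡ {correlation μ T n F G H} (𝔼ᶜ-*ˡ W ω (term F G H′))))

    correlation-slice : ∀ n (i : Fin (suc n)) F G H → correlation μ T (suc n) F G H ≈ᶜ
      𝔼ᶜ (dist μ) (λ (x , y , z) → T (x , y , z) *ᶜ correlation μ T n (slice i x F) (slice i y G) (slice i z H))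
    correlation-slice n i F G H = ℂᴿ.trans (𝔼ᶜ-slice (dist μ) i _) (𝔼ᶜ-cong (dist μ) λ t@(x , y , z) →
      let term : Vec (Fin s × Fin g × Fin p) n → ℂ
          term w = slice i x F (Vec.map proj₁ w) *ᶜ slice i y G (Vec.map (λ t → proj₁ (proj₂ t)) w) *ᶜ slice i z H (Vec.map (λ t → proj₂ (proj₂ t)) w)
      in ℂᴿ.trans
      (𝔼ᶜ-cong (dist μ ^⊗ n) λ w → ℂᴿ.trans
        (ℂᴿ.*-cong {y = term w}
          (ℂᴿ.reflexive (≡.cong₂ _*ᶜ_ (≡.cong₂ _*ᶜ_
            (≡.cong F (map-insertAt proj₁ t w i))
            (≡.cong G (map-insertAt (λ t → proj₁ (proj₂ t)) t w i)))
            (≡.cong H (map-insertAt (λ t → proj₂ (proj₂ t)) t w i))))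
          (ℂ∑.∏-insertAt w i t T))
        (solveᶜ 3 (λ a t q → a ⊗ (t ⊗ q) ⊜ t ⊗ (a ⊗ q)) (term w) (T t) (∏ᶜ (λ j → T (lookup w j)))))
      (𝔼ᶜ-*ˡ (dist μ ^⊗ n) (T t) (λ w → term w *ᶜ ∏ᶜ (λ j → T (lookup w j)))))

-- Effective bases

module EffectiveBasisProperties (ℛ : CompleteOrderedField) where
  open Theory ℛ hiding (zero)
  open RealFieldProperties ℛ
  open ComplexProperties ℛ
  open ExpectationProperties ℛ
  open OneCoordinate ℛ
  open TensorPowers ℛ

  module OrthonormalBasis {s g p} (μ : Fin s × Fin g × Fin p → ℝ) (μ≥0 : NonNegative (dist μ))
    (total : ∑ (points (dist μ)) μ ≈ 1#) (Σ′ : Subset s) (basis : EffectiveBasis μ Σ′)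
    (A : ℝ) (0≤A : 0# ≤ A) (1≤Aμ : ∀ ω → supp (dist μ) ω → 1# ≤ A * μ ω) where
    open EffectiveBasis basis
    open Marginals μ
    open Pairs μ μ≥0 Σ′

    private
      mx : Weighted (Fin s)
      mx = marginalˣ μ
      mx≥0 : NonNegative mx
      mx≥0 = marginalˣ-nonNeg μ≥0
      mx-total : ∑ (allFin s) (weight mx) ≈ 1#
      mx-total = marginalˣ-total total

    Index : Set
    Index = Fin (k₁ ℕ.+ k₂)

    indices : List Index
    indices = allFin (k₁ ℕ.+ k₂)

    degree : Index → ℕ
    degree b = [ const 0 , const 1 ]′ (splitAt k₁ b)

    private
      V : Fin k₁ ⊎ Fin k₂ → Fin s → ℂ
      V = [ B₁ , B₂ ]′

    -- On Σ′, which carries `B₂ j`, the function `B₁ i` is a constant, and `B₂ j` is orthogonal to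
    -- constants. The constant is read off at a point of Σ′; if there is none, `B₂ j` vanishes.
    B₂⊥B₁ : ∀ j i → ⟨ B₂ j , B₁ i ⟩[ mx ] ≈ᶜ 0ᶜ
    B₂⊥B₁ j i with excludedMiddle {P = Σ[ x ∈ Fin s ] x ∈ Σ′}
    ... | yes (x₀ , x₀∈) = ℂᴿ.trans (𝔼ᶜ-cong mx same) (proj₂ (IsOrthonormalBasis.inside basis₂ j) (B₁ i x₀))
      where
      same : ∀ x → B₂ j x *ᶜ conj (B₁ i x) ≈ᶜ B₂ j x *ᶜ conj (B₁ i x₀)
      same x with x ∈? Σ′
      ... | yes x∈ = ℂᴿ.*-congˡ {B₂ j x} (conj-cong (IsOrthonormalBasis.inside basis₁ i x x₀ x∈ x₀∈))
      ... | no  x∉ = ℂᴿ.trans (vanish (B₁ i x)) (ℂᴿ.sym (vanish (B₁ i x₀)))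
        where
        vanish : ∀ z → B₂ j x *ᶜ conj z ≈ᶜ 0ᶜ
        vanish z = ℂᴿ.trans (ℂᴿ.*-congʳ {conj z} (proj₁ (IsOrthonormalBasis.inside basis₂ j) x x∉)) (ℂᴿ.zeroˡ (conj z))
    ... | no empty = ℂᴿ.trans (𝔼ᶜ-cong mx {g = λ _ → 0ᶜ *ᶜ 0ᶜ} λ x →
          ℂᴿ.trans (ℂᴿ.*-congʳ {conj (B₁ i x)} (proj₁ (IsOrthonormalBasis.inside basis₂ j) x λ x∈ → empty (x , x∈)))
            (ℂᴿ.trans (ℂᴿ.zeroˡ (conj (B₁ i x))) (ℂᴿ.sym (ℂᴿ.zeroˡ 0ᶜ))))
          (ℂᴿ.trans (𝔼ᶜ-*ˡ mx 0ᶜ (λ _ → 0ᶜ)) (ℂᴿ.zeroˡ _))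

    conj-⟨⟩ : ∀ f h → conj ⟨ f , h ⟩[ mx ] ≈ᶜ ⟨ h , f ⟩[ mx ]
    conj-⟨⟩ f h = ℂᴿ.trans (conj-∑ᶜ (allFin s) _) (ℂ∑.∑-cong (λ x →
      solve 5 (λ w a b c d → w :* (a :* c :- b :* (:- d)) := w :* (c :* a :- d :* (:- b))) (weight mx x) (re (f x)) (im (f x)) (re (h x)) (im (h x)) ,
      solve 5 (λ w a b c d → :- (w :* (a :* (:- d) :+ b :* c)) := w :* (c :* (:- b) :+ d :* a)) (weight mx x) (re (f x)) (im (f x)) (re (h x)) (im (h x)))
      (allFin s))

    V-orthogonal : ∀ u u′ → u ≢ u′ → ⟨ V u , V u′ ⟩[ mx ] ≈ᶜ 0ᶜ
    V-orthogonal (inj₁ i) (inj₁ i′) u≢u′ = IsOrthonormalBasis.orthogonal basis₁ i i′ (u≢u′ ∘ ≡.cong inj₁)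
    V-orthogonal (inj₁ i) (inj₂ j′) u≢u′ = ℂᴿ.trans (ℂᴿ.sym (conj-⟨⟩ (B₂ j′) (B₁ i)))
      (ℂᴿ.trans (conj-cong (B₂⊥B₁ j′ i)) (refl , solve 0 (:- # 0 := # 0)))
    V-orthogonal (inj₂ j) (inj₁ i′) u≢u′ = B₂⊥B₁ j i′
    V-orthogonal (inj₂ j) (inj₂ j′) u≢u′ = IsOrthonormalBasis.orthogonal basis₂ j j′ (u≢u′ ∘ ≡.cong inj₂)

    V-normalised : ∀ u → ⟨ V u , V u ⟩[ mx ] ≈ᶜ 1ᶜ
    V-normalised (inj₁ i) = IsOrthonormalBasis.normalised basis₁ i
    V-normalised (inj₂ j) = IsOrthonormalBasis.normalised basis₂ j

    B-orthogonal : ∀ b b′ → b ≢ b′ → ⟨ B b , B b′ ⟩[ mx ] ≈ᶜ 0ᶜ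
    B-orthogonal b b′ b≢b′ = V-orthogonal (splitAt k₁ b) (splitAt k₁ b′) λ eq →
      b≢b′ (≡.trans (≡.sym (join-splitAt k₁ k₂ b)) (≡.trans (≡.cong (join k₁ k₂) eq) (join-splitAt k₁ k₂ b′)))

    B-normalised : ∀ b → ⟨ B b , B b ⟩[ mx ] ≈ᶜ 1ᶜ
    B-normalised b = V-normalised (splitAt k₁ b)

    expansion : (Index → ℂ) → Fin s → ℂ
    expansion a x = ∑ᶜ indices (λ b → a b *ᶜ B b x)

    parseval : ∀ a → 𝔼 mx (λ x → ∣ expansion a x ∣²) ≈ ‖ a ‖²⟨ indices ⟩
    parseval a = begin
      𝔼 mx (λ x → ∣ expansion a x ∣²)
        ≈⟨ 𝔼-cong mx (λ x → proj₁ (z*conj[z] (expansion a x))) ⟨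
      𝔼 mx (λ x → re (expansion a x *ᶜ conj (expansion a x)))
        ≈⟨ re-𝔼ᶜ mx (λ x → expansion a x *ᶜ conj (expansion a x)) ⟨
      re (𝔼ᶜ mx (λ x → expansion a x *ᶜ conj (expansion a x)))
        ≈⟨ proj₁ gram ⟩
      re (∑ᶜ indices (λ b → ∑ᶜ indices (λ b′ → a b *ᶜ conj (a b′) *ᶜ ⟨ B b , B b′ ⟩[ mx ])))
        ≈⟨ proj₁ (ℂ∑.∑-cong diagonal indices) ⟩
      re (∑ᶜ indices (λ b → ι ∣ a b ∣²))
        ≈⟨ re-∑ᶜ indices (λ b → ι ∣ a b ∣²) ⟩
      ‖ a ‖²⟨ indices ⟩ ∎
      where
      open ≈-Reasoning
      module R = ℂ-Reasoning
      t : Index → Index → Fin s → ℂ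
      t b b′ x = (a b *ᶜ B b x) *ᶜ conj (a b′ *ᶜ B b′ x)
      t≈ : ∀ b b′ x → t b b′ x ≈ᶜ (a b *ᶜ conj (a b′)) *ᶜ (B b x *ᶜ conj (B b′ x))
      t≈ b b′ x = ℂᴿ.trans (ℂᴿ.*-congˡ {a b *ᶜ B b x} (conj-* (a b′) (B b′ x)))
        (solveᶜ 4 (λ a v a′ v′ → a ⊗ v ⊗ (a′ ⊗ v′) ⊜ a ⊗ a′ ⊗ (v ⊗ v′)) (a b) (B b x) (conj (a b′)) (conj (B b′ x)))
      gram : 𝔼ᶜ mx (λ x → expansion a x *ᶜ conj (expansion a x)) ≈ᶜ
        ∑ᶜ indices (λ b → ∑ᶜ indices (λ b′ → a b *ᶜ conj (a b′) *ᶜ ⟨ B b , B b′ ⟩[ mx ]))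
      gram = R.begin
        𝔼ᶜ mx (λ x → expansion a x *ᶜ conj (expansion a x))
          R.≈⟨ 𝔼ᶜ-cong mx (λ x → ℂᴿ.trans (ℂᴿ.*-congˡ {expansion a x} (conj-∑ᶜ indices (λ b → a b *ᶜ B b x)))
                 (ℂ∑.∑-* indices (λ b → a b *ᶜ B b x) indices (λ b → conj (a b *ᶜ B b x)))) ⟩
        𝔼ᶜ mx (λ x → ∑ᶜ indices (λ b → ∑ᶜ indices (λ b′ → t b b′ x)))
          R.≈⟨ ℂᴿ.trans (𝔼ᶜ-∑ mx indices (λ b x → ∑ᶜ indices (λ b′ → t b b′ x))) (ℂ∑.∑-cong (λ b → 𝔼ᶜ-∑ mx indices (t b)) indices) ⟩
        ∑ᶜ indices (λ b → ∑ᶜ indices (λ b′ → 𝔼ᶜ mx (t b b′)))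
          R.≈⟨ ℂ∑.∑-cong (λ b → ℂ∑.∑-cong (λ b′ → ℂᴿ.trans (𝔼ᶜ-cong mx (t≈ b b′)) (𝔼ᶜ-*ˡ mx (a b *ᶜ conj (a b′)) _)) indices) indices ⟩
        ∑ᶜ indices (λ b → ∑ᶜ indices (λ b′ → a b *ᶜ conj (a b′) *ᶜ ⟨ B b , B b′ ⟩[ mx ])) R.∎
      diagonal : ∀ b → ∑ᶜ indices (λ b′ → a b *ᶜ conj (a b′) *ᶜ ⟨ B b , B b′ ⟩[ mx ]) ≈ᶜ ι ∣ a b ∣²
      diagonal b = R.begin
        ∑ᶜ indices (λ b′ → a b *ᶜ conj (a b′) *ᶜ ⟨ B b , B b′ ⟩[ mx ])
          R.≈⟨ ℂ∑.∑-single b (λ b′ → a b *ᶜ conj (a b′) *ᶜ ⟨ B b , B b′ ⟩[ mx ]) (λ b′ b′≢b →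
                 ℂᴿ.trans (ℂᴿ.*-congˡ {a b *ᶜ conj (a b′)} (B-orthogonal b b′ (b′≢b ∘ ≡.sym))) (ℂᴿ.zeroʳ (a b *ᶜ conj (a b′)))) ⟩
        a b *ᶜ conj (a b) *ᶜ ⟨ B b , B b ⟩[ mx ]
          R.≈⟨ ℂᴿ.trans (ℂᴿ.*-congˡ {a b *ᶜ conj (a b)} (B-normalised b)) (ℂᴿ.*-identityʳ (a b *ᶜ conj (a b))) ⟩
        a b *ᶜ conj (a b)
          R.≈⟨ z*conj[z] (a b) ⟩
        ι ∣ a b ∣² R.∎

    module _ (a : Index → ℂ) where
      private
        -- The degree is 0 on `B₁` and 1 on `B₂`, so multiplying the coefficients by it projects `φ`
        -- to its `B₂` part `φ₂`.
        c : Index → ℂ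
        c b = ι (fromℕ (degree b)) *ᶜ a b

        φ φ₂ : Fin s → ℂ
        φ  = expansion a
        φ₂ = expansion c

        N : ℝ
        N = 𝔼 mx (λ x → ∣ φ₂ x ∣²)

        ι0* : ∀ z → ι (fromℕ 0) *ᶜ z ≈ᶜ 0ᶜ
        ι0* = ℂᴿ.zeroˡ

        ι1* : ∀ z → ι (fromℕ 1) *ᶜ z ≈ᶜ z
        ι1* z = ℂᴿ.trans (ℂᴿ.*-congʳ {z} (+-identityʳ 1# , refl)) (ℂᴿ.*-identityˡ z)

        φ-φ₂ : ∀ {x x′} → x ∈ Σ′ → x′ ∈ Σ′ → φ x -ᶜ φ₂ x ≈ᶜ φ x′ -ᶜ φ₂ x′
        φ-φ₂ {x} {x′} x∈ x′∈ = ℂᴿ.trans (ℂᴿ.sym (ℂ∑.∑-sub indices (λ b → a b *ᶜ B b x) (λ b → c b *ᶜ B b x)))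
          (ℂᴿ.trans (ℂ∑.∑-cong (λ b → same (splitAt k₁ b) (a b)) indices) (ℂ∑.∑-sub indices (λ b → a b *ᶜ B b x′) (λ b → c b *ᶜ B b x′)))
          where
          same : ∀ u z → z *ᶜ V u x -ᶜ (ι (fromℕ ([ const 0 , const 1 ]′ u)) *ᶜ z) *ᶜ V u x ≈ᶜ
                         z *ᶜ V u x′ -ᶜ (ι (fromℕ ([ const 0 , const 1 ]′ u)) *ᶜ z) *ᶜ V u x′
          same (inj₁ i) z = ℂᴿ.+-cong (ℂᴿ.*-congˡ {z} eq) (ℂᴿ.-‿cong (ℂᴿ.*-congˡ {ι (fromℕ 0) *ᶜ z} eq))
            where
            eq : B₁ i x ≈ᶜ B₁ i x′
            eq = IsOrthonormalBasis.inside basis₁ i x x′ x∈ x′∈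
          same (inj₂ j) z = ℂᴿ.trans (cancel x) (ℂᴿ.sym (cancel x′))
            where
            cancel : ∀ x → z *ᶜ B₂ j x -ᶜ (ι (fromℕ 1) *ᶜ z) *ᶜ B₂ j x ≈ᶜ 0ᶜ
            cancel x = ℂᴿ.trans (ℂᴿ.+-congˡ {z *ᶜ B₂ j x} (ℂᴿ.-‿cong (ℂᴿ.*-congʳ {B₂ j x} (ι1* z)))) (ℂᴿ.-‿inverseʳ (z *ᶜ B₂ j x))

        φ₂-supported : ∀ {x} → x ∉ Σ′ → φ₂ x ≈ᶜ 0ᶜ
        φ₂-supported {x} x∉ = ℂ∑.∑-zero (λ b → vanish (splitAt k₁ b) (a b)) indices
          where
          vanish : ∀ u z → (ι (fromℕ ([ const 0 , const 1 ]′ u)) *ᶜ z) *ᶜ V u x ≈ᶜ 0ᶜ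
          vanish (inj₁ i) z = ℂᴿ.trans (ℂᴿ.*-congʳ {B₁ i x} (ι0* z)) (ℂᴿ.zeroˡ (B₁ i x))
          vanish (inj₂ j) z = ℂᴿ.trans (ℂᴿ.*-congˡ {ι (fromℕ 1) *ᶜ z} (proj₁ (IsOrthonormalBasis.inside basis₂ j) x x∉)) (ℂᴿ.zeroʳ (ι (fromℕ 1) *ᶜ z))

        φ₂-mean : 𝔼ᶜ mx φ₂ ≈ᶜ 0ᶜ
        φ₂-mean = ℂᴿ.trans (𝔼ᶜ-∑ mx indices (λ b x → c b *ᶜ B b x)) (ℂ∑.∑-zero (λ b →
          ℂᴿ.trans (𝔼ᶜ-*ˡ mx (c b) (B b)) (vanish (splitAt k₁ b) (a b))) indices)
          where
          vanish : ∀ u z → (ι (fromℕ ([ const 0 , const 1 ]′ u)) *ᶜ z) *ᶜ 𝔼ᶜ mx (V u) ≈ᶜ 0ᶜ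
          vanish (inj₁ i) z = ℂᴿ.trans (ℂᴿ.*-congʳ {𝔼ᶜ mx (B₁ i)} (ι0* z)) (ℂᴿ.zeroˡ (𝔼ᶜ mx (B₁ i)))
          vanish (inj₂ j) z = ℂᴿ.trans (ℂᴿ.*-congˡ {ι (fromℕ 1) *ᶜ z} (ℂᴿ.trans
              (𝔼ᶜ-cong mx (λ x → solve 2 (λ a b → a := a :* # 1 :- b :* (:- # 0)) (re (B₂ j x)) (im (B₂ j x)) ,
                                  solve 2 (λ a b → b := a :* (:- # 0) :+ b :* # 1) (re (B₂ j x)) (im (B₂ j x))))
              (proj₂ (IsOrthonormalBasis.inside basis₂ j) 1ᶜ))) (ℂᴿ.zeroʳ (ι (fromℕ 1) *ᶜ z))

        inside : Fin s → ℝ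
        inside x = if does (x ∈? Σ′) then 1# else 0#

        σ : ℝ
        σ = 𝔼 mx inside

        0≤inside : ∀ x → 0# ≤ inside x
        0≤inside x with x ∈? Σ′
        ... | yes _ = 0≤1
        ... | no _  = ≤-refl

        cross : Fin s → Fin s → ℝ
        cross x x′ = re (φ₂ x) * re (φ₂ x′) + im (φ₂ x) * im (φ₂ x′)

        pointwise : ∀ x x′ → (if both x x′ then ∣ φ x -ᶜ φ x′ ∣² else 0#) ≈
          ∣ φ₂ x ∣² * inside x′ + inside x * ∣ φ₂ x′ ∣² - num 2 * cross x x′
        pointwise x x′ with x ∈? Σ′ | x′ ∈? Σ′
        ... | yes x∈ | yes x′∈ = trans (∣∣²-cong (ℂᴿ.trans
                (solveᶜ 4 (λ a b c d → a ⊖ b ⊜ (a ⊖ c) ⊖ (b ⊖ d) ⊕ (c ⊖ d)) (φ x) (φ x′) (φ₂ x) (φ₂ x′))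
                (ℂᴿ.trans (ℂᴿ.+-congʳ {φ₂ x -ᶜ φ₂ x′} (ℂᴿ.+-congʳ { -ᶜ (φ x′ -ᶜ φ₂ x′)} (φ-φ₂ x∈ x′∈)))
                  (solveᶜ 2 (λ a b → a ⊖ a ⊕ b ⊜ b) (φ x′ -ᶜ φ₂ x′) (φ₂ x -ᶜ φ₂ x′)))))
              (solve 4 (λ a b c d → :∣ (a , b) :-ᶜ (c , d) ∣² := :∣ a , b ∣² :* # 1 :+ # 1 :* :∣ c , d ∣² :- # 2 :* (a :* c :+ b :* d))
                (re (φ₂ x)) (im (φ₂ x)) (re (φ₂ x′)) (im (φ₂ x′)))
        ... | yes x∈ | no x′∉ = sym (trans (+-cong (+-congˡ (*-congˡ (∣∣²-cong (φ₂-supported x′∉))))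
                (-‿cong (*-congˡ (+-cong (*-congˡ (proj₁ (φ₂-supported x′∉))) (*-congˡ (proj₂ (φ₂-supported x′∉)))))))
              (solve 3 (λ n a b → n :* # 0 :+ # 1 :* :∣ # 0 , # 0 ∣² :- # 2 :* (a :* # 0 :+ b :* # 0) := # 0)
                ∣ φ₂ x ∣² (re (φ₂ x)) (im (φ₂ x))))
        ... | no x∉ | yes x′∈ = sym (trans (+-cong (+-congʳ (*-congʳ (∣∣²-cong (φ₂-supported x∉))))
                (-‿cong (*-congˡ (+-cong (*-congʳ (proj₁ (φ₂-supported x∉))) (*-congʳ (proj₂ (φ₂-supported x∉)))))))
              (solve 3 (λ n a b → :∣ # 0 , # 0 ∣² :* # 1 :+ # 0 :* n :- # 2 :* (# 0 :* a :+ # 0 :* b) := # 0)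
                ∣ φ₂ x′ ∣² (re (φ₂ x′)) (im (φ₂ x′))))
        ... | no x∉ | no x′∉ = sym (trans (+-congˡ
                (-‿cong (*-congˡ (+-cong (*-congʳ (proj₁ (φ₂-supported x∉))) (*-congʳ (proj₂ (φ₂-supported x∉)))))))
              (solve 4 (λ m n a b → m :* # 0 :+ # 0 :* n :- # 2 :* (# 0 :* a :+ # 0 :* b) := # 0)
                ∣ φ₂ x ∣² ∣ φ₂ x′ ∣² (re (φ₂ x′)) (im (φ₂ x′))))

        -- On Σ′ the difference φ - φ₂ is constant, so φ may be replaced by φ₂. Its cross terms
        -- average to 0 because φ₂ has mean 0, and each of the two squares is averaged against the
        -- indicator of Σ′ in the other variable.
        influence≈ : effectiveInfluence μ Σ′ φ ≈ num 2 * (σ * N)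
        influence≈ = begin
          effectiveInfluence μ Σ′ φ
            ≈⟨ 𝔼-cong mx (λ x → 𝔼-cong mx (pointwise x)) ⟩
          (𝔼 mx λ x → 𝔼 mx λ x′ → ∣ φ₂ x ∣² * inside x′ + inside x * ∣ φ₂ x′ ∣² - num 2 * cross x x′)
            ≈⟨ 𝔼-cong mx (λ x → trans (𝔼-sub mx _ _) (+-cong (trans (𝔼-+ mx _ _) (+-cong (𝔼-*ˡ mx _ _) (𝔼-*ˡ mx _ _))) (-‿cong (no-cross x)))) ⟩
          (𝔼 mx λ x → ∣ φ₂ x ∣² * σ + inside x * N - 0#)
            ≈⟨ 𝔼-cong mx (λ x → solve 4 (λ n s i m → n :* s :+ i :* m :- # 0 := s :* n :+ m :* i) ∣ φ₂ x ∣² σ (inside x) N) ⟩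
          (𝔼 mx λ x → σ * ∣ φ₂ x ∣² + N * inside x)
            ≈⟨ trans (𝔼-+ mx _ _) (+-cong (𝔼-*ˡ mx _ _) (𝔼-*ˡ mx _ _)) ⟩
          σ * N + N * σ
            ≈⟨ solve 2 (λ s n → s :* n :+ n :* s := # 2 :* (s :* n)) σ N ⟩
          num 2 * (σ * N) ∎
          where
          open ≈-Reasoning
          no-cross : ∀ x → 𝔼 mx (λ x′ → num 2 * cross x x′) ≈ 0#
          no-cross x = begin
            𝔼 mx (λ x′ → num 2 * cross x x′)
              ≈⟨ trans (𝔼-*ˡ mx _ _) (*-congˡ (trans (𝔼-+ mx _ _) (+-cong (𝔼-*ˡ mx _ _) (𝔼-*ˡ mx _ _)))) ⟩
            num 2 * (re (φ₂ x) * 𝔼 mx (λ x′ → re (φ₂ x′)) + im (φ₂ x) * 𝔼 mx (λ x′ → im (φ₂ x′)))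
              ≈⟨ *-congˡ (+-cong (*-congˡ (trans (sym (re-𝔼ᶜ mx φ₂)) (proj₁ φ₂-mean))) (*-congˡ (trans (sym (im-𝔼ᶜ mx φ₂)) (proj₂ φ₂-mean)))) ⟩
            num 2 * (re (φ₂ x) * 0# + im (φ₂ x) * 0#)
              ≈⟨ solve 2 (λ a b → # 2 :* (a :* # 0 :+ b :* # 0) := # 0) (re (φ₂ x)) (im (φ₂ x)) ⟩
            0# ∎

        -- As soon as Σ′ meets the support of the marginal, σ ≥ 1 / A; off Σ′ the function φ₂
        -- vanishes.
        N≤AσN : N ≤ A * (σ * N)
        N≤AσN = begin
          N                                      ≤⟨ 𝔼-mono-≤ mx mx≥0 (λ x x∈ → enlarge x x∈) ⟩
          𝔼 mx (λ x → A * σ * ∣ φ₂ x ∣²)        ≈⟨ 𝔼-*ˡ mx _ _ ⟩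
          A * σ * N                              ≈⟨ *-assoc _ _ _ ⟩
          A * (σ * N)                            ∎
          where
          open ≤-Reasoning
          0≤σ : 0# ≤ σ
          0≤σ = 𝔼-nonNeg mx mx≥0 λ x _ → 0≤inside x
          w≤σ : ∀ {x} → x ∈ Σ′ → weight mx x ≤ σ
          w≤σ {x} x∈ = ≤-respˡ-≈ (at x∈) (weighted≤𝔼 mx mx≥0 (λ x _ → 0≤inside x) (∈-allFin x))
            where
            at : x ∈ Σ′ → weight mx x * inside x ≈ weight mx x
            at x∈ with x ∈? Σ′
            ... | yes _  = *-identityʳ _
            ... | no x∉ = ⊥-elim (x∉ x∈)
          enlarge : ∀ x → supp mx x → ∣ φ₂ x ∣² ≤ A * σ * ∣ φ₂ x ∣²
          enlarge x x∈supp with x ∈? Σ′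
          ... | no x∉ = ≤-trans (≤-reflexive (trans (∣∣²-cong (φ₂-supported x∉)) ∣0∣²)) ((0≤A ⊠ 0≤σ) ⊠ ∣∣²-nonNeg (φ₂ x))
          ... | yes x∈ = ≤-on-suppˣ μ≥0 x∈supp λ y z ω∈ → ≤-respˡ-≈ (*-identityˡ _) (*-monoʳ-≤ (∣∣²-nonNeg (φ₂ x))
                (≤-trans (1≤Aμ _ ω∈) (*-monoˡ-≤ 0≤A (≤-trans (μ≤marginalˣ μ≥0 x y z) (w≤σ x∈)))))

        N≈ : N ≈ ∑ indices (λ b → fromℕ (degree b) * ∣ a b ∣²)
        N≈ = trans (parseval c) (∑-cong (λ b → weigh (splitAt k₁ b) (a b)) indices)
          where
          weigh : ∀ u z → ∣ ι (fromℕ ([ const 0 , const 1 ]′ u)) *ᶜ z ∣² ≈ fromℕ ([ const 0 , const 1 ]′ u) * ∣ z ∣²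
          weigh (inj₁ i) z = trans (∣∣²-cong (ι0* z)) (trans ∣0∣² (sym (zeroˡ ∣ z ∣²)))
          weigh (inj₂ j) z = trans (∣∣²-cong (ι1* z)) (sym (trans (*-congʳ (+-identityʳ 1#)) (*-identityˡ ∣ z ∣²)))

      influence-of-expansion : num 2 * ∑ indices (λ b → fromℕ (degree b) * ∣ a b ∣²) ≤ A * effectiveInfluence μ Σ′ (expansion a)
      influence-of-expansion = begin
        num 2 * ∑ indices (λ b → fromℕ (degree b) * ∣ a b ∣²)     ≈⟨ *-congˡ N≈ ⟨
        num 2 * N                                                 ≤⟨ *-monoˡ-≤ (0≤num 2) N≤AσN ⟩
        num 2 * (A * (σ * N))                                     ≈⟨ solve 3 (λ a s n → # 2 :* (a :* (s :* n)) := a :* (# 2 :* (s :* n))) A σ N ⟩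
        A * (num 2 * (σ * N))                                     ≈⟨ *-congˡ influence≈ ⟨
        A * effectiveInfluence μ Σ′ (expansion a)                 ∎
        where open ≤-Reasoning

-- Fourier weights of high effective degree

module FourierWeights (ℛ : CompleteOrderedField) where
  open Theory ℛ hiding (zero)
  open RealFieldProperties ℛ
  open ComplexProperties ℛ
  open ExpectationProperties ℛ
  open BilinearForms ℛ
  open OneCoordinate ℛ
  open TensorPowers ℛ
  open EffectiveBasisProperties ℛ

  sum-insertAt : ∀ {n} (v : Vec ℕ n) i m → Vec.sum (insertAt v i m) ≡ m ℕ.+ Vec.sum v
  sum-insertAt v           zero    m = ≡.refl
  sum-insertAt (x Vec.∷ v) (suc i) m = ≡.trans (≡.cong (x ℕ.+_) (sum-insertAt v i m))
    (≡.trans (≡.sym (ℕ.+-assoc x m (Vec.sum v))) (≡.trans (≡.cong (ℕ._+ Vec.sum v) (ℕ.+-comm x m)) (ℕ.+-assoc m x (Vec.sum v))))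

  module Weights {s g p} (μ : Fin s × Fin g × Fin p → ℝ) (Σ′ : Subset s) (T : Fin s × Fin g × Fin p → ℂ)
    (μ≥0 : NonNegative (dist μ)) (total : ∑ (points (dist μ)) μ ≈ 1#)
    (∣T∣²≤1 : ∀ ω → supp (dist μ) ω → ∣ T ω ∣² ≤ 1#)
    (product : ∀ y z → weight (marginalʸᶻ μ) (y , z) ≈ weight (marginalʸ μ) y * weight (marginalᶻ μ) z)
    (A : ℝ) (1≤A : 1# ≤ A) (1≤Aμ : ∀ ω → supp (dist μ) ω → 1# ≤ A * μ ω)
    (basis : EffectiveBasis μ Σ′) where

    open EffectiveBasis basis
    open Marginals μ
    open Pairs μ μ≥0 Σ′
    open Setting μ Σ′ T μ≥0 total ∣T∣²≤1 product A 1≤A 1≤Aμ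
    open OrthonormalBasis μ μ≥0 total Σ′ basis A (≤-trans 0≤1 1≤A) 1≤Aμ
    open Correlation μ T

    private
      mx : Weighted (Fin s)
      mx = marginalˣ μ

    effdeg-insertAt : ∀ {n} (χ : Vec Index n) i b → effdeg (insertAt χ i b) ≡ degree b ℕ.+ effdeg χ
    effdeg-insertAt χ i b = ≡.trans (≡.cong Vec.sum (map-insertAt degree b χ i)) (sum-insertAt (Vec.map degree χ) i (degree b))

    effdeg≈∑degree : ∀ {n} (χ : Vec Index n) → fromℕ (effdeg χ) ≈ ∑ (allFin n) (λ i → fromℕ (degree (lookup χ i)))
    effdeg≈∑degree Vec.[]                = refl
    effdeg≈∑degree {suc n} (b Vec.∷ χ) = trans (×-homo-+ 1# (degree b) (effdeg χ)) (trans (+-congˡ (effdeg≈∑degree χ))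
      (sym (∑-allFin-suc n (λ i → fromℕ (degree (lookup (b Vec.∷ χ) i))))))

    degree≤1 : ∀ b → degree b ℕ.≤ 1
    degree≤1 b = at (splitAt k₁ b)
      where
      at : ∀ (u : Fin k₁ ⊎ Fin k₂) → [ const 0 , const 1 ]′ u ℕ.≤ 1
      at (inj₁ i) = ℕ.z≤n
      at (inj₂ j) = ℕ.≤-refl

    effdeg≤n : ∀ {n} (χ : Vec Index n) → effdeg χ ℕ.≤ n
    effdeg≤n Vec.[]      = ℕ.z≤n
    effdeg≤n (b Vec.∷ χ) = ℕ.+-mono-≤ (degree≤1 b) (effdeg≤n χ)

    character-slice : ∀ {n} (χ : Vec Index n) i b (x : Vec (Fin s) n) a →
      character (insertAt χ i b) (insertAt x i a) ≈ᶜ B b a *ᶜ character χ x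
    character-slice χ i b x a = ℂ∑.∏-insertAt₂ χ x i b a B

    -- Induction on the number of coordinates: the sum is an expansion in the last n variables whose
    -- coefficients are one-variable expansions in the first.
    parseval^ : ∀ n (a : Vec Index n → ℂ) →
      𝔼 (mx ^⊗ n) (λ x → ∣ ∑ᶜ (words indices n) (λ χ → a χ *ᶜ character χ x) ∣²) ≈ ‖ a ‖²⟨ words indices n ⟩
    parseval^ zero a = solve 2 (λ r i → # 1 :* :∣ (r , i) :*ᶜ (# 1 , # 0) :+ᶜ (# 0 , # 0) ∣² :+ # 0
        := :∣ r , i ∣² :+ # 0) (re (a Vec.[])) (im (a Vec.[]))
    parseval^ (suc n) a = begin
      𝔼 (mx ^⊗ suc n) (λ x → ∣ ∑ᶜ (words indices (suc n)) (λ χ → a χ *ᶜ character χ x) ∣²)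
        ≈⟨ 𝔼-slice mx zero _ ⟩
      𝔼 mx (λ x₀ → 𝔼 (mx ^⊗ n) (λ x → ∣ ∑ᶜ (words indices (suc n)) (λ χ → a χ *ᶜ character χ (x₀ Vec.∷ x)) ∣²))
        ≈⟨ 𝔼-cong mx (λ x₀ → 𝔼-cong (mx ^⊗ n) (λ x → ∣∣²-cong (peel x₀ x))) ⟩
      𝔼 mx (λ x₀ → 𝔼 (mx ^⊗ n) (λ x → ∣ ∑ᶜ (words indices n) (λ χ → expansion (λ b → a (b Vec.∷ χ)) x₀ *ᶜ character χ x) ∣²))
        ≈⟨ 𝔼-cong mx (λ x₀ → parseval^ n (λ χ → expansion (λ b → a (b Vec.∷ χ)) x₀)) ⟩
      𝔼 mx (λ x₀ → ∑ (words indices n) (λ χ → ∣ expansion (λ b → a (b Vec.∷ χ)) x₀ ∣²))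
        ≈⟨ 𝔼-∑ mx (words indices n) _ ⟩
      ∑ (words indices n) (λ χ → 𝔼 mx (λ x₀ → ∣ expansion (λ b → a (b Vec.∷ χ)) x₀ ∣²))
        ≈⟨ ∑-cong (λ χ → parseval (λ b → a (b Vec.∷ χ))) (words indices n) ⟩
      ∑ (words indices n) (λ χ → ∑ indices (λ b → ∣ a (b Vec.∷ χ) ∣²))
        ≈⟨ trans (∑-swap (words indices n) indices _) (sym (∑-words-suc indices n _ zero)) ⟩
      ‖ a ‖²⟨ words indices (suc n) ⟩ ∎
      where
      open ≈-Reasoning
      peel : ∀ x₀ x → ∑ᶜ (words indices (suc n)) (λ χ → a χ *ᶜ character χ (x₀ Vec.∷ x)) ≈ᶜ
                       ∑ᶜ (words indices n) (λ χ → expansion (λ b → a (b Vec.∷ χ)) x₀ *ᶜ character χ x)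
      peel x₀ x = ℂᴿ.trans (ℂ∑.∑-words-suc indices n (λ χ → a χ *ᶜ character χ (x₀ Vec.∷ x)) zero)
        (ℂᴿ.trans (ℂ∑.∑-swap indices (words indices n) (λ b χ → a (b Vec.∷ χ) *ᶜ character (b Vec.∷ χ) (x₀ Vec.∷ x)))
          (ℂ∑.∑-cong (λ χ → ℂᴿ.trans
            (ℂ∑.∑-cong (λ b → ℂᴿ.sym (ℂᴿ.*-assoc (a (b Vec.∷ χ)) (B b x₀) (character χ x))) indices)
            (ℂᴿ.sym (ℂ∑.*-distribʳ-∑ (character χ x) indices (λ b → a (b Vec.∷ χ) *ᶜ B b x₀)))) (words indices n)))

    Λ : ∀ n → Vec Index n → (Vec (Fin g) n → ℂ) → (Vec (Fin p) n → ℂ) → ℂ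
    Λ n χ G H = correlation μ T n (character χ) G H

    Λ-slice : ∀ n i χ b G H → Λ (suc n) (insertAt χ i b) G H ≈ᶜ
      𝔼ᶜ (dist μ) (λ (x , y , z) → T (x , y , z) *ᶜ (B b x *ᶜ Λ n χ (slice i y G) (slice i z H)))
    Λ-slice n i χ b G H = ℂᴿ.trans (correlation-slice n i (character (insertAt χ i b)) G H)
      (𝔼ᶜ-cong (dist μ) λ (x , y , z) → ℂᴿ.*-congˡ {T (x , y , z)} (ℂᴿ.trans
        (correlation-congˣ n {slice i x (character (insertAt χ i b))} {λ w → B b x *ᶜ character χ w}
          (λ w → character-slice χ i b w x) (slice i y G) (slice i z H))
        (correlation-*ˣ n (B b x) (character χ) (slice i y G) (slice i z H))))

    -- The restriction of the degree is a factor 0 or 1 and not a smaller list of characters, so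
    -- that all sums run over the same words and can be sliced at any coordinate.
    ind : ∀ {n} → ℕ → Vec Index n → ℂ
    ind k χ = if does (k ℕ.≤? effdeg χ) then 1ᶜ else 0ᶜ

    ind≡1 : ∀ {n k} {χ : Vec Index n} → k ℕ.≤ effdeg χ → ind k χ ≡ 1ᶜ
    ind≡1 {k = k} {χ} k≤ = ≡.cong (λ b → if b then 1ᶜ else 0ᶜ) (dec-true (k ℕ.≤? effdeg χ) k≤)

    ind-cases : ∀ {n} k (χ : Vec Index n) → ind k χ ≡ 0ᶜ ⊎ (ind k χ ≡ 1ᶜ × k ℕ.≤ effdeg χ)
    ind-cases k χ = at (k ℕ.≤? effdeg χ)
      where
      at : Dec (k ℕ.≤ effdeg χ) → ind k χ ≡ 0ᶜ ⊎ (ind k χ ≡ 1ᶜ × k ℕ.≤ effdeg χ)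
      at (yes k≤) = inj₂ (ind≡1 {χ = χ} k≤ , k≤)
      at (no  k≰) = inj₁ (≡.cong (λ b → if b then 1ᶜ else 0ᶜ) (dec-false (k ℕ.≤? effdeg χ) k≰))

    family : ∀ n → ℕ → BilinearFamily (Vec Index n) (Vec (Fin g) n) (Vec (Fin p) n)
    family n k = record
      { L       = λ χ G H → ind k χ *ᶜ Λ n χ G H
      ; linearˡ = λ χ ω G G′ H → ℂᴿ.trans (ℂᴿ.*-congˡ {ind k χ} (correlation-linearʸ n ω (character χ) G G′ H))
          (spread (ind k χ) (Λ n χ G H) ω (Λ n χ G′ H))
      ; linearʳ = λ χ ω G H H′ → ℂᴿ.trans (ℂᴿ.*-congˡ {ind k χ} (correlation-linearᶻ n ω (character χ) G H H′))
          (spread (ind k χ) (Λ n χ G H) ω (Λ n χ G H′)) }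
      where
      spread : ∀ c u ω v → c *ᶜ (u +ᶜ ω *ᶜ v) ≈ᶜ c *ᶜ u +ᶜ ω *ᶜ (c *ᶜ v)
      spread = solveᶜ 4 (λ c u ω v → c ⊗ (u ⊕ ω ⊗ v) ⊜ c ⊗ u ⊕ ω ⊗ (c ⊗ v))

    -- `D` bounds a sum of squares and so stands for δ² of the overview. It is uniform in `G` and
    -- `H`, which allows its application to their slices.
    HighDegreeBound : ℕ → ℕ → ℝ → Set
    HighDegreeBound n k D = Defect.Bounded (words indices n) (marginalʸ μ ^⊗ n) (marginalᶻ μ ^⊗ n) (family n k) D

    ν : ∀ n → Weighted (Vec (Fin g) n)
    ν n = marginalʸ μ ^⊗ n
    ξ : ∀ n → Weighted (Vec (Fin p) n)
    ξ n = marginalᶻ μ ^⊗ n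
    ν≥0 : ∀ n → NonNegative (ν n)
    ν≥0 = ^⊗-nonNeg (marginalʸ μ) (marginalʸ-nonNeg μ≥0)
    ξ≥0 : ∀ n → NonNegative (ξ n)
    ξ≥0 = ^⊗-nonNeg (marginalᶻ μ) (marginalᶻ-nonNeg μ≥0)

    norms : ∀ n → (Vec (Fin g) n → ℂ) → (Vec (Fin p) n → ℂ) → ℝ
    norms n G H = 𝔼 (ν n) (λ w → ∣ G w ∣²) * 𝔼 (ξ n) (λ w → ∣ H w ∣²)

    norms-nonNeg : ∀ n G H → 0# ≤ norms n G H
    norms-nonNeg n G H = 𝔼-nonNeg (ν n) (ν≥0 n) (λ w _ → ∣∣²-nonNeg (G w)) ⊠ 𝔼-nonNeg (ξ n) (ξ≥0 n) (λ w _ → ∣∣²-nonNeg (H w))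

    -- Deleting one letter of a character lowers its effective degree by at most 1, hence the bound
    -- for n coordinates is used from `k ∸ 1` on; truncation makes this right for k = 0 too.
    module Peel (n k : ℕ) (D : ℝ) (0≤D : 0# ≤ D) (bounded : HighDegreeBound n (k ℕ.∸ 1) D)
      (G : Vec (Fin g) (suc n) → ℂ) (H : Vec (Fin p) (suc n) → ℂ) where

      S D′ : ℝ
      S  = ∑ (words indices (suc n)) (λ χ → ∣ ind k χ *ᶜ Λ (suc n) χ G H ∣²)
      D′ = D * norms (suc n) G H

      -- The dual vector of (ind k χ · Λ χ)_χ, in coefficients.
      a : Vec Index (suc n) → ℂ
      a χ = ind k χ *ᶜ conj (Λ (suc n) χ G H)

      X : List (Vec Index n)
      X = words indices n

      -- The Fourier coefficients, in the remaining coordinates, of the function Σ a(χ) χ after its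
      -- coordinate `i` has been fixed to `x`.
      f : Fin (suc n) → Fin s → Vec Index n → ℂ
      f i x χ = expansion (λ b → a (insertAt χ i b)) x

      ∣a∣² : ∀ χ → ∣ a χ ∣² ≈ ∣ ind k χ *ᶜ Λ (suc n) χ G H ∣²
      ∣a∣² χ = trans (∣∣²-* (ind k χ) (conj (Λ (suc n) χ G H)))
        (trans (*-congˡ (∣∣²-conj (Λ (suc n) χ G H))) (sym (∣∣²-* (ind k χ) (Λ (suc n) χ G H))))

      module _ (i : Fin (suc n)) where

        by-slices : ∀ (h : Vec Index (suc n) → ℝ) → ∑ X (λ χ → ∑ indices (λ b → h (insertAt χ i b))) ≈ ∑ (words indices (suc n)) h
        by-slices h = trans (∑-swap X indices _) (sym (∑-words-suc indices n h i))

        𝔼‖f‖²≈S : 𝔼 mx (λ x → ‖ f i x ‖²⟨ X ⟩) ≈ S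
        𝔼‖f‖²≈S = begin
          𝔼 mx (λ x → ‖ f i x ‖²⟨ X ⟩)                                           ≈⟨ 𝔼-∑ mx X _ ⟩
          ∑ X (λ χ → 𝔼 mx (λ x → ∣ f i x χ ∣²))                                  ≈⟨ ∑-cong (λ χ → parseval (λ b → a (insertAt χ i b))) X ⟩
          ∑ X (λ χ → ∑ indices (λ b → ∣ a (insertAt χ i b) ∣²))                   ≈⟨ by-slices _ ⟩
          ∑ (words indices (suc n)) (λ χ → ∣ a χ ∣²)                              ≈⟨ ∑-cong ∣a∣² (words indices (suc n)) ⟩
          S ∎
          where open ≈-Reasoning

        -- The second cut-off comes from the bound for n coordinates and removes nothing: where the
        -- first is 1, the shortened character has degree at least `k ∸ 1`.
        cut : ∀ χ b → re (a (insertAt χ i b) *ᶜ ind (k ℕ.∸ 1) χ *ᶜ Λ (suc n) (insertAt χ i b) G H) ≈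
                      ∣ ind k (insertAt χ i b) *ᶜ Λ (suc n) (insertAt χ i b) G H ∣²
        cut χ b = truncate (Λ (suc n) (insertAt χ i b) G H) (cases (ind-cases k (insertAt χ i b)))
          where
          truncate : ∀ {c c′} z → c ≡ 0ᶜ ⊎ (c ≡ 1ᶜ × c′ ≡ 1ᶜ) → re ((c *ᶜ conj z) *ᶜ c′ *ᶜ z) ≈ ∣ c *ᶜ z ∣²
          truncate {c′ = c′} z (inj₁ ≡.refl) = solve 4 (λ c d e f → let 𝟘 = # 0 , # 0 in
            proj₁ ((𝟘 :*ᶜ :conj (e , f)) :*ᶜ (c , d) :*ᶜ (e , f)) := :∣ 𝟘 :*ᶜ (e , f) ∣²) (re c′) (im c′) (re z) (im z)
          truncate z (inj₂ (≡.refl , ≡.refl)) = solve 2 (λ e f → let 𝟙 = # 1 , # 0 in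
            proj₁ ((𝟙 :*ᶜ :conj (e , f)) :*ᶜ 𝟙 :*ᶜ (e , f)) := :∣ 𝟙 :*ᶜ (e , f) ∣²) (re z) (im z)
          cases : ind k (insertAt χ i b) ≡ 0ᶜ ⊎ (ind k (insertAt χ i b) ≡ 1ᶜ × k ℕ.≤ effdeg (insertAt χ i b)) →
                  ind k (insertAt χ i b) ≡ 0ᶜ ⊎ (ind k (insertAt χ i b) ≡ 1ᶜ × ind (k ℕ.∸ 1) χ ≡ 1ᶜ)
          cases (inj₁ eq)        = inj₁ eq
          cases (inj₂ (eq , k≤)) = inj₂ (eq , ind≡1 {χ = χ} (ℕ.∸-monoˡ-≤ 1
            (ℕ.≤-trans k≤ (ℕ.≤-trans (ℕ.≤-reflexive (effdeg-insertAt χ i b)) (ℕ.+-monoˡ-≤ (effdeg χ) (degree≤1 b))))))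

        -- By linearity the correlations of the slices reassemble into those of characters of n + 1
        -- letters, each of which then meets its own conjugate in `a`.
        pairing≈S : 𝔼 (dist μ) (λ (x , y , z) → ∑ X (λ χ → re (T (x , y , z) *ᶜ
          (f i x χ *ᶜ (ind (k ℕ.∸ 1) χ *ᶜ Λ n χ (slice i y G) (slice i z H)))))) ≈ S
        pairing≈S = begin
          𝔼 (dist μ) (λ t → ∑ X (λ χ → re (term χ t)))
            ≈⟨ 𝔼-∑ (dist μ) X (λ χ t → re (term χ t)) ⟩
          ∑ X (λ χ → 𝔼 (dist μ) (λ t → re (term χ t)))
            ≈⟨ ∑-cong (λ χ → trans (sym (re-𝔼ᶜ (dist μ) (term χ))) (proj₁ (expand χ))) X ⟩
          ∑ X (λ χ → re (∑ᶜ indices (λ b → a (insertAt χ i b) *ᶜ ind (k ℕ.∸ 1) χ *ᶜ Λ (suc n) (insertAt χ i b) G H)))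
            ≈⟨ ∑-cong (λ χ → trans (re-∑ᶜ indices _) (∑-cong (cut χ) indices)) X ⟩
          ∑ X (λ χ → ∑ indices (λ b → ∣ ind k (insertAt χ i b) *ᶜ Λ (suc n) (insertAt χ i b) G H ∣²))
            ≈⟨ by-slices _ ⟩
          S ∎
          where
          open ≈-Reasoning
          module R = ℂ-Reasoning
          Λ′ : Vec Index n → Fin s × Fin g × Fin p → ℂ
          Λ′ χ (x , y , z) = Λ n χ (slice i y G) (slice i z H)
          term : Vec Index n → Fin s × Fin g × Fin p → ℂ
          term χ t = T t *ᶜ (f i (proj₁ t) χ *ᶜ (ind (k ℕ.∸ 1) χ *ᶜ Λ′ χ t))
          piece : Vec Index n → Index → Fin s × Fin g × Fin p → ℂ
          piece χ b t = T t *ᶜ (B b (proj₁ t) *ᶜ Λ′ χ t)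
          coefficient : Vec Index n → Index → ℂ
          coefficient χ b = a (insertAt χ i b) *ᶜ ind (k ℕ.∸ 1) χ
          expand : ∀ χ → 𝔼ᶜ (dist μ) (term χ) ≈ᶜ ∑ᶜ indices (λ b → coefficient χ b *ᶜ Λ (suc n) (insertAt χ i b) G H)
          expand χ = R.begin
            𝔼ᶜ (dist μ) (term χ)
              R.≈⟨ 𝔼ᶜ-cong (dist μ) (λ t → ℂᴿ.trans
                     (solveᶜ 4 (λ t e c l → t ⊗ (e ⊗ (c ⊗ l)) ⊜ e ⊗ (t ⊗ (c ⊗ l))) (T t) (f i (proj₁ t) χ) (ind (k ℕ.∸ 1) χ) (Λ′ χ t))
                     (ℂᴿ.trans (ℂ∑.*-distribʳ-∑ (T t *ᶜ (ind (k ℕ.∸ 1) χ *ᶜ Λ′ χ t)) indices (λ b → a (insertAt χ i b) *ᶜ B b (proj₁ t)))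
                       (ℂ∑.∑-cong (λ b → solveᶜ 5 (λ a v t c l → a ⊗ v ⊗ (t ⊗ (c ⊗ l)) ⊜ a ⊗ c ⊗ (t ⊗ (v ⊗ l)))
                         (a (insertAt χ i b)) (B b (proj₁ t)) (T t) (ind (k ℕ.∸ 1) χ) (Λ′ χ t)) indices))) ⟩
            𝔼ᶜ (dist μ) (λ t → ∑ᶜ indices (λ b → coefficient χ b *ᶜ piece χ b t))
              R.≈⟨ 𝔼ᶜ-∑ (dist μ) indices (λ b t → coefficient χ b *ᶜ piece χ b t) ⟩
            ∑ᶜ indices (λ b → 𝔼ᶜ (dist μ) (λ t → coefficient χ b *ᶜ piece χ b t))
              R.≈⟨ ℂ∑.∑-cong (λ b → ℂᴿ.trans (𝔼ᶜ-*ˡ (dist μ) (coefficient χ b) (piece χ b))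
                     (ℂᴿ.*-congˡ {coefficient χ b} (ℂᴿ.sym (Λ-slice n i χ b G H)))) indices ⟩
            ∑ᶜ indices (λ b → coefficient χ b *ᶜ Λ (suc n) (insertAt χ i b) G H) R.∎

        D′≈ : D * (𝔼 (marginalʸ μ) (λ y → 𝔼 (ν n) (λ w → ∣ slice i y G w ∣²)) * 𝔼 (marginalᶻ μ) (λ z → 𝔼 (ξ n) (λ w → ∣ slice i z H w ∣²))) ≈ D′
        D′≈ = *-congˡ (*-cong (sym (𝔼-slice (marginalʸ μ) i _)) (sym (𝔼-slice (marginalᶻ μ) i _)))

        module SlicesAt = Slices X (ν n) (ξ n) (family n (k ℕ.∸ 1)) D 0≤D (ν≥0 n) (ξ≥0 n) bounded
          (λ y → slice i y G) (λ z → slice i z H) (f i) S D′ 𝔼‖f‖²≈S pairing≈S D′≈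

        -- Up to the factor `A`, the weight of the characters that are in `B₂` at `i` is bounded by
        -- influence. This is applied to every component of `f i`, and the influences of the
        -- components add up to the averaged squared distance.
        influences : num 2 * ∑ (words indices (suc n)) (λ χ → fromℕ (degree (lookup χ i)) * ∣ a χ ∣²)
                     ≤ A * pairs (λ x x′ → ‖ (λ χ → f i x χ -ᶜ f i x′ χ) ‖²⟨ X ⟩)
        influences = begin
          num 2 * ∑ (words indices (suc n)) (λ χ → fromℕ (degree (lookup χ i)) * ∣ a χ ∣²)
            ≈⟨ *-congˡ (by-slices _) ⟨
          num 2 * ∑ X (λ χ → ∑ indices (λ b → fromℕ (degree (lookup (insertAt χ i b) i)) * ∣ a (insertAt χ i b) ∣²))
            ≈⟨ *-distribˡ-∑ (num 2) X _ ⟩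
          ∑ X (λ χ → num 2 * ∑ indices (λ b → fromℕ (degree (lookup (insertAt χ i b) i)) * ∣ a (insertAt χ i b) ∣²))
            ≈⟨ ∑-cong (λ χ → *-congˡ (∑-cong (λ b → *-congʳ (reflexive (≡.cong (λ b → fromℕ (degree b)) (insertAt-lookup χ i b)))) indices)) X ⟩
          ∑ X (λ χ → num 2 * ∑ indices (λ b → fromℕ (degree b) * ∣ a (insertAt χ i b) ∣²))
            ≤⟨ ∑-mono-≤ (λ χ → influence-of-expansion (λ b → a (insertAt χ i b))) X ⟩
          ∑ X (λ χ → A * effectiveInfluence μ Σ′ (λ x → f i x χ))
            ≈⟨ *-distribˡ-∑ A X _ ⟨
          A * ∑ X (λ χ → effectiveInfluence μ Σ′ (λ x → f i x χ))
            ≈⟨ *-congˡ (trans (𝔼-cong mx (λ x → trans (𝔼-cong mx (λ x′ → restrict-∑ (both x x′) _)) (𝔼-∑ mx X _))) (𝔼-∑ mx X _)) ⟨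
          A * pairs (λ x x′ → ‖ (λ χ → f i x χ -ᶜ f i x′ χ) ‖²⟨ X ⟩) ∎
          where
          open ≤-Reasoning
          restrict-∑ : ∀ b (h : Vec Index n → ℝ) → (if b then ∑ X h else 0#) ≈ ∑ X (λ χ → if b then h χ else 0#)
          restrict-∑ true  h = refl
          restrict-∑ false h = sym (∑-zero (λ _ → refl) X)

      S≤D′ : S ≤ D′
      S≤D′ = SlicesAt.S≤D′ zero

      -- Summed over all coordinates, a character is counted as often as its effective degree says,
      -- thus at least `k` times wherever its coefficient is nonzero.
      degree-count : ∀ {I} → (∀ i → num 2 * ∑ (words indices (suc n)) (λ χ → fromℕ (degree (lookup χ i)) * ∣ a χ ∣²) ≤ I) →
        num 2 * (fromℕ k * S) ≤ fromℕ (suc n) * I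
      degree-count {I} each = begin
        num 2 * (fromℕ k * S)
          ≈⟨ *-congˡ (trans (*-distribˡ-∑ (fromℕ k) W _) (∑-cong (λ χ → *-congˡ (sym (∣a∣² χ))) W)) ⟩
        num 2 * ∑ W (λ χ → fromℕ k * ∣ a χ ∣²)
          ≤⟨ *-monoˡ-≤ (0≤num 2) (∑-mono-≤ low W) ⟩
        num 2 * ∑ W (λ χ → fromℕ (effdeg χ) * ∣ a χ ∣²)
          ≈⟨ *-congˡ (trans (∑-cong (λ χ → trans (*-congʳ (effdeg≈∑degree χ)) (*-distribʳ-∑ ∣ a χ ∣² (allFin (suc n)) _)) W)
               (∑-swap W (allFin (suc n)) _)) ⟩
        num 2 * ∑ (allFin (suc n)) (λ i → ∑ W (λ χ → fromℕ (degree (lookup χ i)) * ∣ a χ ∣²))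
          ≈⟨ *-distribˡ-∑ (num 2) (allFin (suc n)) _ ⟩
        ∑ (allFin (suc n)) (λ i → num 2 * ∑ W (λ χ → fromℕ (degree (lookup χ i)) * ∣ a χ ∣²))
          ≤⟨ ∑-mono-≤ each (allFin (suc n)) ⟩
        ∑ (allFin (suc n)) (λ _ → I)
          ≈⟨ count (suc n) ⟩
        fromℕ (suc n) * I ∎
        where
        open ≤-Reasoning
        W : List (Vec Index (suc n))
        W = words indices (suc n)
        count : ∀ m → ∑ (allFin m) (λ _ → I) ≈ fromℕ m * I
        count zero    = sym (zeroˡ I)
        count (suc m) = trans (∑-allFin-suc m (λ _ → I)) (trans (+-congˡ (count m)) (solve 2 (λ i m → i :+ m :* i := (# 1 :+ m) :* i) I (fromℕ m)))
        low : ∀ χ → fromℕ k * ∣ a χ ∣² ≤ fromℕ (effdeg χ) * ∣ a χ ∣²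
        low χ = at (Λ (suc n) χ G H) (ind-cases k χ)
          where
          at : ∀ {c} z → c ≡ 0ᶜ ⊎ (c ≡ 1ᶜ × k ℕ.≤ effdeg χ) → fromℕ k * ∣ c *ᶜ conj z ∣² ≤ fromℕ (effdeg χ) * ∣ c *ᶜ conj z ∣²
          at {c} z (inj₂ (_ , k≤)) = *-monoʳ-≤ (∣∣²-nonNeg (c *ᶜ conj z)) (fromℕ-mono-≤ k≤)
          at z (inj₁ ≡.refl) = ≤-reflexive (solve 4 (λ k d a b → let n = :∣ (# 0 , # 0) :*ᶜ :conj (a , b) ∣² in
            k :* n := d :* n) (fromℕ k) (fromℕ (effdeg χ)) (re z) (im z))

-- Decay in the effective degree

module DegreeDecay (ℛ : CompleteOrderedField) where
  open Theory ℛ hiding (zero)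
  open RealFieldProperties ℛ
  open ComplexProperties ℛ
  open ExpectationProperties ℛ
  open OneCoordinate ℛ
  open EffectiveBasisProperties ℛ
  open FourierWeights ℛ

  module Bounds {s g p} (μ : Fin s × Fin g × Fin p → ℝ) (Σ′ : Subset s) (T : Fin s × Fin g × Fin p → ℂ)
    (μ≥0 : NonNegative (dist μ)) (total : ∑ (points (dist μ)) μ ≈ 1#)
    (∣T∣²≤1 : ∀ ω → supp (dist μ) ω → ∣ T ω ∣² ≤ 1#)
    (product : ∀ y z → weight (marginalʸᶻ μ) (y , z) ≈ weight (marginalʸ μ) y * weight (marginalᶻ μ) z)
    (A : ℝ) (1≤A : 1# ≤ A) (1≤Aμ : ∀ ω → supp (dist μ) ω → 1# ≤ A * μ ω)
    (basis : EffectiveBasis μ Σ′) where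

    open EffectiveBasis basis
    open Setting μ Σ′ T μ≥0 total ∣T∣²≤1 product A 1≤A 1≤Aμ
    open OrthonormalBasis μ μ≥0 total Σ′ basis A (≤-trans 0≤1 1≤A) 1≤Aμ using (degree)
    open Weights μ Σ′ T μ≥0 total ∣T∣²≤1 product A 1≤A 1≤Aμ basis

    bound-mono : ∀ {n k D D′} → D ≤ D′ → HighDegreeBound n k D → HighDegreeBound n k D′
    bound-mono {n} D≤D′ bounded G H = ≤-trans (bounded G H) (*-monoʳ-≤ (norms-nonNeg n G H) D≤D′)

    bound-vacuous : ∀ {n k D} → n ℕ.< k → 0# ≤ D → HighDegreeBound n k D
    bound-vacuous {n} {k} n<k 0≤D G H = ≤-trans
      (≤-reflexive (∑-zero (λ χ → vanish (ind-cases k χ) (effdeg≤n χ) (Λ n χ G H)) (words (allFin (k₁ ℕ.+ k₂)) n)))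
      (0≤D ⊠ norms-nonNeg n G H)
      where
      vanish : ∀ {c e} → c ≡ 0ᶜ ⊎ (c ≡ 1ᶜ × k ℕ.≤ e) → e ℕ.≤ n → ∀ z → ∣ c *ᶜ z ∣² ≈ 0#
      vanish (inj₁ ≡.refl) _ z = trans (∣∣²-cong (ℂᴿ.zeroˡ z)) ∣0∣²
      vanish (inj₂ (_ , k≤e)) e≤n z = ⊥-elim (ℕ.<⇒≱ n<k (ℕ.≤-trans k≤e e≤n))

    bound-peel : ∀ {n k D} → 0# ≤ D → HighDegreeBound n (k ℕ.∸ 1) D → HighDegreeBound (suc n) k D
    bound-peel {n} {k} {D} 0≤D bounded G H = Peel.S≤D′ n k D 0≤D bounded G H

    -- For no coordinates the only correlation is the product of the values of `G` and `H`. Peeling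
    -- without gain then carries the constant 1 to all n, as |T| ≤ 1.
    bound-1 : ∀ n k → HighDegreeBound n k 1#
    bound-1 zero k G H = empty (ind-cases k Vec.[]) (G Vec.[]) (H Vec.[])
      where
      empty : ∀ {c} → c ≡ 0ᶜ ⊎ (c ≡ 1ᶜ × k ℕ.≤ 0) → ∀ u v →
        ∣ c *ᶜ (1# ·ᶜ (1ᶜ *ᶜ u *ᶜ v *ᶜ 1ᶜ) +ᶜ 0ᶜ) ∣² + 0# ≤ 1# * ((1# * ∣ u ∣² + 0#) * (1# * ∣ v ∣² + 0#))
      empty (inj₁ ≡.refl) u v = ≤-via (∣∣²-nonNeg u ⊠ ∣∣²-nonNeg v)
        (solve 4 (λ a b c d → let u = a , b ; v = c , d ; 𝟘 = # 0 , # 0 ; 𝟙 = # 1 , # 0 ; w = 𝟙 :*ᶜ u :*ᶜ v :*ᶜ 𝟙 in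
          # 1 :* ((# 1 :* :∣ u ∣² :+ # 0) :* (# 1 :* :∣ v ∣² :+ # 0))
            :- (:∣ 𝟘 :*ᶜ ((# 1 :* proj₁ w , # 1 :* proj₂ w) :+ᶜ 𝟘) ∣² :+ # 0) := :∣ u ∣² :* :∣ v ∣²)
          (re u) (im u) (re v) (im v))
      empty (inj₂ (≡.refl , _)) u v = ≤-reflexive
        (solve 4 (λ a b c d → let u = a , b ; v = c , d ; 𝟘 = # 0 , # 0 ; 𝟙 = # 1 , # 0 ; w = 𝟙 :*ᶜ u :*ᶜ v :*ᶜ 𝟙 in
          :∣ 𝟙 :*ᶜ ((# 1 :* proj₁ w , # 1 :* proj₂ w) :+ᶜ 𝟘) ∣² :+ # 0
            := # 1 :* ((# 1 :* :∣ u ∣² :+ # 0) :* (# 1 :* :∣ v ∣² :+ # 0)))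
          (re u) (im u) (re v) (im v))
    bound-1 (suc n) k = bound-peel {k = k} 0≤1 (bound-1 n (k ℕ.∸ 1))

    -- ρ is the proportion d / n, ρ² c₁ the influence threshold, κ the gain of the base case at this
    -- threshold, and η the resulting gain of a peeling step. β = 1 / (2 A) absorbs the factor `A`
    -- of the influence bound.
    module _ (β c₁ ρ κ η : ℝ) (0≤β : 0# ≤ β) (2Aβ≈1 : num 2 * (A * β) ≈ 1#)
      (0≤c₁ : 0# ≤ c₁) (32A⁴c₁≤β² : num 32 * (A * A * (A * A) * c₁) ≤ β * β)
      (0≤ρ : 0# ≤ ρ) (0<κ : 0# < κ) (0≤η : 0# ≤ η) (2η≤1 : num 2 * η ≤ 1#)
      (128η≤κτ : num 128 * η ≤ κ * (ρ * ρ * c₁)) (256A²η≤ρ²β² : num 256 * (A * A * η) ≤ ρ * ρ * (β * β))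
      (base : BaseInequality (ρ * ρ * c₁) κ) where

      private
        0≤A : 0# ≤ A
        0≤A = ≤-trans 0≤1 1≤A
        0≤1-η : 0# ≤ 1# - η
        0≤1-η = *-cancelˡ-≤ (0<num 1) (≤-via (gap 2η≤1 ⊹ 0≤1)
          (solve 1 (λ e → # 2 :* (# 1 :- e) :- # 2 :* # 0 := (# 1 :- # 2 :* e) :+ # 1) η))

      -- If S exceeded (1 - η) D′, the estimate of `Gain` would hold at every coordinate, with A B′
      -- = ρ S / 2. Counting degrees gives 2 k S ≤ (n + 1) ρ S / 2 ≤ k S, which is absurd as k S >
      -- 0.
      bound-gain : ∀ {n k D} → fromℕ (suc n) * ρ ≤ num 2 * fromℕ k → 0# < fromℕ k → 0# ≤ D →
        HighDegreeBound n (k ℕ.∸ 1) D → HighDegreeBound (suc n) k ((1# - η) * D)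
      bound-gain {n} {k} {D} nρ≤2k 0<k 0≤D bounded G H =
        ≤-respʳ-≈ (sym (*-assoc _ _ _)) (by-contradiction (S ≤? (1# - η) * D′))
        where
        open Peel n k D 0≤D bounded G H
        by-contradiction : Dec (S ≤ (1# - η) * D′) → S ≤ (1# - η) * D′
        by-contradiction (yes p) = p
        by-contradiction (no ¬p) = ⊥-elim (*-pos 0<k 0<S 2kS≤0)
          where
          open ≤-Reasoning
          0≤D′ : 0# ≤ D′
          0≤D′ = 0≤D ⊠ norms-nonNeg (suc n) G H
          [1-η]D′≤S : (1# - η) * D′ ≤ S
          [1-η]D′≤S = ≰⇒≥ ¬p
          0<S : 0# < S
          0<S S≤0 = ¬p (≤-trans S≤0 (0≤1-η ⊠ 0≤D′))
          0≤S : 0# ≤ S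
          0≤S = <⇒≤ 0<S
          D′≤2S : D′ ≤ num 2 * S
          D′≤2S = ≤-via (gap [1-η]D′≤S ⊹ gap [1-η]D′≤S ⊹ gap 2η≤1 ⊠ 0≤D′)
            (solve 3 (λ e D S → # 2 :* S :- D := (S :- (# 1 :- e) :* D) :+ ((S :- (# 1 :- e) :* D) :+ (# 1 :- # 2 :* e) :* D)) η D′ S)
          B′ J : ℝ
          B′ = ρ * S * β
          J = (ρ * ρ * c₁) * ((A * D′) * (A * D′))
          -- As D′ ≤ 2 S, the right side is at least ρ² β² D′² / 4. The two summands on the left
          -- take at most 1 / 8 and 1 / 16 of ρ² β² D′², by the assumptions on c₁ and on η.
          JB : num 4 * (A * A * J + num 4 * ((A * D′) * (A * (η * D′)))) ≤ B′ * B′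
          JB = *-cancelˡ-≤ (0<num 15) (≤-via
            (((0≤num 4 ⊠ (0≤ρ ⊠ 0≤ρ) ⊠ (0≤β ⊠ 0≤β)) ⊠ (gap D′≤2S ⊠ ((0≤num 2 ⊠ 0≤S) ⊹ 0≤D′)))
              ⊹ (0≤num 2 ⊠ (0≤ρ ⊠ 0≤ρ) ⊠ (0≤D′ ⊠ 0≤D′) ⊠ gap 32A⁴c₁≤β²)
              ⊹ ((0≤D′ ⊠ 0≤D′) ⊠ gap 256A²η≤ρ²β²)
              ⊹ (0≤ρ ⊠ 0≤ρ) ⊠ (0≤β ⊠ 0≤β) ⊠ (0≤D′ ⊠ 0≤D′))
            (solve 7 (λ A b c r e D S →
               # 16 :* ((r :* S :* b) :* (r :* S :* b))
                 :- # 16 :* (# 4 :* (A :* A :* ((r :* r :* c) :* ((A :* D) :* (A :* D))) :+ # 4 :* ((A :* D) :* (A :* (e :* D)))))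
               := (# 4 :* ((r :* r) :* (b :* b))) :* ((# 2 :* S :- D) :* (# 2 :* S :+ D))
                  :+ (# 2 :* ((r :* r) :* ((D :* D) :* (b :* b :- # 32 :* (A :* A :* (A :* A) :* c))))
                  :+ ((D :* D) :* (r :* r :* (b :* b) :- # 256 :* (A :* A :* e))
                  :+ (r :* r) :* ((b :* b) :* (D :* D)))))
               A β c₁ ρ η D′ S))
          κJ : num 124 * ((A * (η * D′)) * (A * D′)) ≤ κ * J
          κJ = ≤-via ((0≤A ⊠ 0≤D′) ⊠ (0≤A ⊠ 0≤D′) ⊠ (gap 128η≤κτ ⊹ 0≤num 4 ⊠ 0≤η))
            (solve 5 (λ A κ t e D → κ :* (t :* ((A :* D) :* (A :* D))) :- # 124 :* ((A :* (e :* D)) :* (A :* D))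
               := (A :* D) :* ((A :* D) :* ((κ :* t :- # 128 :* e) :+ # 4 :* e))) A κ (ρ * ρ * c₁) η D′)
          each : ∀ i → num 2 * ∑ (words (allFin (k₁ ℕ.+ k₂)) (suc n)) (λ χ → fromℕ (degree (lookup χ i)) * ∣ a χ ∣²) ≤ A * B′
          each i = ≤-trans (influences i) (*-monoˡ-≤ 0≤A (SlicesAt.Gain.pairs‖f-f‖²≤B i κ (ρ * ρ * c₁) J (η * D′) B′
            0<κ ((0≤ρ ⊠ 0≤ρ) ⊠ 0≤c₁) ((0≤ρ ⊠ 0≤S) ⊠ 0≤β) base
            (≤-via (gap [1-η]D′≤S) (solve 3 (λ e D S → e :* D :- (D :- S) := S :- (# 1 :- e) :* D) η D′ S))
            (≤-via (0≤1-η ⊠ 0≤D′) (solve 2 (λ e D → D :- e :* D := (# 1 :- e) :* D) η D′))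
            κJ ≤-refl JB))
          2kS≤0 : fromℕ k * S ≤ 0#
          2kS≤0 = *-cancelˡ-≤ (0<num 1) (≤-via (gap twice ⊹ gap nρS≤)
            (solve 3 (λ k S x → # 2 :* # 0 :- # 2 :* (k :* S) := (x :- # 2 :* (# 2 :* (k :* S))) :+ (# 2 :* (k :* S) :- x))
              (fromℕ k) S (fromℕ (suc n) * ρ * S)))
            where
            nρS≤ : fromℕ (suc n) * ρ * S ≤ num 2 * (fromℕ k * S)
            nρS≤ = ≤-respʳ-≈ (*-assoc _ _ _) (*-monoʳ-≤ 0≤S nρ≤2k)
            twice : num 2 * (num 2 * (fromℕ k * S)) ≤ fromℕ (suc n) * ρ * S
            twice = begin
              num 2 * (num 2 * (fromℕ k * S))           ≤⟨ *-monoˡ-≤ (0≤num 2) (degree-count each) ⟩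
              num 2 * (fromℕ (suc n) * (A * B′))        ≈⟨ solve 5 (λ n A r S b → # 2 :* (n :* (A :* (r :* S :* b))) := (# 2 :* (A :* b)) :* (n :* r :* S))
                                                             (fromℕ (suc n)) A ρ S β ⟩
              num 2 * (A * β) * (fromℕ (suc n) * ρ * S) ≈⟨ *-congʳ 2Aβ≈1 ⟩
              1# * (fromℕ (suc n) * ρ * S)              ≈⟨ *-identityˡ _ ⟩
              fromℕ (suc n) * ρ * S                     ∎

      -- Each of the j peelings costs at most one degree, so that at least h + 1 ≥ d / 2
      -- degrees are left before it and it gains the factor 1 - η.
      bound-decay : ∀ {ζ d n₀ h} → num 2 * ζ ≈ η → fromℕ n₀ * ρ ≤ fromℕ d → d ℕ.≤ 2 ℕ.* suc h →
        ∀ n j k → n ℕ.≤ n₀ → h ℕ.+ j ℕ.≤ k → HighDegreeBound n k ((1# - ζ) ^ j * (1# - ζ) ^ j)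
      bound-decay {ζ} {d} {n₀} {h} 2ζ≈η n₀ρ≤d d≤2[h+1] = go
        where
        0≤1-ζ : 0# ≤ 1# - ζ
        0≤1-ζ = *-cancelˡ-≤ (0<num 1) (≤-via (0≤1-η ⊹ 0≤1)
          (trans (solve 1 (λ z → # 2 :* (# 1 :- z) :- # 2 :* # 0 := (# 1 :- # 2 :* z) :+ # 1) ζ)
                 (+-congʳ (+-congˡ (-‿cong 2ζ≈η)))))
        power-nonNeg : ∀ j → 0# ≤ (1# - ζ) ^ j * (1# - ζ) ^ j
        power-nonNeg j = ^-nonNeg 0≤1-ζ j ⊠ ^-nonNeg 0≤1-ζ j
        go : ∀ n j k → n ℕ.≤ n₀ → h ℕ.+ j ℕ.≤ k → HighDegreeBound n k ((1# - ζ) ^ j * (1# - ζ) ^ j)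
        go n       zero    k n≤ _ = bound-mono {n} {k} (≤-reflexive (sym (*-identityˡ 1#))) (bound-1 n k)
        -- Coordinates cannot run out before the gains do: k ≥ h + j + 1 > 0, and the empty
        -- character has degree 0.
        go zero    (suc j) k n≤ h+j<k = bound-vacuous {zero} {k}
          (ℕ.≤-trans (ℕ.s≤s ℕ.z≤n) (ℕ.≤-trans (ℕ.m≤n+m (suc j) h) h+j<k)) (power-nonNeg (suc j))
        go (suc n) (suc j) k n<n₀ h+j<k = bound-mono {suc n} {k} shrink
          (bound-gain {k = k} nρ≤2k 0<k (power-nonNeg j) (go n j (k ℕ.∸ 1) (ℕ.≤-trans (ℕ.n≤1+n n) n<n₀) (ℕ.∸-monoˡ-≤ 1 h+j+1≤k)))
          where
          h+j+1≤k : suc (h ℕ.+ j) ℕ.≤ k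
          h+j+1≤k = ℕ.≤-trans (ℕ.≤-reflexive (≡.sym (ℕ.+-suc h j))) h+j<k
          h+1≤k : suc h ℕ.≤ k
          h+1≤k = ℕ.≤-trans (ℕ.s≤s (ℕ.m≤m+n h j)) h+j+1≤k
          0<k : 0# < fromℕ k
          0<k = <-≤-trans (fromℕ-pos h) (fromℕ-mono-≤ h+1≤k)
          nρ≤2k : fromℕ (suc n) * ρ ≤ num 2 * fromℕ k
          nρ≤2k = begin
            fromℕ (suc n) * ρ        ≤⟨ *-monoʳ-≤ 0≤ρ (fromℕ-mono-≤ n<n₀) ⟩
            fromℕ n₀ * ρ             ≤⟨ n₀ρ≤d ⟩
            fromℕ d                  ≤⟨ fromℕ-mono-≤ (ℕ.≤-trans d≤2[h+1] (ℕ.*-monoʳ-≤ 2 h+1≤k)) ⟩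
            fromℕ (2 ℕ.* k)          ≈⟨ ×1-homo-* 2 k ⟩
            fromℕ 2 * fromℕ k        ≈⟨ *-congʳ (+-congˡ (+-identityʳ 1#)) ⟩
            num 2 * fromℕ k          ∎
            where open ≤-Reasoning
          -- (1 - ζ)² ≥ 1 - 2 ζ = 1 - η. Keeping the constant a square makes its root available when
          -- Cauchy-Schwarz is applied at the end.
          shrink : (1# - η) * ((1# - ζ) ^ j * (1# - ζ) ^ j) ≤ (1# - ζ) ^ suc j * (1# - ζ) ^ suc j
          shrink = ≤-respˡ-≈ (*-congʳ (+-congˡ (-‿cong 2ζ≈η))) (≤-via (square-nonNeg ζ ⊠ power-nonNeg j)
            (solve 2 (λ z q → ((# 1 :- z) :* q) :* ((# 1 :- z) :* q) :- (# 1 :- # 2 :* z) :* (q :* q) := (z :* z) :* (q :* q)) ζ ((1# - ζ) ^ j)))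

-- Conclusion

module Conclusion (ℛ : CompleteOrderedField) where
  open Theory ℛ hiding (zero)
  open RealFieldProperties ℛ
  open RealPowerProperties ℛ
  open ComplexProperties ℛ
  open ExpectationProperties ℛ
  open OneCoordinate ℛ
  open TensorPowers ℛ
  open EffectiveBasisProperties ℛ
  open FourierWeights ℛ
  open DegreeDecay ℛ

  module _ {Ω : Set} (μ : Weighted Ω) (μ≥0 : NonNegative μ) (f : Ω → ℂ) where

    ‖‖-nonNeg : 0# ≤ ‖ f ‖[ μ ]
    ‖‖-nonNeg = √-nonNeg (𝔼-nonNeg μ μ≥0 λ ω _ → ∣∣²-nonNeg (f ω))

    ‖‖-square : ‖ f ‖[ μ ] * ‖ f ‖[ μ ] ≈ 𝔼 μ (λ ω → ∣ f ω ∣²)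
    ‖‖-square = √-square (𝔼-nonNeg μ μ≥0 λ ω _ → ∣∣²-nonNeg (f ω))

  weights-bounded-below : ∀ {Ω} (μ : Weighted Ω) → (∀ ω → ω ∈ˡ points μ) →
    Σ[ A ∈ ℝ ] (1# ≤ A × (∀ ω → supp μ ω → 1# ≤ A * weight μ ω))
  weights-bounded-below {Ω} μ all∈ = 1# + total ,
    ≤-via 0≤total (solve 1 (λ t → # 1 :+ t :- # 1 := t) total) ,
    λ ω ω∈ → begin
      1#                                ≈⟨ ⁻¹-inverse (0<⇒≉0 ω∈) ⟨
      weight μ ω * weight μ ω ⁻¹        ≈⟨ *-comm _ _ ⟩
      weight μ ω ⁻¹ * weight μ ω        ≤⟨ *-monoʳ-≤ (<⇒≤ ω∈) (≤-trans (at ω ω∈) (≤-via 0≤1 (solve 1 (λ t → # 1 :+ t :- t := # 1) total))) ⟩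
      (1# + total) * weight μ ω         ∎
    where
    open ≤-Reasoning
    inverse : Ω → ℝ
    inverse ω = if does (weight μ ω ≤? 0#) then 0# else weight μ ω ⁻¹
    0≤inverse : ∀ ω → 0# ≤ inverse ω
    0≤inverse ω with weight μ ω ≤? 0#
    ... | yes _   = ≤-refl
    ... | no  0<w = <⇒≤ (⁻¹-pos 0<w)
    total : ℝ
    total = ∑ (points μ) inverse
    0≤total : 0# ≤ total
    0≤total = ∑-nonNeg 0≤inverse (points μ)
    inverse≈ : ∀ ω → supp μ ω → weight μ ω ⁻¹ ≤ inverse ω
    inverse≈ ω ω∈ with weight μ ω ≤? 0#
    ... | yes w≤0 = ⊥-elim (ω∈ w≤0)
    ... | no _    = ≤-refl
    at : ∀ ω → supp μ ω → weight μ ω ⁻¹ ≤ total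
    at ω ω∈ = ≤-trans (inverse≈ ω ω∈) (term≤∑ 0≤inverse (all∈ ω))

  ∏-mono-≤ : ∀ n {f h : Fin n → ℝ} → (∀ i → 0# ≤ f i) → (∀ i → f i ≤ h i) → ∏ f ≤ ∏ h
  ∏-mono-≤ zero    0≤f f≤h = ≤-refl
  ∏-mono-≤ (suc n) {f} {h} 0≤f f≤h = *-mono-≤ (0≤f zero)
    (≤-trans (∏-nonNeg n _ (λ i → 0≤f (suc i))) (∏-mono-≤ n (λ i → 0≤f (suc i)) (λ i → f≤h (suc i))))
    (f≤h zero) (∏-mono-≤ n (λ i → 0≤f (suc i)) (λ i → f≤h (suc i)))

  minimum-with-1 : ∀ x → 0# < x → Σ[ m ∈ ℝ ] (0# < m × m ≤ x × m ≤ 1#)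
  minimum-with-1 x 0<x with x ≤? 1#
  ... | yes x≤1 = x , 0<x , ≤-refl , x≤1
  ... | no  1<x = 1# , 0<1 , ≰⇒≥ 1<x , ≤-refl

  -- A reciprocal of a natural number is chosen so that ν (d / n)^K is rational, which makes its
  -- comparison with powers of 2 elementary.
  small-reciprocal : ∀ x → Σ[ Q ∈ ℕ ] Σ[ ν ∈ ℝ ] (ν * fromℕ (suc Q) ≈ 1# × 0# < ν × ν * x ≤ 1#)
  small-reciprocal x with archimedean x
  ... | Q , x≤Q = Q , fromℕ (suc Q) ⁻¹ , νQ≈1 , 0<ν ,
        ≤-respʳ-≈ νQ≈1 (*-monoˡ-≤ (<⇒≤ 0<ν) (≤-trans x≤Q (fromℕ-mono-≤ (ℕ.n≤1+n Q))))
    where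
    0<ν : 0# < fromℕ (suc Q) ⁻¹
    0<ν = ⁻¹-pos (fromℕ-pos Q)
    νQ≈1 : fromℕ (suc Q) ⁻¹ * fromℕ (suc Q) ≈ 1#
    νQ≈1 = trans (*-comm _ _) (⁻¹-inverse (0<⇒≉0 (fromℕ-pos Q)))

  reciprocal-≤ : ∀ {ν m u} → 0# < u → ν * (m * u ⁻¹) ≤ 1# → m * ν ≤ u
  reciprocal-≤ {ν} {m} {u} 0<u p = begin
    m * ν                     ≈⟨ *-identityʳ _ ⟨
    m * ν * 1#                ≈⟨ *-congˡ (⁻¹-inverse (0<⇒≉0 0<u)) ⟨
    m * ν * (u * u ⁻¹)        ≈⟨ solve 4 (λ m n u i → m :* n :* (u :* i) := u :* (n :* (m :* i))) m ν u (u ⁻¹) ⟩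
    u * (ν * (m * u ⁻¹))      ≤⟨ *-monoˡ-≤ (<⇒≤ 0<u) p ⟩
    u * 1#                    ≈⟨ *-identityʳ u ⟩
    u                         ∎
    where open ≤-Reasoning

  module _ {s g p} (μ : Fin s × Fin g × Fin p → ℝ) (Σ′ : Subset s) (T : Fin s × Fin g × Fin p → ℂ)
    (μ≥0 : NonNegative (dist μ)) (total : ∑ (points (dist μ)) μ ≈ 1#)
    (disk : DiskValuedOnSupport μ T) (relaxed : RelaxedBaseCase μ Σ′ T) where

    open Marginals μ
    open RelaxedBaseCase relaxed

    private
      mx : Weighted (Fin s)
      mx = marginalˣ μ
      mx≥0 : NonNegative mx
      mx≥0 = marginalˣ-nonNeg μ≥0

      ∣T∣²≤1 : ∀ ω → supp (dist μ) ω → ∣ T ω ∣² ≤ 1#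
      ∣T∣²≤1 ω ω∈ = ≤-respˡ-≈ (∣∣-square (T ω)) (≤-respʳ-≈ (*-identityˡ 1#)
        (*-mono-≤ (∣∣-nonNeg (T ω)) 0≤1 (disk ω ω∈) (disk ω ω∈)))

      A-data : Σ[ A ∈ ℝ ] (1# ≤ A × (∀ ω → supp (dist μ) ω → 1# ≤ A * μ ω))
      A-data = weights-bounded-below (dist μ) triple∈

      A : ℝ
      A = proj₁ A-data
      1≤A : 1# ≤ A
      1≤A = proj₁ (proj₂ A-data)
      1≤Aμ : ∀ ω → supp (dist μ) ω → 1# ≤ A * μ ω
      1≤Aμ = proj₂ (proj₂ A-data)
      0<A : 0# < A
      0<A = <-≤-trans 0<1 1≤A

      L : ℕ
      L = 100 ℕ.* M

      -- Lowering the constant of the base case to at most 1 keeps 1 - c₀ τ^L nonnegative for all τ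
      -- ≤ 1.
      c₀-data : Σ[ m ∈ ℝ ] (0# < m × m ≤ proj₁ influence-gap × m ≤ 1#)
      c₀-data = minimum-with-1 (proj₁ influence-gap) (proj₁ (proj₂ influence-gap))

      c₀ : ℝ
      c₀ = proj₁ c₀-data
      0<c₀ : 0# < c₀
      0<c₀ = proj₁ (proj₂ c₀-data)

    open Setting μ Σ′ T μ≥0 total ∣T∣²≤1 yz-product A 1≤A 1≤Aμ using (BaseInequality)

    -- With a, b, c the three norms, (1 - κ) (a - t b c)² ≥ 0 turns the bound on the correlation
    -- into one by squares; 1 - κ ≥ 0 is where τ ≤ 1 is used.
    base-inequality : ∀ τ → 0# < τ → τ ≤ 1# → BaseInequality τ (c₀ * τ ^ L)
    base-inequality τ 0<τ τ≤1 φ γ θ influential t 0≤t = begin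
      num 2 * (t * re z)
        ≤⟨ *-monoˡ-≤ (0≤num 2) (*-monoˡ-≤ 0≤t (≤-trans (re≤∣∣ z) (proj₂ (proj₂ influence-gap) τ 0<τ φ γ θ
             (≤-respˡ-≈ (*-congˡ (sym (trans (*-congˡ (*-identityʳ a)) (‖‖-square mx mx≥0 φ)))) influential)))) ⟩
      num 2 * (t * ((1# - proj₁ influence-gap * τ ^ L) * a * b * c))
        ≤⟨ ≤-via ((0≤num 2 ⊠ 0≤t) ⊠ (((gap (proj₁ (proj₂ (proj₂ c₀-data))) ⊠ 0≤τL) ⊠ 0≤a) ⊠ 0≤b) ⊠ 0≤c)
             (solve 7 (λ t c₀ c₁ τ a b c → # 2 :* (t :* ((# 1 :- c₁ :* τ) :* a :* b :* c)) :- # 2 :* (t :* ((# 1 :- c₀ :* τ) :* a :* b :* c))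
                := (# 2 :* t) :* (((((c₀ :- c₁) :* τ) :* a) :* b) :* c)) t (proj₁ influence-gap) c₀ (τ ^ L) a b c) ⟩
      num 2 * (t * ((1# - c₀ * τ ^ L) * a * b * c))
        ≤⟨ ≤-via (gap c₀τL≤1 ⊠ square-nonNeg (a - t * (b * c)))
             (solve 5 (λ k t a b c → (# 1 :- k) :* (a :* a :+ t :* t :* ((b :* b) :* (c :* c))) :- # 2 :* (t :* ((# 1 :- k) :* a :* b :* c))
                := (# 1 :- k) :* ((a :- t :* (b :* c)) :* (a :- t :* (b :* c)))) (c₀ * τ ^ L) t a b c) ⟩
      (1# - c₀ * τ ^ L) * (a * a + t * t * ((b * b) * (c * c)))
        ≈⟨ *-congˡ (+-cong (‖‖-square mx mx≥0 φ) (*-congˡ (*-cong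
             (‖‖-square (marginalʸ μ) (marginalʸ-nonNeg μ≥0) γ) (‖‖-square (marginalᶻ μ) (marginalᶻ-nonNeg μ≥0) θ)))) ⟩
      _ ∎
      where
      open ≤-Reasoning
      z : ℂ
      z = 𝔼ᶜ (dist μ) (λ (x , y , z) → φ x *ᶜ γ y *ᶜ θ z *ᶜ T (x , y , z))
      a b c : ℝ
      a = ‖ φ ‖[ mx ]
      b = ‖ γ ‖[ marginalʸ μ ]
      c = ‖ θ ‖[ marginalᶻ μ ]
      0≤a : 0# ≤ a
      0≤a = ‖‖-nonNeg mx mx≥0 φ
      0≤b : 0# ≤ b
      0≤b = ‖‖-nonNeg (marginalʸ μ) (marginalʸ-nonNeg μ≥0) γ
      0≤c : 0# ≤ c
      0≤c = ‖‖-nonNeg (marginalᶻ μ) (marginalᶻ-nonNeg μ≥0) θ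
      0≤τL : 0# ≤ τ ^ L
      0≤τL = ^-nonNeg (<⇒≤ 0<τ) L
      c₀τL≤1 : c₀ * τ ^ L ≤ 1#
      c₀τL≤1 = ≤-respʳ-≈ (*-identityˡ 1#) (*-mono-≤ (<⇒≤ 0<c₀) 0≤1 (proj₂ (proj₂ (proj₂ c₀-data))) (^≤1 (<⇒≤ 0<τ) τ≤1 L))

    module _ (basis : EffectiveBasis μ Σ′) where
      open EffectiveBasis basis
      open OrthonormalBasis μ μ≥0 total Σ′ basis A (<⇒≤ 0<A) 1≤Aμ using (Index; indices)
      open Weights μ Σ′ T μ≥0 total ∣T∣²≤1 yz-product A 1≤A 1≤Aμ basis
      open Correlation μ T

      -- `F` equals its expansion only almost everywhere, and this shows that the correlation
      -- evaluates `F` at points of the support only.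
      supp-projection : ∀ {n} ω → supp (dist μ ^⊗ n) ω → supp (mx ^⊗ n) (Vec.map proj₁ ω)
      supp-projection {n} ω ω∈ = <-≤-trans ω∈ (∏-mono-≤ n (λ i → μ≥0 (lookup ω i)) λ i →
        ≤-respʳ-≈ (reflexive (≡.cong (weight mx) (≡.sym (lookup-map i proj₁ ω)))) (μ≤marginalˣ μ≥0 _ _ _))

      module _ {n d} (F : Vec (Fin s) n → ℂ) (F-homogeneous : EffectivelyHomogeneous d F) where
        private
          coefficient : Vec Index n → ℂ
          coefficient χ = if does (effdeg χ ℕ.≟ d) then fourier F χ else 0ᶜ

          F′ : Vec (Fin s) n → ℂ
          F′ x = ∑ᶜ (words indices n) (λ χ → coefficient χ *ᶜ character χ x)

          W : List (Vec Index n)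
          W = words indices n

        F≐F′ : F ≐ F′ [ mx ^⊗ n ]
        F≐F′ x x∈ = ℂᴿ.trans (F-homogeneous x x∈)
          (ℂ∑.∑-cong (λ χ → factor (does (effdeg χ ℕ.≟ d)) (fourier F χ) (character χ x)) W)
          where
          factor : ∀ b u v → (if b then u *ᶜ v else 0ᶜ) ≈ᶜ (if b then u else 0ᶜ) *ᶜ v
          factor true  u v = ℂᴿ.refl {u *ᶜ v}
          factor false u v = ℂᴿ.sym (ℂᴿ.zeroˡ v)

        ‖F‖² : ‖ F ‖[ mx ^⊗ n ] * ‖ F ‖[ mx ^⊗ n ] ≈ ‖ coefficient ‖²⟨ W ⟩
        ‖F‖² = trans (‖‖-square (mx ^⊗ n) (^⊗-nonNeg mx mx≥0 n) F)
          (trans (𝔼-cong-supp (mx ^⊗ n) (^⊗-nonNeg mx mx≥0 n) (λ x x∈ → ∣∣²-cong (F≐F′ x x∈))) (parseval^ n coefficient))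

        module _ (G : Vec (Fin g) n → ℂ) (H : Vec (Fin p) n → ℂ) where

          -- The cut-off at `d` can be inserted since every coefficient vanishes unless the degree
          -- is `d`. It makes the second factor the vector that `HighDegreeBound` controls.
          correlation-expansion : correlation μ T n F G H ≈ᶜ ∑ᶜ W (λ χ → coefficient χ *ᶜ (ind d χ *ᶜ Λ n χ G H))
          correlation-expansion = ℂᴿ.trans
            (𝔼ᶜ-cong-supp (dist μ ^⊗ n) (^⊗-nonNeg (dist μ) μ≥0 n) (λ ω ω∈ →
              ℂᴿ.*-congʳ {∏ᶜ (λ i → T (lookup ω i))} (ℂᴿ.*-congʳ {H (Vec.map (λ t → proj₂ (proj₂ t)) ω)}
                (ℂᴿ.*-congʳ {G (Vec.map (λ t → proj₁ (proj₂ t)) ω)} (F≐F′ (Vec.map proj₁ ω) (supp-projection ω ω∈))))))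
            (ℂᴿ.trans (correlation-∑ˣ n W (λ χ x → coefficient χ *ᶜ character χ x) G H)
              (ℂ∑.∑-cong (λ χ → ℂᴿ.trans (correlation-*ˣ n (coefficient χ) (character χ) G H)
                (restrict χ (effdeg χ ℕ.≟ d) (fourier F χ) (Λ n χ G H))) W))
            where
            restrict : ∀ χ (e : Dec (effdeg χ ≡ d)) u z → (if does e then u else 0ᶜ) *ᶜ z ≈ᶜ (if does e then u else 0ᶜ) *ᶜ (ind d χ *ᶜ z)
            restrict χ (yes e) u z = ℂᴿ.*-congˡ {u} (ℂᴿ.sym (ℂᴿ.trans
              (ℂᴿ.*-congʳ {z} (ℂᴿ.reflexive (ind≡1 {χ = χ} (ℕ.≤-reflexive (≡.sym e))))) (ℂᴿ.*-identityˡ z)))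
            restrict χ (no _) u z = ℂᴿ.trans (ℂᴿ.zeroˡ z) (ℂᴿ.sym (ℂᴿ.zeroˡ (ind d χ *ᶜ z)))

          correlation-≤ : ∀ {Y} → 0# ≤ Y → HighDegreeBound n d (Y * Y) → ∣ correlation μ T n F G H ∣
            ≤ Y * ‖ F ‖[ mx ^⊗ n ] * ‖ G ‖[ marginalʸ μ ^⊗ n ] * ‖ H ‖[ marginalᶻ μ ^⊗ n ]
          correlation-≤ {Y} 0≤Y bounded = ∣∣≤ (((0≤Y ⊠ 0≤F) ⊠ 0≤G) ⊠ 0≤H) (begin
            ∣ correlation μ T n F G H ∣²
              ≈⟨ ∣∣²-cong correlation-expansion ⟩
            ∣ ∑ᶜ W (λ χ → coefficient χ *ᶜ (ind d χ *ᶜ Λ n χ G H)) ∣²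
              ≤⟨ cauchy-schwarz W coefficient (λ χ → ind d χ *ᶜ Λ n χ G H) ⟩
            ‖ coefficient ‖²⟨ W ⟩ * ‖ (λ χ → ind d χ *ᶜ Λ n χ G H) ‖²⟨ W ⟩
              ≤⟨ *-monoˡ-≤ (‖‖²-nonNeg coefficient W) (bounded G H) ⟩
            ‖ coefficient ‖²⟨ W ⟩ * (Y * Y * norms n G H)
              ≈⟨ *-cong (sym ‖F‖²) (*-congˡ (*-cong (sym (‖‖-square (ν n) (ν≥0 n) G)) (sym (‖‖-square (ξ n) (ξ≥0 n) H)))) ⟩
            f * f * (Y * Y * (h * h * (k * k)))
              ≈⟨ solve 4 (λ y f h k → f :* f :* (y :* y :* (h :* h :* (k :* k))) := (y :* f :* h :* k) :* (y :* f :* h :* k)) Y f h k ⟩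
            (Y * f * h * k) * (Y * f * h * k) ∎)
            where
            open ≤-Reasoning
            f h k : ℝ
            f = ‖ F ‖[ mx ^⊗ n ]
            h = ‖ G ‖[ ν n ]
            k = ‖ H ‖[ ξ n ]
            0≤F : 0# ≤ f
            0≤F = ‖‖-nonNeg (mx ^⊗ n) (^⊗-nonNeg mx mx≥0 n) F
            0≤G : 0# ≤ h
            0≤G = ‖‖-nonNeg (ν n) (ν≥0 n) G
            0≤H : 0# ≤ k
            0≤H = ‖‖-nonNeg (ξ n) (ξ≥0 n) H

    -- Choice of the constants

    private
      β : ℝ
      β = (num 2 * A) ⁻¹

      0<2A : 0# < num 2 * A
      0<2A = *-pos (0<num 1) 0<A

      0<β : 0# < β
      0<β = ⁻¹-pos 0<2A

      2Aβ≈1 : num 2 * (A * β) ≈ 1#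
      2Aβ≈1 = trans (sym (*-assoc _ _ _)) (⁻¹-inverse (0<⇒≉0 0<2A))

      β≤1 : β ≤ 1#
      β≤1 = ≤-respʳ-≈ 2Aβ≈1 (≤-via (<⇒≤ 0<β ⊠ (gap 1≤A ⊹ <⇒≤ 0<A))
        (solve 2 (λ A b → # 2 :* (A :* b) :- b := b :* ((A :- # 1) :+ A)) A β))

      32A⁴ : ℝ
      32A⁴ = num 32 * (A * A * (A * A))

      0<32A⁴ : 0# < 32A⁴
      0<32A⁴ = *-pos (0<num 31) (*-pos (*-pos 0<A 0<A) (*-pos 0<A 0<A))

      c₁ : ℝ
      c₁ = β * β * 32A⁴ ⁻¹

      0<c₁ : 0# < c₁
      0<c₁ = *-pos (*-pos 0<β 0<β) (⁻¹-pos 0<32A⁴)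

      32A⁴c₁≈β² : 32A⁴ * c₁ ≈ β * β
      32A⁴c₁≈β² = trans (solve 3 (λ a b i → a :* (b :* i) := b :* (a :* i)) 32A⁴ (β * β) (32A⁴ ⁻¹))
        (trans (*-congˡ (⁻¹-inverse (0<⇒≉0 0<32A⁴))) (*-identityʳ _))

      1≤A² : 1# ≤ A * A
      1≤A² = ≤-respˡ-≈ (*-identityˡ 1#) (*-mono-≤ 0≤1 (<⇒≤ 0<A) 1≤A 1≤A)

      1≤32A⁴ : 1# ≤ 32A⁴
      1≤32A⁴ = ≤-respˡ-≈ (trans (*-congˡ (*-identityˡ 1#)) (*-identityʳ 1#)) (*-mono-≤ 0≤1 (0≤A² ⊠ 0≤A²)
        (≤-via (0≤num 31) (solve 0 (# 32 :- # 1 := # 31))) (*-mono-≤ 0≤1 0≤A² 1≤A² 1≤A²))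
        where
        0≤A² : 0# ≤ A * A
        0≤A² = ≤-trans 0≤1 1≤A²

      c₁≤1 : c₁ ≤ 1#
      c₁≤1 = begin
        c₁             ≈⟨ *-identityˡ _ ⟨
        1# * c₁        ≤⟨ *-monoʳ-≤ (<⇒≤ 0<c₁) 1≤32A⁴ ⟩
        32A⁴ * c₁      ≈⟨ 32A⁴c₁≈β² ⟩
        β * β          ≤⟨ *-mono-≤ (<⇒≤ 0<β) 0≤1 β≤1 β≤1 ⟩
        1# * 1#        ≈⟨ *-identityˡ 1# ⟩
        1#             ∎
        where open ≤-Reasoning

      c₂ : ℝ
      c₂ = c₀ * c₁ ^ suc L

      0<c₂ : 0# < c₂
      0<c₂ = *-pos 0<c₀ (^-pos 0<c₁ (suc L))

      0<β² : 0# < β * β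
      0<β² = *-pos 0<β 0<β

      -- ν₀ has to satisfy 256 ν₀ ≤ c₂, 512 A² ν₀ ≤ β² and 4 ν₀ ≤ 1. A reciprocal of at least m₁ +
      -- m₂ + 4 meets all three at once.
      m₁ m₂ : ℝ
      m₁ = num 256 * c₂ ⁻¹
      m₂ = num 512 * (A * A) * (β * β) ⁻¹

      ν-data : Σ[ Q ∈ ℕ ] Σ[ ν ∈ ℝ ] (ν * fromℕ (suc Q) ≈ 1# × 0# < ν × ν * (m₁ + (m₂ + num 4)) ≤ 1#)
      ν-data = small-reciprocal (m₁ + (m₂ + num 4))

      Q : ℕ
      Q = proj₁ ν-data
      ν₀ : ℝ
      ν₀ = proj₁ (proj₂ ν-data)
      ν₀Q≈1 : ν₀ * fromℕ (suc Q) ≈ 1#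
      ν₀Q≈1 = proj₁ (proj₂ (proj₂ ν-data))
      0<ν₀ : 0# < ν₀
      0<ν₀ = proj₁ (proj₂ (proj₂ (proj₂ ν-data)))
      0≤ν₀ : 0# ≤ ν₀
      0≤ν₀ = <⇒≤ 0<ν₀

      ν₀m≤1 : ν₀ * (m₁ + (m₂ + num 4)) ≤ 1#
      ν₀m≤1 = proj₂ (proj₂ (proj₂ (proj₂ ν-data)))

      0≤m₁ : 0# ≤ m₁
      0≤m₁ = 0≤num 256 ⊠ <⇒≤ (⁻¹-pos 0<c₂)
      0≤m₂ : 0# ≤ m₂
      0≤m₂ = (0≤num 512 ⊠ ≤-trans 0≤1 1≤A²) ⊠ <⇒≤ (⁻¹-pos 0<β²)

      256ν₀≤c₂ : num 256 * ν₀ ≤ c₂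
      256ν₀≤c₂ = reciprocal-≤ 0<c₂ (≤-trans (*-monoˡ-≤ 0≤ν₀ (≤-via (0≤m₂ ⊹ 0≤num 4)
        (solve 2 (λ a b → a :+ b :- a := b) m₁ (m₂ + num 4)))) ν₀m≤1)

      512A²ν₀≤β² : num 512 * (A * A) * ν₀ ≤ β * β
      512A²ν₀≤β² = reciprocal-≤ 0<β² (≤-trans (*-monoˡ-≤ 0≤ν₀ (≤-via (0≤m₁ ⊹ 0≤num 4)
        (solve 3 (λ a b c → a :+ (b :+ c) :- b := a :+ c) m₁ m₂ (num 4)))) ν₀m≤1)

      4ν₀≤1 : num 4 * ν₀ ≤ 1#
      4ν₀≤1 = ≤-respˡ-≈ (*-comm _ _) (≤-trans (*-monoˡ-≤ 0≤ν₀ (≤-via (0≤m₁ ⊹ 0≤m₂)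
        (solve 3 (λ a b c → a :+ (b :+ c) :- c := a :+ b) m₁ m₂ (num 4)))) ν₀m≤1)

      -- (ρ² c₁) ^ (L + 1) = c₁ ^ (L + 1) ρ ^ K
      K : ℕ
      K = L ℕ.+ suc L

    module _ (basis : EffectiveBasis μ Σ′) (n : ℕ) .{{_ : NonZero n}} (d : ℕ) (d≤n : d ℕ.≤ n) (0<d : 0 ℕ.< d) where
      open Bounds μ Σ′ T μ≥0 total ∣T∣²≤1 yz-product A 1≤A 1≤Aμ basis
      open Weights μ Σ′ T μ≥0 total ∣T∣²≤1 yz-product A 1≤A 1≤Aμ basis using (HighDegreeBound)

      private
        0<n : 0# < fromℕ n
        0<n = <-≤-trans (fromℕ-pos 0) (fromℕ-mono-≤ (ℕ.>-nonZero⁻¹ n))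

        ρ ζ η τ : ℝ
        ρ = fromℕ d * fromℕ n ⁻¹
        ζ = ν₀ * ρ ^ suc K
        η = num 2 * ζ
        τ = ρ * ρ * c₁

        0<ρ : 0# < ρ
        0<ρ = *-pos (<-≤-trans (fromℕ-pos 0) (fromℕ-mono-≤ 0<d)) (⁻¹-pos 0<n)
        0≤ρ : 0# ≤ ρ
        0≤ρ = <⇒≤ 0<ρ

        nρ≈d : fromℕ n * ρ ≈ fromℕ d
        nρ≈d = trans (solve 3 (λ n d i → n :* (d :* i) := d :* (n :* i)) (fromℕ n) (fromℕ d) (fromℕ n ⁻¹))
          (trans (*-congˡ (⁻¹-inverse (0<⇒≉0 0<n))) (*-identityʳ _))

        ρ≤1 : ρ ≤ 1#
        ρ≤1 = ≤-respʳ-≈ (⁻¹-inverse (0<⇒≉0 0<n)) (*-monoʳ-≤ (<⇒≤ (⁻¹-pos 0<n)) (fromℕ-mono-≤ d≤n))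

        ρ²≤1 : ρ * ρ ≤ 1#
        ρ²≤1 = ≤-respʳ-≈ (*-identityˡ 1#) (*-mono-≤ 0≤ρ 0≤1 ρ≤1 ρ≤1)

        0<τ : 0# < τ
        0<τ = *-pos (*-pos 0<ρ 0<ρ) 0<c₁

        τ≤1 : τ ≤ 1#
        τ≤1 = ≤-respʳ-≈ (*-identityˡ 1#) (*-mono-≤ (0≤ρ ⊠ 0≤ρ) 0≤1 ρ²≤1 c₁≤1)

        ρ^K≥0 : 0# ≤ ρ ^ suc K
        ρ^K≥0 = ^-nonNeg 0≤ρ (suc K)

        ρ^K≤1 : ρ ^ suc K ≤ 1#
        ρ^K≤1 = ^≤1 0≤ρ ρ≤1 (suc K)

        ρ^K≤ρ² : ρ ^ suc K ≤ ρ * ρ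
        ρ^K≤ρ² = begin
          ρ ^ (suc L ℕ.+ suc L)       ≈⟨ ^-homo-* ρ (suc L) (suc L) ⟩
          ρ * ρ ^ L * (ρ * ρ ^ L)     ≤⟨ *-mono-≤ (0≤ρ ⊠ ^-nonNeg 0≤ρ L) 0≤ρ shrink shrink ⟩
          ρ * ρ                       ∎
          where
          open ≤-Reasoning
          shrink : ρ * ρ ^ L ≤ ρ
          shrink = ≤-respʳ-≈ (*-identityʳ ρ) (*-monoˡ-≤ 0≤ρ (^≤1 0≤ρ ρ≤1 L))

        κτ≈ : c₀ * τ ^ L * τ ≈ c₂ * ρ ^ suc K
        κτ≈ = begin
          c₀ * τ ^ L * τ                                  ≈⟨ solve 3 (λ c t u → c :* t :* u := c :* (u :* t)) c₀ (τ ^ L) τ ⟩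
          c₀ * (ρ * ρ * c₁) ^ suc L                       ≈⟨ *-congˡ (^-distrib-* (ρ * ρ) c₁ (suc L)) ⟩
          c₀ * ((ρ * ρ) ^ suc L * c₁ ^ suc L)             ≈⟨ *-congˡ (*-congʳ (^-distrib-* ρ ρ (suc L))) ⟩
          c₀ * (ρ ^ suc L * ρ ^ suc L * c₁ ^ suc L)       ≈⟨ *-congˡ (*-congʳ (^-homo-* ρ (suc L) (suc L))) ⟨
          c₀ * (ρ ^ suc K * c₁ ^ suc L)                   ≈⟨ solve 3 (λ c r t → c :* (r :* t) := c :* t :* r) c₀ (ρ ^ suc K) (c₁ ^ suc L) ⟩
          c₂ * ρ ^ suc K                                  ∎
          where open ≈-Reasoning

        128η≤κτ : num 128 * η ≤ c₀ * τ ^ L * τ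
        128η≤κτ = ≤-respʳ-≈ (sym κτ≈) (≤-respˡ-≈
          (solve 2 (λ v r → # 256 :* v :* r := # 128 :* (# 2 :* (v :* r))) ν₀ (ρ ^ suc K))
          (*-monoʳ-≤ ρ^K≥0 256ν₀≤c₂))

        256A²η≤ρ²β² : num 256 * (A * A * η) ≤ ρ * ρ * (β * β)
        256A²η≤ρ²β² = begin
          num 256 * (A * A * η)                     ≈⟨ solve 3 (λ A v r → # 256 :* (A :* A :* (# 2 :* (v :* r))) := r :* (# 512 :* (A :* A) :* v)) A ν₀ (ρ ^ suc K) ⟩
          ρ ^ suc K * (num 512 * (A * A) * ν₀)      ≤⟨ *-mono-≤ ρ^K≥0 (<⇒≤ 0<β²) ρ^K≤ρ² 512A²ν₀≤β² ⟩
          ρ * ρ * (β * β)                           ∎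
          where open ≤-Reasoning

        2η≤1 : num 2 * η ≤ 1#
        2η≤1 = begin
          num 2 * η                  ≈⟨ solve 2 (λ v r → # 2 :* (# 2 :* (v :* r)) := # 4 :* v :* r) ν₀ (ρ ^ suc K) ⟩
          num 4 * ν₀ * ρ ^ suc K     ≤⟨ *-mono-≤ (0≤num 4 ⊠ 0≤ν₀) 0≤1 4ν₀≤1 ρ^K≤1 ⟩
          1# * 1#                    ≈⟨ *-identityˡ 1# ⟩
          1#                         ∎
          where open ≤-Reasoning

      high-degree-bound : HighDegreeBound n d ((1# - ζ) ^ ⌈ d /2⌉ * (1# - ζ) ^ ⌈ d /2⌉)
      high-degree-bound = bound-decay β c₁ ρ (c₀ * τ ^ L) η (<⇒≤ 0<β) 2Aβ≈1 (<⇒≤ 0<c₁)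
        (≤-reflexive (trans (sym (*-assoc _ _ _)) 32A⁴c₁≈β²)) 0≤ρ (*-pos 0<c₀ (^-pos 0<τ L)) (0≤num 2 ⊠ 0≤ν₀ ⊠ ρ^K≥0)
        2η≤1 128η≤κτ 256A²η≤ρ²β² (base-inequality τ 0<τ τ≤1) {d = d} {n₀ = n} {h = ⌊ d /2⌋} refl (≤-reflexive nρ≈d) d≤2[h+1]
        n ⌈ d /2⌉ d ℕ.≤-refl (ℕ.≤-reflexive (ℕ.⌊n/2⌋+⌈n/2⌉≡n d))
        where
        d≤2[h+1] : d ℕ.≤ 2 ℕ.* suc ⌊ d /2⌋
        d≤2[h+1] = ℕ.≤-trans (ℕ.≤-reflexive (≡.sym (ℕ.⌊n/2⌋+⌈n/2⌉≡n d)))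
          (ℕ.+-mono-≤ (ℕ.n≤1+n ⌊ d /2⌋) (ℕ.≤-trans (ℕ.⌊n/2⌋-mono (ℕ.n≤1+n (suc d))) (ℕ.m≤m+n (suc ⌊ d /2⌋) 0)))

      0≤1-ζ : 0# ≤ 1# - ζ
      0≤1-ζ = gap (≤-trans (≤-via (((0≤num 3 ⊠ 0≤ν₀) ⊠ ρ^K≥0)) (solve 2 (λ v r → # 2 :* (# 2 :* (v :* r)) :- v :* r := (# 3 :* v) :* r) ν₀ (ρ ^ suc K))) 2η≤1)

    decay : Σ[ c ∈ ℝ ] Σ[ C ∈ ℝ ] (0# < c × 0# < C ×
      ((basis : EffectiveBasis μ Σ′) (n : ℕ) → .{{NonZero n}} → (d : ℕ) →
       (G : Vec (Fin g) n → ℂ) (H : Vec (Fin p) n → ℂ) (F : Vec (Fin s) n → ℂ) →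
       EffectiveBasis.EffectivelyHomogeneous basis d F →
       ∣ correlation μ T n F G H ∣
         ≤ fromℕ 2 ^ʳ (- (c * (fromℕ d * (fromℕ d * (fromℕ n) ⁻¹) ^ʳ C)))
           * ‖ F ‖[ marginalˣ μ ^⊗ n ] * ‖ G ‖[ marginalʸ μ ^⊗ n ] * ‖ H ‖[ marginalᶻ μ ^⊗ n ]))
    -- C = K + 1 = 2 (L + 1) = 200 M + 2. The factor 1 / 2 in c arises because the gain occurs ⌈d /
    -- 2⌉ ≥ d / 2 times.
    decay = c , fromℕ (suc K) , *-pos 0<ν₀ 0<½ , fromℕ-pos K , bound
      where
      ½ c : ℝ
      ½ = (1# + 1#) ⁻¹
      c = ν₀ * ½
      0<½ : 0# < ½
      0<½ = ⁻¹-pos (0<num 1)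
      c+c≈ν₀ : c + c ≈ ν₀
      c+c≈ν₀ = trans (solve 2 (λ v h → v :* h :+ v :* h := v :* ((# 1 :+ # 1) :* h)) ν₀ ½)
        (trans (*-congˡ (⁻¹-inverse (0<⇒≉0 (0<num 1)))) (*-identityʳ ν₀))

      module _ (basis : EffectiveBasis μ Σ′) (n : ℕ) .{{_ : NonZero n}} (d : ℕ)
        (G : Vec (Fin g) n → ℂ) (H : Vec (Fin p) n → ℂ) (F : Vec (Fin s) n → ℂ)
        (F-homogeneous : EffectiveBasis.EffectivelyHomogeneous basis d F) where
        open Bounds μ Σ′ T μ≥0 total ∣T∣²≤1 yz-product A 1≤A 1≤Aμ basis
        open Weights μ Σ′ T μ≥0 total ∣T∣²≤1 yz-product A 1≤A 1≤Aμ basis using (HighDegreeBound)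

        E : ℝ
        E = fromℕ 2 ^ʳ (- (c * (fromℕ d * (fromℕ d * (fromℕ n) ⁻¹) ^ʳ fromℕ (suc K))))

        conclude : ∀ {Y} → 0# ≤ Y → Y ≤ E → HighDegreeBound n d (Y * Y) → ∣ correlation μ T n F G H ∣
          ≤ E * ‖ F ‖[ marginalˣ μ ^⊗ n ] * ‖ G ‖[ marginalʸ μ ^⊗ n ] * ‖ H ‖[ marginalᶻ μ ^⊗ n ]
        conclude 0≤Y Y≤E bounded = ≤-trans (correlation-≤ basis F F-homogeneous G H 0≤Y bounded)
          (*-monoʳ-≤ (‖‖-nonNeg (marginalᶻ μ ^⊗ n) (^⊗-nonNeg (marginalᶻ μ) (marginalᶻ-nonNeg μ≥0) n) H)
            (*-monoʳ-≤ (‖‖-nonNeg (marginalʸ μ ^⊗ n) (^⊗-nonNeg (marginalʸ μ) (marginalʸ-nonNeg μ≥0) n) G)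
              (*-monoʳ-≤ (‖‖-nonNeg (mx ^⊗ n) (^⊗-nonNeg mx mx≥0 n) F) Y≤E)))

        d≤2⌈d/2⌉ : d ℕ.≤ 2 ℕ.* ⌈ d /2⌉
        d≤2⌈d/2⌉ = ℕ.≤-trans (ℕ.≤-reflexive (≡.sym (ℕ.⌊n/2⌋+⌈n/2⌉≡n d)))
          (ℕ.+-mono-≤ (ℕ.⌊n/2⌋≤⌈n/2⌉ d) (ℕ.m≤m+n ⌈ d /2⌉ 0))

        bound : ∣ correlation μ T n F G H ∣
          ≤ E * ‖ F ‖[ marginalˣ μ ^⊗ n ] * ‖ G ‖[ marginalʸ μ ^⊗ n ] * ‖ H ‖[ marginalᶻ μ ^⊗ n ]
        bound with d ℕ.≤? n | 0 ℕ.<? d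
        -- No character has effective degree above n, so the bound holds with the constant 0.
        ... | no d≰n | _ = conclude ≤-refl (2^ʳ-nonNeg _)
                (bound-vacuous {n} {d} (ℕ.≰⇒> d≰n) (≤-reflexive (sym (zeroˡ 0#))))
        ... | yes d≤n | yes 0<d = conclude (^-nonNeg (0≤1-ζ basis n d d≤n 0<d) ⌈ d /2⌉)
                ([1-ν[d/n]^k]^N≤2^ʳ Q d n ⌈ d /2⌉ K ν₀Q≈1 c+c≈ν₀ d≤n d≤2⌈d/2⌉)
                (high-degree-bound basis n d d≤n 0<d)
        -- For d = 0 the threshold τ would be 0, where the base case says nothing. Here the trivial
        -- constant 1 is enough, since the exponent of the claim vanishes.
        ... | yes d≤n | no d≮ = conclude 0≤1
                ([1-ν[d/n]^k]^N≤2^ʳ Q d n 0 K ν₀Q≈1 c+c≈ν₀ d≤n (ℕ.≮⇒≥ d≮))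
                (bound-mono {n} {d} (≤-reflexive (sym (*-identityˡ 1#))) (bound-1 n d))

theorem4p12 : (ℛ : CompleteOrderedField) → let open Theory ℛ in
  (s g p : ℕ) (μ : Fin s × Fin g × Fin p → ℝ) (Σ′ : Subset s) (T : Fin s × Fin g × Fin p → ℂ) →
  IsDistribution (dist μ) →
  DiskValuedOnSupport μ T →
  ¬ EmbeddableOverDisk μ T →
  RelaxedBaseCase μ Σ′ T →
  Σ[ c ∈ ℝ ] Σ[ C ∈ ℝ ] (0# < c × 0# < C ×
    ((basis : EffectiveBasis μ Σ′) (n : ℕ) → .{{NonZero n}} → (d : ℕ) →
     (G : Vec (Fin g) n → ℂ) (H : Vec (Fin p) n → ℂ) (F : Vec (Fin s) n → ℂ) →
     EffectiveBasis.EffectivelyHomogeneous basis d F →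
     ∣ correlation μ T n F G H ∣
       ≤ fromℕ 2 ^ʳ (- (c * (fromℕ d * (fromℕ d * (fromℕ n) ⁻¹) ^ʳ C)))
         * ‖ F ‖[ marginalˣ μ ^⊗ n ] * ‖ G ‖[ marginalʸ μ ^⊗ n ] * ‖ H ‖[ marginalᶻ μ ^⊗ n ]))
theorem4p12 ℛ s g p μ Σ′ T μ-distribution disk _ relaxed =
  Conclusion.decay ℛ μ Σ′ T nonNegative total disk relaxed
  where open Theory.IsDistribution μ-distribution
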